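{- Let $m\ge 7$ and let $R_m=R(G_1,\dots,G_m)$ be a ring all of whose hinges are edges. Let $R'_m$ be obtained from $R_m$ by performing, for each link $G_i$, a Henneberg-II extension whose base vertex set is the set of hinge vertices $\{a_i,b_i,c_i,d_i\}$ of $G_i$ and which deletes a hinge edge of $G_i$. If $R_m$ is independent, each $G_i$ is rigid, and for each $i$ the graph obtained from $G_i$ by deleting its hinge edges is nucleation-free, then $R'_m$ is independent and nucleation-free, and each of its hinges is implied.
   Context: All graphs are finite and simple. Rank, independence, rigidity and circuits refer to the 3-dimensional generic rigidity matroid $\mathcal{R}_3$; $\mathrm{rank}(G)$ is the rank of $E(G)$. $G$ is independent if $\mathrm{rank}(G)=|E(G)|$; rigid if $\mathrm{rank}(G)$ equals the rank of the complete graph on $V(G)$ ($=3|V(G)|-6$ when $|V(G)|\ge 3$). A nonedge $f$ of $G$ is implied if $G\cup f$ contains a circuit containing $f$. A nucleation is a rigid subgraph on at least $5$ vertices; nucleation-free means having none. Ring: given $m\ge 3$ vertex-disjoint graphs $G_1,\dots,G_m$ (links), each with four distinct hinge vertices $a_i,b_i,c_i,d_i$, the ring $R(G_1,\dots,G_m)$ is obtained by identifying $a_1$ with $c_m$, $b_1$ with $d_m$, and, for $1\le i\le m-1$, $c_i$ with $a_{i+1}$ and $d_i$ with $b_{i+1}$. The pairs $(a_i,b_i)$ and $(c_i,d_i)$ are the hinges (of $G_i$ and of the ring). Henneberg-II extension: choose four existing vertices $W$ (the base vertex set) inducing at least one edge, delete one such edge, and add a new vertex adjacent to all vertices of $W$.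 -}

module Defs where

open import Data.Nat using (ℕ; zero; suc; _≤_)
open import Data.Nat.DivMod using (_mod_)
open import Data.Fin using (Fin; zero; suc; toℕ) renaming (_≟_ to _≟F_)
open import Data.Bool using (Bool; true; false; if_then_else_)
open import Data.Rational using (ℚ; 0ℚ; _+_; _*_; _-_)
open import Data.List using (List; []; _∷_; length; lookup; tabulate; foldr; removeAt)
open import Data.List.Relation.Unary.All using (All)
open import Data.List.Relation.Unary.Any using (Any)
open import Data.List.Relation.Unary.AllPairs using (AllPairs)
open import Data.List.Relation.Unary.Unique.Propositional using (Unique)
open import Data.List.Membership.Propositional using (_∈_)
open import Data.Product using (Σ; Σ-syntax; _×_; _,_; proj₁; proj₂)
open import Data.Sum using (_⊎_; inj₁; inj₂)
open import Data.Unit using (⊤)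
open import Data.Empty using (⊥)
open import Relation.Nullary using (¬_; yes; no)
open import Relation.Binary.PropositionalEquality using (_≡_; _≢_)
open import Relation.Binary.Definitions using (DecidableEquality)
import Data.Sum.Properties as SumP
import Data.Product.Properties as ProdP

-- Graphs: a vertex type with decidable equality and an adjacency
-- relation (finite simple graphs are obtained by instantiating V with
-- a finite type and Adj with a symmetric irreflexive relation).

record Graph : Set₁ where
  field
    V   : Set
    eq  : DecidableEquality V
    Adj : V → V → Set

open Graph public

-- an (ordered representative of an) edge
Pair : Set → Set
Pair V = V × V

SameEdge : {V : Set} → Pair V → Pair V → Set
SameEdge (u , v) (x , y) = (u ≡ x × v ≡ y) ⊎ (u ≡ y × v ≡ x)

SimpleList : {V : Set} → List (Pair V) → Set
SimpleList L = All (λ e → proj₁ e ≢ proj₂ e) L × AllPairs (λ e f → ¬ SameEdge e f) L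

AdjP : (G : Graph) → Pair (V G) → Set
AdjP G (u , v) = Adj G u v

-- The 3-dimensional rigidity matroid.
-- A placement p : V → ℚ³; the rigidity-matrix row of edge uv has
-- entry p(u)-p(v) in the columns of u, p(v)-p(u) in those of v, 0 else.

Σℚ : List ℚ → ℚ
Σℚ = foldr _+_ 0ℚ

rowEntry : {V : Set} → DecidableEquality V → (V → Fin 3 → ℚ) →
           Pair V → V → Fin 3 → ℚ
rowEntry eqV p (u , v) w c with eqV w u | eqV w v
... | yes _ | _     = p u c - p v c
... | no _  | yes _ = p v c - p u c
... | no _  | no _  = 0ℚ

RowsIndependentAt : {V : Set} → DecidableEquality V → (V → Fin 3 → ℚ) →
                    List (Pair V) → Set
RowsIndependentAt eqV p L =
  (lam : Fin (length L) → ℚ) →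
  ((w : _) (c : Fin 3) →
     Σℚ (tabulate (λ k → lam k * rowEntry eqV p (lookup L k) w c)) ≡ 0ℚ) →
  (k : Fin (length L)) → lam k ≡ 0ℚ

-- independence in the generic 3-dim rigidity matroid: the rows are
-- independent at a generic (equivalently: at some rational) placement
IndepR3 : {V : Set} → DecidableEquality V → List (Pair V) → Set
IndepR3 {V} eqV L = Σ (V → Fin 3 → ℚ) λ p → RowsIndependentAt eqV p L

-- rank(E) = rank(K_U) for the graph (U , E), where U is given by a
-- predicate InV and E by a predicate InE on pairs (edges of E lie in U):
-- every independent edge set on U is matched in size by an
-- independent subset of E.
RigidWrt : {V : Set} → DecidableEquality V → (V → Set) → (Pair V → Set) → Set
RigidWrt {V} eqV InV InE =
  (L : List (Pair V)) → SimpleList L →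
  All (λ e → InV (proj₁ e) × InV (proj₂ e)) L → IndepR3 eqV L →
  Σ (List (Pair V)) λ S → SimpleList S × All InE S × IndepR3 eqV S ×
    (length L ≤ length S)

-- G is independent: rank(E(G)) = |E(G)|, i.e. every (sub)set of edges,
-- in particular E(G) itself, is independent
Independent : Graph → Set
Independent G = (L : List (Pair (V G))) → SimpleList L → All (AdjP G) L →
                IndepR3 (eq G) L

Rigid : Graph → Set
Rigid G = RigidWrt (eq G) (λ _ → ⊤) (AdjP G)

NucleationFree : Graph → Set
NucleationFree G =
  (Us : List (V G)) (Es : List (Pair (V G))) → Unique Us → 5 ≤ length Us →
  SimpleList Es →
  All (λ e → AdjP G e × (proj₁ e ∈ Us) × (proj₂ e ∈ Us)) Es →
  ¬ RigidWrt (eq G) (λ x → x ∈ Us) (λ e → Any (SameEdge e) Es)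

Circuit : {V : Set} → DecidableEquality V → List (Pair V) → Set
Circuit eqV C = ¬ IndepR3 eqV C × ((k : Fin (length C)) → IndepR3 eqV (removeAt C k))

Implied : (G : Graph) → Pair (V G) → Set
Implied G f =
  (proj₁ f ≢ proj₂ f) × ¬ AdjP G f ×
  Σ (List (Pair (V G))) λ C → SimpleList C ×
    All (λ e → AdjP G e ⊎ SameEdge e f) C × Any (SameEdge f) C × Circuit (eq G) C

-- Links and rings.
-- A link with k further vertices has vertex set Fin 4 ⊎ Fin k, the hinge
-- vertices being a = inj₁ 0, b = inj₁ 1, c = inj₁ 2, d = inj₁ 3.

LV : ℕ → Set
LV k = Fin 4 ⊎ Fin k

eqLV : (k : ℕ) → DecidableEquality (LV k)
eqLV k = SumP.≡-dec _≟F_ _≟F_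

hA hB hC hD : {k : ℕ} → LV k
hA = inj₁ zero
hB = inj₁ (suc zero)
hC = inj₁ (suc (suc zero))
hD = inj₁ (suc (suc (suc zero)))

linkGraph : (k : ℕ) → (LV k → LV k → Set) → Graph
linkGraph k A = record { V = LV k ; eq = eqLV k ; Adj = A }

linkMinusHinges : (k : ℕ) → (LV k → LV k → Set) → Graph
linkMinusHinges k A = record
  { V = LV k ; eq = eqLV k
  ; Adj = λ x y → A x y × ¬ SameEdge (x , y) (hA , hB) × ¬ SameEdge (x , y) (hC , hD) }

-- cyclic successor on Fin m (indices 0..m-1 instead of 1..m)
sucMod : {m : ℕ} → Fin m → Fin m
sucMod {suc k} i = suc (toℕ i) mod suc k

-- Ring vertices: hinge vertices (j , 0), (j , 1) for the ring hinge j
-- (= (a_j , b_j) = (c_{j-1} , d_{j-1})), and internal vertices of links.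
RV : (m : ℕ) → (Fin m → ℕ) → Set
RV m n = (Fin m × Fin 2) ⊎ Σ (Fin m) (λ i → Fin (n i))

eqRV : (m : ℕ) (n : Fin m → ℕ) → DecidableEquality (RV m n)
eqRV m n = SumP.≡-dec (ProdP.≡-dec _≟F_ _≟F_) (ProdP.≡-dec _≟F_ _≟F_)

ι : {m : ℕ} {n : Fin m → ℕ} (i : Fin m) → LV (n i) → RV m n
ι i (inj₁ zero)                   = inj₁ (i , zero)
ι i (inj₁ (suc zero))             = inj₁ (i , suc zero)
ι i (inj₁ (suc (suc zero)))       = inj₁ (sucMod i , zero)
ι i (inj₁ (suc (suc (suc zero)))) = inj₁ (sucMod i , suc zero)
ι i (inj₂ x)                      = inj₂ (i , x)

ringAdj : (m : ℕ) (n : Fin m → ℕ) → ((i : Fin m) → LV (n i) → LV (n i) → Set) →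
          RV m n → RV m n → Set
ringAdj m n G u v =
  Σ (Fin m) λ i → Σ (LV (n i)) λ x → Σ (LV (n i)) λ y →
    G i x y × ι i x ≡ u × ι i y ≡ v

ring : (m : ℕ) (n : Fin m → ℕ) → ((i : Fin m) → LV (n i) → LV (n i) → Set) → Graph
ring m n G = record { V = RV m n ; eq = eqRV m n ; Adj = ringAdj m n G }

hingePair : {m : ℕ} {n : Fin m → ℕ} → Fin m → Pair (RV m n)
hingePair j = (inj₁ (j , zero) , inj₁ (j , suc zero))

-- the ring hinge deleted by the Henneberg-II extension at link i:
-- s i = false : the hinge edge a_i b_i ; s i = true : the hinge edge c_i d_i
deletedHinge : {m : ℕ} → (Fin m → Bool) → Fin m → Fin m
deletedHinge s i = if s i then sucMod i else i

baseVerts : {m : ℕ} {n : Fin m → ℕ} → Fin m → List (RV m n)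
baseVerts i = ι i hA ∷ ι i hB ∷ ι i hC ∷ ι i hD ∷ []

-- vertices of R'_m: ring vertices and one new vertex per link
RV' : (m : ℕ) → (Fin m → ℕ) → Set
RV' m n = RV m n ⊎ Fin m

ring'Adj : (m : ℕ) (n : Fin m → ℕ) → ((i : Fin m) → LV (n i) → LV (n i) → Set) →
           (Fin m → Bool) → RV' m n → RV' m n → Set
ring'Adj m n G s (inj₁ u) (inj₁ v) =
  ringAdj m n G u v × ((i : Fin m) → ¬ SameEdge (u , v) (hingePair (deletedHinge s i)))
ring'Adj m n G s (inj₁ u) (inj₂ i) = u ∈ baseVerts i
ring'Adj m n G s (inj₂ i) (inj₁ u) = u ∈ baseVerts i
ring'Adj m n G s (inj₂ i) (inj₂ j) = ⊥

ring' : (m : ℕ) (n : Fin m → ℕ) → ((i : Fin m) → LV (n i) → LV (n i) → Set) →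
        (Fin m → Bool) → Graph
ring' m n G s = record
  { V = RV' m n ; eq = SumP.≡-dec (eqRV m n) _≟F_ ; Adj = ring'Adj m n G s }

hingePair' : {m : ℕ} {n : Fin m → ℕ} → Fin m → Pair (RV' m n)
hingePair' j = (inj₁ (inj₁ (j , zero)) , inj₁ (inj₁ (j , suc zero)))

{-# OPTIONS --safe #-}
module Submission where

-- Independence of R'. Put the new vertex of each link on the line through the hinge whose edge is deleted,
-- at a placement where R is independent and the two hinges of each link are not coplanar: there the extension
-- neither creates nor loses a stress. Both conditions are nonvanishing conditions on polynomials in the
-- coordinates, so they can be met simultaneously; the same symbolic elimination decides IndepR3.
--
-- Implied hinges. Let Q consist of bases of the links, all hinges, and three edges at every new vertex. Q is
-- independent and has as many edges as R'. As the links are rigid, the fourth edge at a new vertex lies in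
-- the span of Q, hence so do R' and the hinges. So R' plus a hinge is dependent, and a circuit is obtained
-- by dropping superfluous edges.
--
-- No nucleation. R' has no hinge edges, so its links are edge disjoint. A set of u ≥ 5 vertices of one link
-- spans at most 3u - 7 edges there. If a vertex set of size at least 5 meets every hinge, summing the bounds
-- over the links leaves a surplus of at least one per link, that is m ≥ 7; otherwise the ring is cut at a hinge it misses
-- and the links are glued one by one. Either way at most 3|U| - 7 edges are spanned, while a rigid subgraph
-- needs 3|U| - 6.

open import Defs
open import Data.Bool using (Bool; true; false; if_then_else_; _∧_; _∨_) renaming (_≟_ to _≟B_)
open import Data.Bool.Properties using (∨-identityʳ)
open import Data.Empty using (⊥; ⊥-elim)
open import Data.Fin using (Fin; zero; suc; toℕ; fromℕ; fromℕ<; inject₁; cast; punchIn; punchOut; combine; remQuot; join; splitAt) renaming (_≟_ to _≟F_)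
import Data.Fin.Properties as Finₚ
open import Data.Fin.Relation.Unary.Top using (view; ‵fromℕ; ‵inj₁)
open import Data.List using (List; []; _∷_; length; lookup; tabulate; _++_; map; concat; allFin; removeAt)
open import Data.List.Properties using (length-map; length-++; map-++; ++-identityʳ)
open import Data.List.Membership.Propositional using (_∈_; find; lose)
open import Data.List.Membership.Propositional.Properties using (∈-lookup; ∈-allFin; ∈-map⁺; ∈-map⁻; ∈-++⁺ˡ; ∈-++⁺ʳ; ∈-concat⁺′; ∈-concat⁻′; ∈-tabulate⁺; ∈-tabulate⁻)
open import Data.List.Relation.Binary.Permutation.Homogeneous using (onIndices)
open import Data.List.Relation.Binary.Permutation.Propositional using (_↭_; ↭-sym; ↭⇒↭ₛ)
open import Data.List.Relation.Binary.Permutation.Propositional.Properties using (shift; shifts)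
open import Data.List.Relation.Binary.Permutation.Setoid.Properties using (onIndices-lookup)
open import Data.List.Relation.Binary.Sublist.Propositional using (_⊆_; []; _∷_; _∷ʳ_; ⊆-refl)
import Data.List.Relation.Binary.Sublist.Propositional as Sublist
open import Data.List.Relation.Binary.Sublist.Propositional.Properties using (All-resp-⊆; ++⁺)
open import Data.List.Relation.Unary.All using (All; []; _∷_)
import Data.List.Relation.Unary.All as All
import Data.List.Relation.Unary.All.Properties as Allₚ
open import Data.List.Relation.Unary.AllPairs using (AllPairs; []; _∷_)
import Data.List.Relation.Unary.AllPairs as AllPairs
import Data.List.Relation.Unary.AllPairs.Properties as AllPairsₚ
open import Data.List.Relation.Unary.Any using (Any; here; there)
import Data.List.Relation.Unary.Any as Any
import Data.List.Relation.Unary.Any.Properties as Anyₚ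
open import Data.List.Relation.Unary.Unique.Propositional using (Unique)
import Data.List.Relation.Unary.Unique.Propositional.Properties as Uniqueₚ
open import Data.Nat using (ℕ; zero; suc; _≤_; z≤n; s≤s)
import Data.Nat as ℕ
open import Data.Nat.DivMod using (m<n⇒m%n≡m; n%n≡0; m%n<n)
import Data.Nat.Properties as ℕₚ
open import Data.Nat.Solver using () renaming (module +-*-Solver to ℕ-Solver)
open import Data.Product using (Σ; ∃; _×_; _,_; proj₁; proj₂)
open import Data.Rational using (ℚ; 0ℚ; 1ℚ)
import Data.Rational as ℚ
import Data.Rational.Properties as ℚₚ
open import Data.Rational.Solver using (module +-*-Solver)
open import Data.Sum using (_⊎_; inj₁; inj₂; [_,_]′)
open import Data.Unit using (⊤; tt)
open import Data.Vec using (Vec; []; _∷_)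
import Data.Vec as Vec
import Data.Vec.Properties as Vecₚ
open import Function using (_∘_; id)
open import Function.Bundles using (Inverse)
open import Function.Definitions using (Injective)
open import Relation.Binary.Definitions using (DecidableEquality)
open import Relation.Binary.PropositionalEquality using (_≡_; _≢_; refl; sym; trans; cong; cong₂; subst; subst₂; setoid; module ≡-Reasoning)
open import Relation.Nullary using (¬_; Dec; yes; no)
open import Relation.Nullary.Decidable using (¬?; decidable-stable; toWitness; _→-dec_; _×-dec_; _⊎-dec_)
import Algebra.Properties.CommutativeMonoid.Sum ℕₚ.+-0-commutativeMonoid as Sum
open Sum using () renaming (sum to ∑ℕ)

-- Counting edges around the ring

-- The map `deletedHinge s` is injective on `Fin m`, hence onto. So every hinge edge disappears,
-- which is what makes the links edge disjoint, and each disappears only once, so that the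
-- extensions can trade hinge edges for stars one at a time. Adjacency is an arbitrary relation, so
-- the edges of a graph cannot be enumerated. Rigidity supplies lists instead: tested against an
-- independent set of 3v - 6 pairs, it returns at least that many edges. The number 7 is one more
-- than the six rigid motions. The critical link for the count has both hinges and the new vertex
-- inside the set: four new edges face three new coordinates. The missing unit comes from the two
-- hinge edges, which are absent from R' although the link with them is still independent, so its
-- other edges stay two below 3u - 6. Gluing along a chain cannot express the last identification of
-- a closed ring. When every hinge is met, the hinge vertices are therefore shared evenly between
-- their two links, and one unit per link remains.

sucMod-inject₁ : ∀ {k} (i : Fin k) → sucMod (inject₁ i) ≡ suc i
sucMod-inject₁ {k} i = Finₚ.toℕ-injective (trans (Finₚ.toℕ-fromℕ< (m%n<n (suc (toℕ (inject₁ i))) (suc k)))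
  (trans (cong (λ t → suc t ℕ.% suc k) (Finₚ.toℕ-inject₁ i)) (m<n⇒m%n≡m (s≤s (Finₚ.toℕ<n i)))))

sucMod-fromℕ : ∀ k → sucMod (fromℕ k) ≡ zero
sucMod-fromℕ k = Finₚ.toℕ-injective (trans (Finₚ.toℕ-fromℕ< (m%n<n (suc (toℕ (fromℕ k))) (suc k)))
  (trans (cong (λ t → suc t ℕ.% suc k) (Finₚ.toℕ-fromℕ k)) (n%n≡0 (suc k))))

module DegreesOfFreedom where
  open import Data.Nat using (_+_; _*_; _∸_; _≤?_)
  open ℕ-Solver using (solve; _:+_; _:*_; _:=_; con)

  tri : ℕ → ℕ
  tri zero    = 0
  tri (suc u) = u + tri u

  isPair : ℕ → Bool
  isPair 2 = true
  isPair _ = false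

  -- A lower bound for 3u - e over the edge sets met by a nucleation: e edges of one link on u of its vertices.
  -- The flag says whether both vertices of a (deleted, hence nonadjacent) hinge are among them.
  gap : ℕ → Bool → ℕ
  gap 0 _     = 0
  gap 1 _     = 3
  gap 2 false = 5
  gap 2 true  = 6
  gap 3 false = 6
  gap 3 true  = 7
  gap 4 false = 6
  gap 4 true  = 7
  gap (suc (suc (suc (suc (suc _))))) _ = 7

  dof : Bool → ℕ → ℕ
  dof b u = gap u b

  -- `h` and `h′` count the vertices met on the two hinges of a link, `z` the interior ones together
  -- with the new vertex, and `e` all edges met. The ring arithmetic sees a link only through these
  -- numbers; the bounds by 2 help to make its case tables finite.
  record LinkCount (h h′ z e : ℕ) : Set where
    field
      bound : e + dof (isPair h ∨ isPair h′) (h + h′ + z) ≤ (h + h′ + z) * 3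
      h≤2   : h ≤ 2
      h′≤2  : h′ ≤ 2

  asFin : ∀ {k n} → k ℕ.< n → ∃ λ (i : Fin n) → toℕ i ≡ k
  asFin k<n = fromℕ< k<n , Finₚ.toℕ-fromℕ< k<n

  dof≤7 : ∀ b u → dof b u ≤ 7
  dof≤7 b     0 = z≤n
  dof≤7 b     1 = ℕₚ.m≤m+n 3 4
  dof≤7 false 2 = ℕₚ.m≤m+n 5 2
  dof≤7 true  2 = ℕₚ.m≤m+n 6 1
  dof≤7 false 3 = ℕₚ.m≤m+n 6 1
  dof≤7 false 4 = ℕₚ.m≤m+n 6 1
  dof≤7 true  3 = ℕₚ.≤-refl
  dof≤7 true  4 = ℕₚ.≤-refl
  dof≤7 b (suc (suc (suc (suc (suc _))))) = ℕₚ.≤-refl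

  -- Below five link vertices it suffices to count pairs, less one when a hinge is whole, since its
  -- edge is absent. Two whole hinges are excluded: with one edge discounted, the four edges at the
  -- new vertex would break the bound. The finitely many cases are settled by evaluation.
  smallCase : ∀ (h h′ : Fin 3) (y : Fin 5) (ξ : Fin 2) →
    toℕ h + toℕ h′ + toℕ y ≤ 4 → isPair (toℕ h) ∧ isPair (toℕ h′) ≡ false →
    (if isPair (toℕ h) ∨ isPair (toℕ h′) then tri (toℕ h + toℕ h′ + toℕ y) ∸ 1 else tri (toℕ h + toℕ h′ + toℕ y))
      + toℕ ξ * (toℕ h + toℕ h′) + dof (isPair (toℕ h) ∨ isPair (toℕ h′)) (toℕ h + toℕ h′ + (toℕ y + toℕ ξ))
    ≤ (toℕ h + toℕ h′ + (toℕ y + toℕ ξ)) * 3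
  smallCase = toWitness {a? = Finₚ.all? λ h → Finₚ.all? λ h′ → Finₚ.all? λ y → Finₚ.all? λ ξ →
    (_ ≤? _) →-dec ((_ ≟B _) →-dec (_ ≤? _))} tt

  -- A new vertex with at most three neighbours in the set pays for its edges with its own three
  -- coordinates.
  threeShared : ∀ h h′ → h ≤ 2 → h′ ≤ 2 → isPair h ∧ isPair h′ ≡ false → h + h′ ≤ 3
  threeShared h h′ h≤ h′≤ with asFin (s≤s h≤) | asFin (s≤s h′≤)
  ... | i , refl | j , refl = table i j
    where
    table : ∀ (i j : Fin 3) → isPair (toℕ i) ∧ isPair (toℕ j) ≡ false → toℕ i + toℕ j ≤ 3
    table = toWitness {a? = Finₚ.all? λ i → Finₚ.all? λ j → (_ ≟B _) →-dec (_ ≤? _)} tt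

  -- `y` counts interior vertices, `ξ` the new vertex, `e₀` and `e₁` the old and the new edges. With
  -- two whole hinges the new vertex may bring four edges against three coordinates, and the `8` of
  -- that hypothesis, one above 7, absorbs the excess. Otherwise it brings at most three, and either
  -- the bound for five or more link vertices or the table applies.
  linkCount : ∀ {h h′ y ξ e₀ e₁} → h ≤ 2 → h′ ≤ 2 → ξ ≤ 1 → e₁ ≤ ξ * (h + h′) → e₀ ≤ tri (h + h′ + y) →
    (isPair h ∨ isPair h′ ≡ true → suc e₀ ≤ tri (h + h′ + y)) →
    (isPair h ∧ isPair h′ ≡ true → e₀ + 8 ≤ (h + h′ + y) * 3) →
    (5 ≤ h + h′ + y → e₀ + 7 ≤ (h + h′ + y) * 3) → LinkCount h h′ (y + ξ) (e₀ + e₁)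
  linkCount {h} {h′} {y} {ξ} {e₀} {e₁} h≤2 h′≤2 ξ≤1 new all-pairs one-hinge two-hinges nucleationFree =
      record { bound = bound (isPair h ∧ isPair h′) refl ; h≤2 = h≤2 ; h′≤2 = h′≤2 }
    where
    open ℕₚ.≤-Reasoning
    u = h + h′ + y
    b = isPair h ∨ isPair h′
    spread : u * 3 + ξ * 3 ≡ (h + h′ + (y + ξ)) * 3
    spread = trans (sym (ℕₚ.*-distribʳ-+ 3 u ξ)) (cong (_* 3) (ℕₚ.+-assoc (h + h′) y ξ))
    bound : ∀ both → isPair h ∧ isPair h′ ≡ both → e₀ + e₁ + dof b (h + h′ + (y + ξ)) ≤ (h + h′ + (y + ξ)) * 3
    bound true both = begin
      e₀ + e₁ + dof b (h + h′ + (y + ξ)) ≤⟨ ℕₚ.+-monoʳ-≤ (e₀ + e₁) (dof≤7 b (h + h′ + (y + ξ))) ⟩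
      e₀ + e₁ + 7 ≤⟨ ℕₚ.+-monoˡ-≤ 7 (ℕₚ.+-monoʳ-≤ e₀ (begin
        e₁ ≤⟨ new ⟩
        ξ * (h + h′) ≤⟨ ℕₚ.*-monoʳ-≤ ξ (ℕₚ.+-mono-≤ h≤2 h′≤2) ⟩
        ξ * 4 ≡⟨ ℕₚ.*-suc ξ 3 ⟩
        ξ + ξ * 3 ≤⟨ ℕₚ.+-monoˡ-≤ (ξ * 3) ξ≤1 ⟩
        1 + ξ * 3 ∎)) ⟩
      e₀ + (1 + ξ * 3) + 7 ≡⟨ solve 2 (λ e x → e :+ (con 1 :+ x) :+ con 7 := e :+ con 8 :+ x) refl e₀ (ξ * 3) ⟩
      e₀ + 8 + ξ * 3 ≤⟨ ℕₚ.+-monoˡ-≤ (ξ * 3) (two-hinges both) ⟩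
      u * 3 + ξ * 3 ≡⟨ spread ⟩
      (h + h′ + (y + ξ)) * 3 ∎
    bound false notBoth with 5 ≤? u
    ... | yes 5≤u = begin
      e₀ + e₁ + dof b (h + h′ + (y + ξ)) ≤⟨ ℕₚ.+-monoʳ-≤ (e₀ + e₁) (dof≤7 b (h + h′ + (y + ξ))) ⟩
      e₀ + e₁ + 7 ≤⟨ ℕₚ.+-monoˡ-≤ 7 (ℕₚ.+-monoʳ-≤ e₀ (ℕₚ.≤-trans new (ℕₚ.*-monoʳ-≤ ξ (threeShared h h′ h≤2 h′≤2 notBoth)))) ⟩
      e₀ + ξ * 3 + 7 ≡⟨ solve 2 (λ e x → e :+ x :+ con 7 := e :+ con 7 :+ x) refl e₀ (ξ * 3) ⟩
      e₀ + 7 + ξ * 3 ≤⟨ ℕₚ.+-monoˡ-≤ (ξ * 3) (nucleationFree 5≤u) ⟩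
      u * 3 + ξ * 3 ≡⟨ spread ⟩
      (h + h′ + (y + ξ)) * 3 ∎
    ... | no 5≰u = ℕₚ.≤-trans
        (ℕₚ.+-monoˡ-≤ (dof b (h + h′ + (y + ξ))) (ℕₚ.+-mono-≤ (old b refl) new)) small
      where
      u≤4 : u ≤ 4
      u≤4 = ℕₚ.≤-pred (ℕₚ.≰⇒> 5≰u)
      old : ∀ b → isPair h ∨ isPair h′ ≡ b → e₀ ≤ (if b then tri u ∸ 1 else tri u)
      old true  eq = ℕₚ.≤-trans (ℕₚ.≤-reflexive (sym (ℕₚ.m+n∸m≡n 1 e₀))) (ℕₚ.∸-monoˡ-≤ 1 (one-hinge eq))
      old false eq = all-pairs
      small : (if b then tri u ∸ 1 else tri u) + ξ * (h + h′) + dof b (h + h′ + (y + ξ)) ≤ (h + h′ + (y + ξ)) * 3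
      small with asFin (s≤s h≤2) | asFin (s≤s h′≤2) | asFin {y} {5} (s≤s (ℕₚ.≤-trans (ℕₚ.m≤n+m y (h + h′)) u≤4)) | asFin (s≤s ξ≤1)
      ... | H , refl | H′ , refl | Y , refl | X , refl = smallCase H H′ Y X u≤4 notBoth

  -- When one side of a gluing already has the maximal gap 7, the other has to pay for the `h`
  -- vertices counted twice. For `h = 2` this relies on the flag: a hinge without its edge has gap 6
  -- rather than 5.
  shared≤dof : ∀ h b k → h ≤ 2 → h * 3 ≤ dof (isPair h ∨ b) (h + k)
  shared≤dof 0 b k _ = z≤n
  shared≤dof 1 b     0 _ = ℕₚ.≤-refl
  shared≤dof 1 false 1 _ = ℕₚ.m≤m+n 3 2
  shared≤dof 1 true  1 _ = ℕₚ.m≤m+n 3 3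
  shared≤dof 1 false 2 _ = ℕₚ.m≤m+n 3 3
  shared≤dof 1 true  2 _ = ℕₚ.m≤m+n 3 4
  shared≤dof 1 false 3 _ = ℕₚ.m≤m+n 3 3
  shared≤dof 1 true  3 _ = ℕₚ.m≤m+n 3 4
  shared≤dof 1 b (suc (suc (suc (suc k)))) _ = ℕₚ.m≤m+n 3 4
  shared≤dof 2 b 0 _ = ℕₚ.≤-refl
  shared≤dof 2 b 1 _ = ℕₚ.m≤m+n 6 1
  shared≤dof 2 b 2 _ = ℕₚ.m≤m+n 6 1
  shared≤dof 2 b (suc (suc (suc k))) _ = ℕₚ.m≤m+n 6 1
  shared≤dof (suc (suc (suc h))) b k (s≤s (s≤s ()))

  dof-large : ∀ b {u} → 5 ≤ u → dof b u ≡ 7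
  dof-large b (s≤s (s≤s (s≤s (s≤s (s≤s _))))) = refl

  glueCase : ∀ (h h′ : Fin 3) (a z : Fin 5) →
    dof (isPair (toℕ h′)) (toℕ h + toℕ a + (toℕ h′ + toℕ z)) + toℕ h * 3
      ≤ dof (isPair (toℕ h)) (toℕ h + toℕ a) + dof (isPair (toℕ h) ∨ isPair (toℕ h′)) (toℕ h + toℕ h′ + toℕ z)
  glueCase = toWitness {a? = Finₚ.all? λ h → Finₚ.all? λ h′ → Finₚ.all? λ a → Finₚ.all? λ z → _ ≤? _} tt

  -- The vertices of the common hinge are counted on both sides, hence `h * 3`. If one side has five
  -- vertices off that hinge, its gap 7 covers the union and `shared≤dof` makes the other side pay;
  -- the rest is a finite table. Only the flag of the outgoing hinge `h′` survives, because the next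
  -- link attaches there.
  dof-glue : ∀ h h′ a z → h ≤ 2 → h′ ≤ 2 → dof (isPair h′) (h + a + (h′ + z)) + h * 3
    ≤ dof (isPair h) (h + a) + dof (isPair h ∨ isPair h′) (h + h′ + z)
  dof-glue h h′ a z h≤2 h′≤2 with 5 ≤? a | 5 ≤? z
  ... | yes 5≤a | _ = ℕₚ.+-mono-≤
        (ℕₚ.≤-trans (dof≤7 (isPair h′) (h + a + (h′ + z))) (ℕₚ.≤-reflexive (sym (dof-large (isPair h) (ℕₚ.≤-trans 5≤a (ℕₚ.m≤n+m a h))))))
        (ℕₚ.≤-trans (shared≤dof h (isPair h′) (h′ + z) h≤2)
          (ℕₚ.≤-reflexive (cong (dof (isPair h ∨ isPair h′)) (sym (ℕₚ.+-assoc h h′ z)))))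
  ... | no _ | yes 5≤z = ℕₚ.≤-trans (ℕₚ.≤-reflexive (ℕₚ.+-comm (dof (isPair h′) (h + a + (h′ + z))) (h * 3))) (ℕₚ.+-mono-≤
        (subst (λ b → h * 3 ≤ dof b (h + a)) (∨-identityʳ (isPair h)) (shared≤dof h false a h≤2))
        (ℕₚ.≤-trans (dof≤7 (isPair h′) (h + a + (h′ + z)))
          (ℕₚ.≤-reflexive (sym (dof-large (isPair h ∨ isPair h′) (ℕₚ.≤-trans 5≤z (ℕₚ.m≤n+m z (h + h′))))))))
  ... | no 5≰a | no 5≰z with asFin (s≤s h≤2) | asFin (s≤s h′≤2) | asFin (ℕₚ.≰⇒> 5≰a) | asFin (ℕₚ.≰⇒> 5≰z)
  ...   | H , refl | H′ , refl | A , refl | Z , refl = glueCase H H′ A Z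

  glue : ∀ {h h′ z e a E} → LinkCount h h′ z e → E + dof (isPair h) (h + a) ≤ (h + a) * 3 →
    E + e + dof (isPair h′) (h + a + (h′ + z)) ≤ (h + a + (h′ + z)) * 3
  glue {h} {h′} {z} {e} {a} {E} count so-far = ℕₚ.+-cancelʳ-≤ (h * 3) _ _ (begin
    E + e + D′ + h * 3 ≡⟨ ℕₚ.+-assoc (E + e) D′ (h * 3) ⟩
    E + e + (D′ + h * 3) ≤⟨ ℕₚ.+-monoʳ-≤ (E + e) (dof-glue h h′ a z h≤2 h′≤2) ⟩
    E + e + (Da + Du) ≡⟨ solve 4 (λ E e x y → E :+ e :+ (x :+ y) := (E :+ x) :+ (e :+ y)) refl E e Da Du ⟩
    (E + Da) + (e + Du) ≤⟨ ℕₚ.+-mono-≤ so-far bound ⟩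
    (h + a) * 3 + (h + h′ + z) * 3
      ≡⟨ solve 4 (λ h a k z → (h :+ a) :* con 3 :+ (h :+ k :+ z) :* con 3 := (h :+ a :+ (k :+ z)) :* con 3 :+ h :* con 3) refl h a h′ z ⟩
    (h + a + (h′ + z)) * 3 + h * 3 ∎)
    where
    open ℕₚ.≤-Reasoning
    open LinkCount count
    D′ = dof (isPair h′) (h + a + (h′ + z))
    Da = dof (isPair h) (h + a)
    Du = dof (isPair h ∨ isPair h′) (h + h′ + z)

  -- Links are glued one after the other along the hinges; a is the number of vertices met so far off the current hinge.
  chain : ∀ {k} (h h′ z e : Fin (suc k) → ℕ) → (∀ i → h′ (inject₁ i) ≡ h (suc i)) →
    (∀ i → LinkCount (h i) (h′ i) (z i) (e i)) → ∀ a E → E + dof (isPair (h zero)) (h zero + a) ≤ (h zero + a) * 3 →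
    E + ∑ℕ e + dof (isPair (h′ (fromℕ k))) (h zero + a + ∑ℕ (λ i → h′ i + z i)) ≤ (h zero + a + ∑ℕ (λ i → h′ i + z i)) * 3
  chain {zero} h h′ z e coh counts a E so-far =
    subst₂ (λ e s → E + e + dof (isPair (h′ zero)) (h zero + a + s) ≤ (h zero + a + s) * 3)
      (sym (ℕₚ.+-identityʳ (e zero))) (sym (ℕₚ.+-identityʳ (h′ zero + z zero))) (glue {a = a} (counts zero) so-far)
  chain {suc k} h h′ z e coh counts a E so-far =
    subst₂ (λ f s → f + dof (isPair (h′ (fromℕ (suc k)))) s ≤ s * 3)
      (ℕₚ.+-assoc E (e zero) (∑ℕ (e ∘ suc)))
      (trans (cong (_+ rest) regroup) (ℕₚ.+-assoc (h zero + a) (h′ zero + z zero) rest))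
      (chain (h ∘ suc) (h′ ∘ suc) (z ∘ suc) (e ∘ suc) (coh ∘ suc) (counts ∘ suc) (h zero + a + z zero) (E + e zero)
        (subst₂ (λ b s → E + e zero + dof (isPair b) s ≤ s * 3) (coh zero) (sym regroup) (glue {a = a} (counts zero) so-far)))
    where
    rest = ∑ℕ (λ i → h′ (suc i) + z (suc i))
    regroup : h (suc zero) + (h zero + a + z zero) ≡ h zero + a + (h′ zero + z zero)
    regroup = trans (cong (_+ (h zero + a + z zero)) (sym (coh zero)))
      (solve 3 (λ b s z → b :+ (s :+ z) := s :+ (b :+ z)) refl (h′ zero) (h zero + a) (z zero))

  ∑-shift : ∀ {k} (f : Fin (suc k) → ℕ) → ∑ℕ (f ∘ sucMod) ≡ ∑ℕ f
  ∑-shift {k} f = trans (Sum.sum-init-last (f ∘ sucMod)) (trans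
    (cong₂ _+_ (Sum.sum-cong-≗ (λ i → cong f (sucMod-inject₁ i))) (cong f (sucMod-fromℕ k)))
    (ℕₚ.+-comm (∑ℕ (f ∘ suc)) (f zero)))

  Counts : ∀ {k} → (h z e : Fin (suc k) → ℕ) → Set
  Counts h z e = ∀ i → LinkCount (h i) (h (sucMod i)) (z i) (e i)

  -- As hinge `zero` is missed, the last link closes onto nothing, and the chain started from the
  -- empty set counts every vertex once. With five vertices in total the final gap is 7.
  cutRing : ∀ {k} (h z e : Fin (suc k) → ℕ) → Counts h z e → 5 ≤ ∑ℕ h + ∑ℕ z → h zero ≡ 0 →
    ∑ℕ e + 7 ≤ (∑ℕ h + ∑ℕ z) * 3
  cutRing {k} h z e counts large h₀≡0 = subst₂ (λ d s → ∑ℕ e + d ≤ s * 3)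
      (dof-large (isPair (h (sucMod (fromℕ k)))) (ℕₚ.≤-trans large (ℕₚ.≤-reflexive (sym total)))) total
      (chain h (h ∘ sucMod) z e (λ i → cong h (sucMod-inject₁ i)) counts 0 0
        (ℕₚ.≤-reflexive (trans (cong (λ x → dof (isPair x) (x + 0)) h₀≡0) (cong (λ x → (x + 0) * 3) (sym h₀≡0)))))
    where
    total : h zero + 0 + ∑ℕ (λ i → h (sucMod i) + z i) ≡ ∑ℕ h + ∑ℕ z
    total = trans (cong₂ _+_ (cong (_+ 0) h₀≡0) (Sum.∑-distrib-+ (h ∘ sucMod) z)) (cong (_+ ∑ℕ z) (∑-shift h))

  -- Rotating the ring brings the missed hinge to index `zero`. The distance `d` carries the
  -- recursion, since a rotation replaces `suc j` by `inject₁ j`, which is not structurally smaller.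
  brokenRing : ∀ {k} (h z e : Fin (suc k) → ℕ) → Counts h z e → 5 ≤ ∑ℕ h + ∑ℕ z → ∀ d j → toℕ j ≡ d → h j ≡ 0 →
    ∑ℕ e + 7 ≤ (∑ℕ h + ∑ℕ z) * 3
  brokenRing h z e counts large d       zero    _   hj≡0 = cutRing h z e counts large hj≡0
  brokenRing {suc k} h z e counts large (suc d) (suc j) toℕ≡ hj≡0 =
    subst₂ (λ x y → x + 7 ≤ y * 3) (∑-shift e) (cong₂ _+_ (∑-shift h) (∑-shift z))
      (brokenRing (h ∘ sucMod) (z ∘ sucMod) (e ∘ sucMod) (counts ∘ sucMod)
        (ℕₚ.≤-trans large (ℕₚ.≤-reflexive (sym (cong₂ _+_ (∑-shift h) (∑-shift z)))))
        d (inject₁ j) (trans (Finₚ.toℕ-inject₁ j) (ℕₚ.suc-injective toℕ≡)) (trans (cong h (sucMod-inject₁ j)) hj≡0))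

  ∑-mono : ∀ {k} {f g : Fin k → ℕ} → (∀ i → f i ≤ g i) → ∑ℕ f ≤ ∑ℕ g
  ∑-mono {zero}  f≤g = z≤n
  ∑-mono {suc k} f≤g = ℕₚ.+-mono-≤ (f≤g zero) (∑-mono (f≤g ∘ suc))

  fullCase : ∀ (h h′ : Fin 3) (z : Fin 5) → 1 ≤ toℕ h → 1 ≤ toℕ h′ →
    2 + toℕ h * 3 + toℕ h′ * 3 ≤ dof (isPair (toℕ h) ∨ isPair (toℕ h′)) (toℕ h + toℕ h′ + toℕ z) * 2
  fullCase = toWitness {a? = Finₚ.all? λ h → Finₚ.all? λ h′ → Finₚ.all? λ z →
    (_ ≤? _) →-dec ((_ ≤? _) →-dec (_ ≤? _))} tt

  -- Each hinge vertex lies in two links, so a link is charged half of its three coordinates;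
  -- everything is doubled to stay in ℕ. The `2` is the doubled surplus of one unit per link,
  -- available because both hinges are met.
  fullLink : ∀ {h h′ z e} → LinkCount h h′ z e → 1 ≤ h → 1 ≤ h′ → (e * 2 + 2) + (h * 3 + h′ * 3) ≤ (h + h′ + z) * 6
  fullLink {h} {h′} {z} {e} count 1≤h 1≤h′ = begin
    (e * 2 + 2) + (h * 3 + h′ * 3) ≡⟨ solve 3 (λ e x y → (e :* con 2 :+ con 2) :+ (x :+ y) := e :* con 2 :+ (con 2 :+ x :+ y)) refl e (h * 3) (h′ * 3) ⟩
    e * 2 + (2 + h * 3 + h′ * 3) ≤⟨ ℕₚ.+-monoʳ-≤ (e * 2) slack ⟩
    e * 2 + D * 2 ≡⟨ sym (ℕₚ.*-distribʳ-+ 2 e D) ⟩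
    (e + D) * 2 ≤⟨ ℕₚ.*-monoˡ-≤ 2 bound ⟩
    (h + h′ + z) * 3 * 2 ≡⟨ ℕₚ.*-assoc (h + h′ + z) 3 2 ⟩
    (h + h′ + z) * 6 ∎
    where
    open ℕₚ.≤-Reasoning
    open LinkCount count
    D = dof (isPair h ∨ isPair h′) (h + h′ + z)
    slack : 2 + h * 3 + h′ * 3 ≤ D * 2
    slack with 5 ≤? z
    ... | yes 5≤z = ℕₚ.≤-trans (ℕₚ.+-mono-≤ (ℕₚ.+-monoʳ-≤ 2 (ℕₚ.*-monoˡ-≤ 3 h≤2)) (ℕₚ.*-monoˡ-≤ 3 h′≤2))
          (ℕₚ.≤-reflexive (cong (_* 2) (sym (dof-large (isPair h ∨ isPair h′) (ℕₚ.≤-trans 5≤z (ℕₚ.m≤n+m z (h + h′)))))))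
    ... | no 5≰z with asFin (s≤s h≤2) | asFin (s≤s h′≤2) | asFin (ℕₚ.≰⇒> 5≰z)
    ...   | H , refl | H′ , refl | Z , refl = fullCase H H′ Z 1≤h 1≤h′

  ∑-*ʳ : ∀ {k} (f : Fin k → ℕ) c → ∑ℕ (λ i → f i * c) ≡ ∑ℕ f * c
  ∑-*ʳ {zero}  f c = refl
  ∑-*ʳ {suc k} f c = trans (cong (f zero * c +_) (∑-*ʳ (f ∘ suc) c)) (sym (ℕₚ.*-distribʳ-+ c (f zero) (∑ℕ (f ∘ suc))))

  ∑-const : ∀ k c → ∑ℕ {k} (λ _ → c) ≡ k * c
  ∑-const zero    c = refl
  ∑-const (suc k) c = cong (c +_) (∑-const k c)

  fullRing : ∀ {k} (h z e : Fin (suc k) → ℕ) → Counts h z e → 7 ≤ suc k → (∀ i → 1 ≤ h i) →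
    ∑ℕ e + 7 ≤ (∑ℕ h + ∑ℕ z) * 3
  -- In the doubled sum over the links each of the `X` hinge vertices carries weight 6 once too
  -- often. Adding `X * 6` to both sides balances this before cancelling.
  fullRing {k} h z e counts 7≤m 1≤h = ℕₚ.*-cancelʳ-≤ _ _ 2 (ℕₚ.+-cancelʳ-≤ (X * 6) _ _ (begin
    (∑ℕ e + 7) * 2 + X * 6 ≤⟨ ℕₚ.+-monoˡ-≤ (X * 6) (ℕₚ.*-monoˡ-≤ 2 (ℕₚ.+-monoʳ-≤ (∑ℕ e) 7≤m)) ⟩
    (∑ℕ e + suc k) * 2 + X * 6
      ≡⟨ solve 3 (λ e k x → (e :+ k) :* con 2 :+ x :* con 6 := (e :* con 2 :+ k :* con 2) :+ (x :* con 3 :+ x :* con 3)) refl (∑ℕ e) (suc k) X ⟩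
    (∑ℕ e * 2 + suc k * 2) + (X * 3 + X * 3)
      ≡⟨ cong₂ _+_ (cong₂ _+_ (sym (∑-*ʳ e 2)) (sym (∑-const (suc k) 2))) (cong₂ _+_ (sym (∑-*ʳ h 3)) (trans (cong (_* 3) (sym (∑-shift h))) (sym (∑-*ʳ (h ∘ sucMod) 3)))) ⟩
    (∑ℕ (λ i → e i * 2) + ∑ℕ {suc k} (λ _ → 2)) + (∑ℕ (λ i → h i * 3) + ∑ℕ (λ i → h (sucMod i) * 3))
      ≡⟨ sym (trans (Sum.∑-distrib-+ (λ i → e i * 2 + 2) (λ i → h i * 3 + h (sucMod i) * 3))
           (cong₂ _+_ (Sum.∑-distrib-+ (λ i → e i * 2) (λ _ → 2)) (Sum.∑-distrib-+ (λ i → h i * 3) (λ i → h (sucMod i) * 3)))) ⟩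
    ∑ℕ (λ i → (e i * 2 + 2) + (h i * 3 + h (sucMod i) * 3)) ≤⟨ ∑-mono (λ i → fullLink (counts i) (1≤h i) (1≤h (sucMod i))) ⟩
    ∑ℕ (λ i → (h i + h (sucMod i) + z i) * 6) ≡⟨ ∑-*ʳ (λ i → h i + h (sucMod i) + z i) 6 ⟩
    ∑ℕ (λ i → h i + h (sucMod i) + z i) * 6
      ≡⟨ cong (_* 6) (trans (Sum.∑-distrib-+ (λ i → h i + h (sucMod i)) z)
           (cong (_+ ∑ℕ z) (trans (Sum.∑-distrib-+ h (h ∘ sucMod)) (cong (X +_) (∑-shift h))))) ⟩
    (X + X + ∑ℕ z) * 6 ≡⟨ solve 2 (λ x z → (x :+ x :+ z) :* con 6 := (x :+ z) :* con 3 :* con 2 :+ x :* con 6) refl X (∑ℕ z) ⟩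
    (X + ∑ℕ z) * 3 * 2 + X * 6 ∎))
    where
    open ℕₚ.≤-Reasoning
    X = ∑ℕ h

  ringCount : ∀ {m} → 7 ≤ m → (h z e : Fin m → ℕ) → (∀ i → LinkCount (h i) (h (sucMod i)) (z i) (e i)) →
    5 ≤ ∑ℕ h + ∑ℕ z → ∑ℕ e + 7 ≤ (∑ℕ h + ∑ℕ z) * 3
  ringCount {suc k} 7≤m h z e counts large with Finₚ.any? (λ j → h j ℕₚ.≟ 0)
  ... | yes (j , hj≡0) = brokenRing h z e counts large (toℕ j) j refl hj≡0
  ... | no none = fullRing h z e counts 7≤m (λ i → ℕₚ.n≢0⇒n>0 (λ hi≡0 → none (i , hi≡0)))

-- Linear algebra over ℚ

open import Data.Rational using (_+_; _*_; _-_; -_; 1/_; _≟_; ∣_∣; _⊔_; ≢-nonZero; nonNegative)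
open +-*-Solver using (solve; _:+_; _:*_; _:-_; :-_; _:=_; con)

∑ : ∀ {k} → (Fin k → ℚ) → ℚ
∑ {zero}  f = 0ℚ
∑ {suc k} f = f zero + ∑ (f ∘ suc)

Σℚ-tabulate : ∀ {k} (f : Fin k → ℚ) → Σℚ (tabulate f) ≡ ∑ f
Σℚ-tabulate {zero}  f = refl
Σℚ-tabulate {suc k} f = cong (f zero +_) (Σℚ-tabulate (f ∘ suc))

∑-cong : ∀ {k} {f g : Fin k → ℚ} → (∀ i → f i ≡ g i) → ∑ f ≡ ∑ g
∑-cong {zero}  eq = refl
∑-cong {suc k} eq = cong₂ _+_ (eq zero) (∑-cong (eq ∘ suc))

∑-zero : ∀ {k} {f : Fin k → ℚ} → (∀ i → f i ≡ 0ℚ) → ∑ f ≡ 0ℚ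
∑-zero {zero}  eq = refl
∑-zero {suc k} eq = trans (cong₂ _+_ (eq zero) (∑-zero (eq ∘ suc))) (ℚₚ.+-identityˡ 0ℚ)

∑-+ : ∀ {k} (f g : Fin k → ℚ) → ∑ (λ i → f i + g i) ≡ ∑ f + ∑ g
∑-+ {zero}  f g = refl
∑-+ {suc k} f g = trans (cong (f zero + g zero +_) (∑-+ (f ∘ suc) (g ∘ suc)))
  (solve 4 (λ a b c d → (a :+ b) :+ (c :+ d) := (a :+ c) :+ (b :+ d)) refl
    (f zero) (g zero) (∑ (f ∘ suc)) (∑ (g ∘ suc)))

∑-* : ∀ {k} a (f : Fin k → ℚ) → ∑ (λ i → a * f i) ≡ a * ∑ f
∑-* {zero}  a f = sym (ℚₚ.*-zeroʳ a)
∑-* {suc k} a f = trans (cong (a * f zero +_) (∑-* a (f ∘ suc)))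
  (sym (ℚₚ.*-distribˡ-+ a (f zero) (∑ (f ∘ suc))))

∑-swap : ∀ {k l} (f : Fin k → Fin l → ℚ) →
         ∑ (λ i → ∑ (λ j → f i j)) ≡ ∑ (λ j → ∑ (λ i → f i j))
∑-swap {zero}  {l} f = sym (∑-zero {l} (λ _ → refl))
∑-swap {suc k} f = trans (cong (∑ (f zero) +_) (∑-swap (f ∘ suc)))
  (sym (∑-+ (f zero) (λ j → ∑ (λ i → f (suc i) j))))

δ : ∀ {k} → Fin k → Fin k → ℚ
δ i j with i ≟F j
... | yes _ = 1ℚ
... | no _  = 0ℚ

δ-diag : ∀ {k} (i : Fin k) → δ i i ≡ 1ℚ
δ-diag i with i ≟F i
... | yes _   = refl
... | no i≢i = ⊥-elim (i≢i refl)

δ-off : ∀ {k} {i j : Fin k} → i ≢ j → δ i j ≡ 0ℚ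
δ-off {i = i} {j} i≢j with i ≟F j
... | yes i≡j = ⊥-elim (i≢j i≡j)
... | no _    = refl

δ-suc : ∀ {k} (i j : Fin k) → δ (suc i) (suc j) ≡ δ i j
δ-suc i j with i ≟F j
... | yes _ = refl
... | no _  = refl

∑-δ : ∀ {k} (i : Fin k) (f : Fin k → ℚ) → ∑ (λ j → δ i j * f j) ≡ f i
∑-δ zero f = trans (cong₂ _+_ (ℚₚ.*-identityˡ (f zero))
  (∑-zero (λ j → ℚₚ.*-zeroˡ (f (suc j))))) (ℚₚ.+-identityʳ _)
∑-δ (suc i) f = trans (cong₂ _+_ (ℚₚ.*-zeroˡ (f zero))
    (∑-cong (λ j → cong (_* f (suc j)) (δ-suc i j))))
  (trans (ℚₚ.+-identityˡ _) (∑-δ i (f ∘ suc)))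

*-zero-cancel : ∀ {a b} → a ≢ 0ℚ → a * b ≡ 0ℚ → b ≡ 0ℚ
*-zero-cancel {a} {b} a≢0 ab≡0 = begin
  b                ≡⟨ sym (ℚₚ.*-identityˡ b) ⟩
  1ℚ * b           ≡⟨ cong (_* b) (sym (ℚₚ.*-inverseˡ a)) ⟩
  (1/ a * a) * b   ≡⟨ ℚₚ.*-assoc (1/ a) a b ⟩
  1/ a * (a * b)   ≡⟨ cong (1/ a *_) ab≡0 ⟩
  1/ a * 0ℚ        ≡⟨ ℚₚ.*-zeroʳ (1/ a) ⟩
  0ℚ ∎
  where open ≡-Reasoning
        instance _ = ≢-nonZero a≢0

*-≢0 : ∀ {a b} → a ≢ 0ℚ → b ≢ 0ℚ → a * b ≢ 0ℚ
*-≢0 a≢0 b≢0 ab≡0 = b≢0 (*-zero-cancel a≢0 ab≡0)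

comb : ∀ {C : Set} {k} → (Fin k → ℚ) → (Fin k → C → ℚ) → C → ℚ
comb μ A c = ∑ (λ i → μ i * A i c)

Indep : ∀ {C : Set} {k} → (Fin k → C → ℚ) → Set
Indep A = ∀ μ → (∀ c → comb μ A c ≡ 0ℚ) → ∀ i → μ i ≡ 0ℚ

-- Coefficients on `B` are pushed forward along `φ` and extended by zero; injectivity lets them be
-- read off again. Sublists, permutations and reoriented edges all reduce to this.
indep-reindex : ∀ {C : Set} {k l} {A : Fin k → C → ℚ} {B : Fin l → C → ℚ} (φ : Fin l → Fin k) →
  Injective _≡_ _≡_ φ → (∀ i c → B i c ≡ A (φ i) c) → Indep A → Indep B
indep-reindex {A = A} {B} φ inj eq indA μ μB i = trans (sym νφ) (indA ν νA (φ i))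
  where
  open ≡-Reasoning
  ν = λ j → ∑ (λ i → μ i * δ (φ i) j)
  νA : ∀ c → comb ν A c ≡ 0ℚ
  νA c = begin
    ∑ (λ j → ∑ (λ i → μ i * δ (φ i) j) * A j c)
      ≡⟨ ∑-cong (λ j → trans (ℚₚ.*-comm _ (A j c)) (sym (∑-* (A j c) (λ i → μ i * δ (φ i) j)))) ⟩
    ∑ (λ j → ∑ (λ i → A j c * (μ i * δ (φ i) j)))
      ≡⟨ ∑-swap (λ j i → A j c * (μ i * δ (φ i) j)) ⟩
    ∑ (λ i → ∑ (λ j → A j c * (μ i * δ (φ i) j)))
      ≡⟨ ∑-cong (λ i → trans (∑-cong (λ j →
           solve 3 (λ a m d → a :* (m :* d) := m :* (d :* a)) refl (A j c) (μ i) (δ (φ i) j)))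
           (∑-* (μ i) (λ j → δ (φ i) j * A j c))) ⟩
    ∑ (λ i → μ i * ∑ (λ j → δ (φ i) j * A j c))
      ≡⟨ ∑-cong (λ i → cong (μ i *_) (trans (∑-δ (φ i) (λ j → A j c)) (sym (eq i c)))) ⟩
    ∑ (λ i → μ i * B i c) ≡⟨ μB c ⟩
    0ℚ ∎
  δφ : ∀ i′ → δ (φ i′) (φ i) ≡ δ i i′
  δφ i′ with i ≟F i′
  ... | yes refl = δ-diag (φ i)
  ... | no i≢i′ = δ-off (λ φ≡ → i≢i′ (inj (sym φ≡)))
  νφ : ν (φ i) ≡ μ i
  νφ = trans (∑-cong (λ i′ → trans (ℚₚ.*-comm (μ i′) _) (cong (_* μ i′) (δφ i′)))) (∑-δ i μ)

-- One step of fraction-free Gaussian elimination on the first row with pivot column c₀.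
reduce : ∀ {C : Set} {k} → (Fin (suc k) → C → ℚ) → C → Fin k → C → ℚ
reduce A c₀ i c = A zero c₀ * A (suc i) c - A (suc i) c₀ * A zero c

comb-reduce : ∀ {C : Set} {k} (A : Fin (suc k) → C → ℚ) c₀ (μ : Fin k → ℚ) c →
  comb μ (reduce A c₀) c ≡ A zero c₀ * comb μ (A ∘ suc) c - comb μ (A ∘ suc) c₀ * A zero c
comb-reduce A c₀ μ c = begin
  ∑ (λ i → μ i * (e * A (suc i) c - A (suc i) c₀ * a))
    ≡⟨ ∑-cong (λ i → solve 5 (λ m e x y a → m :* (e :* x :- y :* a) := e :* (m :* x) :+ (:- a) :* (m :* y))
         refl (μ i) e (A (suc i) c) (A (suc i) c₀) a) ⟩
  ∑ (λ i → e * (μ i * A (suc i) c) + (- a) * (μ i * A (suc i) c₀))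
    ≡⟨ ∑-+ (λ i → e * (μ i * A (suc i) c)) (λ i → (- a) * (μ i * A (suc i) c₀)) ⟩
  ∑ (λ i → e * (μ i * A (suc i) c)) + ∑ (λ i → (- a) * (μ i * A (suc i) c₀))
    ≡⟨ cong₂ _+_ (∑-* e (λ i → μ i * A (suc i) c)) (∑-* (- a) (λ i → μ i * A (suc i) c₀)) ⟩
  e * X + (- a) * Y
    ≡⟨ solve 4 (λ e x a y → e :* x :+ (:- a) :* y := e :* x :- y :* a) refl e X a Y ⟩
  e * X - Y * a ∎
  where
  open ≡-Reasoning
  e = A zero c₀
  a = A zero c
  X = comb μ (A ∘ suc) c
  Y = comb μ (A ∘ suc) c₀

-- Column `c₀` determines the first coefficient from the others, and substituting it turns a
-- relation on `A` into one on the reduced rows. The pivot is cancelled only at the end.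
indep-unreduce : ∀ {C : Set} {k} (A : Fin (suc k) → C → ℚ) c₀ → A zero c₀ ≢ 0ℚ →
  Indep (reduce A c₀) → Indep A
indep-unreduce A c₀ e≢0 ind μ μA = λ { zero → μ₀≡0 ; (suc i) → μ≡0 i }
  where
  open ≡-Reasoning
  e = A zero c₀
  rest : ∀ c → comb (μ ∘ suc) (A ∘ suc) c ≡ - (μ zero * A zero c)
  rest c = begin
    Y ≡⟨ solve 2 (λ x y → y := (:- x) :+ (x :+ y)) refl (μ zero * A zero c) Y ⟩
    (- (μ zero * A zero c)) + (μ zero * A zero c + Y) ≡⟨ cong ((- (μ zero * A zero c)) +_) (μA c) ⟩
    (- (μ zero * A zero c)) + 0ℚ ≡⟨ ℚₚ.+-identityʳ _ ⟩
    - (μ zero * A zero c) ∎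
    where Y = comb (μ ∘ suc) (A ∘ suc) c
  μ≡0 : ∀ i → μ (suc i) ≡ 0ℚ
  μ≡0 = ind (μ ∘ suc) λ c → begin
    comb (μ ∘ suc) (reduce A c₀) c ≡⟨ comb-reduce A c₀ (μ ∘ suc) c ⟩
    e * comb (μ ∘ suc) (A ∘ suc) c - comb (μ ∘ suc) (A ∘ suc) c₀ * A zero c
      ≡⟨ cong₂ (λ x y → e * x - y * A zero c) (rest c) (rest c₀) ⟩
    e * (- (μ zero * A zero c)) - (- (μ zero * e)) * A zero c
      ≡⟨ solve 3 (λ e m a → e :* (:- (m :* a)) :- (:- (m :* e)) :* a := con 0ℚ) refl e (μ zero) (A zero c) ⟩
    0ℚ ∎
  μ₀≡0 : μ zero ≡ 0ℚ
  μ₀≡0 = *-zero-cancel e≢0 (begin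
    e * μ zero ≡⟨ ℚₚ.*-comm e (μ zero) ⟩
    μ zero * e ≡⟨ sym (ℚₚ.+-identityʳ _) ⟩
    μ zero * e + 0ℚ ≡⟨ cong (μ zero * e +_) (sym (∑-zero (λ i → trans (cong (_* A (suc i) c₀) (μ≡0 i)) (ℚₚ.*-zeroˡ (A (suc i) c₀))))) ⟩
    comb μ A c₀ ≡⟨ μA c₀ ⟩
    0ℚ ∎)

-- A relation on the reduced rows lifts to `A`: its coefficients are scaled by the pivot, and the
-- first row collects the multiples that were subtracted.
indep-reduce : ∀ {C : Set} {k} (A : Fin (suc k) → C → ℚ) c₀ → A zero c₀ ≢ 0ℚ →
  Indep A → Indep (reduce A c₀)
indep-reduce A c₀ e≢0 ind μ μR i = *-zero-cancel e≢0 (ind ν νA (suc i))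
  where
  open ≡-Reasoning
  e = A zero c₀
  ν : Fin _ → ℚ
  ν zero    = - comb μ (A ∘ suc) c₀
  ν (suc i) = e * μ i
  νA : ∀ c → comb ν A c ≡ 0ℚ
  νA c = begin
    (- Y) * A zero c + ∑ (λ i → (e * μ i) * A (suc i) c)
      ≡⟨ cong ((- Y) * A zero c +_) (trans (∑-cong (λ i → ℚₚ.*-assoc e (μ i) (A (suc i) c))) (∑-* e (λ i → μ i * A (suc i) c))) ⟩
    (- Y) * A zero c + e * X
      ≡⟨ solve 4 (λ y a e x → (:- y) :* a :+ e :* x := e :* x :- y :* a) refl Y (A zero c) e X ⟩
    e * X - Y * A zero c ≡⟨ sym (comb-reduce A c₀ μ c) ⟩
    comb μ (reduce A c₀) c ≡⟨ μR c ⟩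
    0ℚ ∎
    where X = comb μ (A ∘ suc) c
          Y = comb μ (A ∘ suc) c₀

1≢0 : 1ℚ ≢ 0ℚ
1≢0 ()

indep-firstRow≢0 : ∀ {C : Set} {k} (A : Fin (suc k) → C → ℚ) → (∀ c → A zero c ≡ 0ℚ) → ¬ Indep A
indep-firstRow≢0 {k = k} A A₀≡0 ind = 1≢0 (trans (sym (δ-diag {suc k} zero))
  (ind (δ zero) (λ c → trans (∑-δ zero (λ j → A j c)) (A₀≡0 c)) zero))

-- This is all that elimination asks of a set of columns: deciding whether it offers a pivot.
Searchable : Set → Set₁
Searchable C = {P : C → Set} → (∀ c → Dec (P c)) → Dec (∃ P)

nonzero? : ∀ {C : Set} → Searchable C → (f : C → ℚ) → (∃ λ c → f c ≢ 0ℚ) ⊎ (∀ c → f c ≡ 0ℚ)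
nonzero? search f with search (λ c → ¬? (f c ≟ 0ℚ))
... | yes found = inj₁ found
... | no  none  = inj₂ (λ c → decidable-stable (f c ≟ 0ℚ) (λ ≢0 → none (c , ≢0)))

-- Elimination clears the pivot column, which can then be removed together with the pivot row.
indep-dim : ∀ {k d} (A : Fin k → Fin d → ℚ) → Indep A → k ≤ d
indep-dim {zero}          A ind = z≤n
indep-dim {suc k} {zero}  A ind = ⊥-elim (indep-firstRow≢0 A (λ ()) ind)
indep-dim {suc k} {suc d} A ind with nonzero? Finₚ.any? (A zero)
... | inj₂ A₀≡0       = ⊥-elim (indep-firstRow≢0 A A₀≡0 ind)
... | inj₁ (c₀ , e≢0) = s≤s (indep-dim {k} {d} (λ i j → reduce A c₀ i (punchIn c₀ j)) λ μ μR →
        indep-reduce A c₀ e≢0 ind μ (vanish μ μR))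
  where
  vanish : (μ : Fin k → ℚ) → (∀ j → comb {Fin d} μ (λ i j → reduce A c₀ i (punchIn c₀ j)) j ≡ 0ℚ) →
           ∀ c → comb μ (reduce A c₀) c ≡ 0ℚ
  vanish μ μR c with c₀ ≟F c
  ... | yes refl = ∑-zero {f = λ i → μ i * reduce A c₀ i c₀} (λ i → trans (cong (μ i *_)
          (solve 2 (λ x y → x :* y :- y :* x := con 0ℚ) refl (A zero c₀) (A (suc i) c₀))) (ℚₚ.*-zeroʳ (μ i)))
  ... | no c₀≢c = subst (λ c → comb μ (reduce A c₀) c ≡ 0ℚ) (Finₚ.punchIn-punchOut c₀≢c) (μR (punchOut c₀≢c))

InSpan : ∀ {C : Set} {k} → (Fin k → C → ℚ) → (C → ℚ) → Set
InSpan A v = ∃ λ μ → ∀ c → v c ≡ comb μ A c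

inSpan-row : ∀ {C : Set} {k} (A : Fin k → C → ℚ) {v} i → (∀ c → v c ≡ A i c) → InSpan A v
inSpan-row A i eq = δ i , λ c → trans (eq c) (sym (∑-δ i (λ j → A j c)))

-- The matrix expressing `B` through `A` inherits independent rows from `B`, and it has only `k`
-- columns.
steinitz : ∀ {C : Set} {k l} (A : Fin k → C → ℚ) (B : Fin l → C → ℚ) →
  (∀ i → InSpan A (B i)) → Indep B → l ≤ k
steinitz A B sp ind = indep-dim (λ i j → proj₁ (sp i) j) λ μ μM → ind μ λ c → begin
  ∑ (λ i → μ i * B i c)
    ≡⟨ ∑-cong (λ i → trans (cong (μ i *_) (proj₂ (sp i) c)) (sym (∑-* (μ i) (λ j → M i j * A j c)))) ⟩
  ∑ (λ i → ∑ (λ j → μ i * (M i j * A j c)))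
    ≡⟨ ∑-swap (λ i j → μ i * (M i j * A j c)) ⟩
  ∑ (λ j → ∑ (λ i → μ i * (M i j * A j c)))
    ≡⟨ ∑-cong (λ j → trans (∑-cong (λ i → solve 3 (λ m x a → m :* (x :* a) := a :* (m :* x)) refl (μ i) (M i j) (A j c)))
         (∑-* (A j c) (λ i → μ i * M i j))) ⟩
  ∑ (λ j → A j c * comb μ M j)
    ≡⟨ ∑-zero (λ j → trans (cong (A j c *_) (μM j)) (ℚₚ.*-zeroʳ (A j c))) ⟩
  0ℚ ∎
  where open ≡-Reasoning
        M = λ i j → proj₁ (sp i) j

-- A relation with nonzero first coefficient could be divided to put the first row into the span of
-- the others. Equality in ℚ is decidable, so the mere negation of span membership is enough.
indep-cons : ∀ {C : Set} {k} (A : Fin (suc k) → C → ℚ) →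
  ¬ InSpan (A ∘ suc) (A zero) → Indep (A ∘ suc) → Indep A
indep-cons A ¬sp ind μ μA = λ { zero → μ₀≡0 ; (suc i) → ind (μ ∘ suc) rest i }
  where
  open ≡-Reasoning
  μ₀≡0 : μ zero ≡ 0ℚ
  μ₀≡0 = decidable-stable (μ zero ≟ 0ℚ) λ μ₀≢0 → ¬sp (dependence μ₀≢0)
    where
    dependence : μ zero ≢ 0ℚ → InSpan (A ∘ suc) (A zero)
    dependence μ₀≢0 = (λ i → (- r) * μ (suc i)) , λ c → begin
      A zero c ≡⟨ sym (ℚₚ.*-identityˡ _) ⟩
      1ℚ * A zero c ≡⟨ cong (_* A zero c) (sym (ℚₚ.*-inverseˡ (μ zero))) ⟩
      (r * μ zero) * A zero c
        ≡⟨ solve 4 (λ r m a x → (r :* m) :* a := r :* (m :* a :+ x) :+ (:- r) :* x) refl r (μ zero) (A zero c) (Y c) ⟩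
      r * comb μ A c + (- r) * Y c ≡⟨ cong (λ z → r * z + (- r) * Y c) (μA c) ⟩
      r * 0ℚ + (- r) * Y c ≡⟨ solve 2 (λ r x → r :* con 0ℚ :+ (:- r) :* x := (:- r) :* x) refl r (Y c) ⟩
      (- r) * Y c ≡⟨ sym (∑-* (- r) (λ i → μ (suc i) * A (suc i) c)) ⟩
      ∑ (λ i → (- r) * (μ (suc i) * A (suc i) c)) ≡⟨ ∑-cong (λ i → sym (ℚₚ.*-assoc (- r) (μ (suc i)) (A (suc i) c))) ⟩
      comb (λ i → (- r) * μ (suc i)) (A ∘ suc) c ∎
      where instance _ = ≢-nonZero μ₀≢0
            r = 1/ μ zero
            Y = comb (μ ∘ suc) (A ∘ suc)
  rest : ∀ c → comb (μ ∘ suc) (A ∘ suc) c ≡ 0ℚ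
  rest c = begin
    Y ≡⟨ sym (ℚₚ.+-identityˡ Y) ⟩
    0ℚ + Y ≡⟨ cong (_+ Y) (sym (trans (cong (_* A zero c) μ₀≡0) (ℚₚ.*-zeroˡ (A zero c)))) ⟩
    comb μ A c ≡⟨ μA c ⟩
    0ℚ ∎
    where Y = comb (μ ∘ suc) (A ∘ suc) c

-- Polynomials in several variables

-- Lists of coefficients with respect to the first variable, constant term first. Nothing is
-- normalised, so the zero polynomial has many forms and nonvanishing is always expressed through
-- values.
Poly : ℕ → Set
Poly zero    = ℚ
Poly (suc d) = List (Poly d)

eval : ∀ {d} → Poly d → Vec ℚ d → ℚ
eval {zero}  q       []      = q
eval {suc d} []      (t ∷ x) = 0ℚ
eval {suc d} (f ∷ F) (t ∷ x) = eval f x + t * eval F (t ∷ x)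

constP : ∀ {d} → ℚ → Poly d
constP {zero}  q = q
constP {suc d} q = constP q ∷ []

varP : ∀ {d} → Fin d → Poly d
varP {suc d} zero    = constP 0ℚ ∷ constP 1ℚ ∷ []
varP {suc d} (suc i) = varP i ∷ []

addP : ∀ {d} → Poly d → Poly d → Poly d
addP {zero}  p       q       = p + q
addP {suc d} []      G       = G
addP {suc d} (f ∷ F) []      = f ∷ F
addP {suc d} (f ∷ F) (g ∷ G) = addP f g ∷ addP F G

mulP : ∀ {d} → Poly d → Poly d → Poly d
mulP {zero}  p       q = p * q
mulP {suc d} []      G = []
mulP {suc d} (f ∷ F) G = addP {suc d} (map (mulP f) G) (constP 0ℚ ∷ mulP {suc d} F G)

subP : ∀ {d} → Poly d → Poly d → Poly d
subP f g = addP f (mulP (constP (- 1ℚ)) g)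

eval-const : ∀ {d} q (x : Vec ℚ d) → eval (constP q) x ≡ q
eval-const q []      = refl
eval-const q (t ∷ x) = trans (cong₂ _+_ (eval-const q x) (ℚₚ.*-zeroʳ t)) (ℚₚ.+-identityʳ q)

eval-var : ∀ {d} (i : Fin d) (x : Vec ℚ d) → eval (varP i) x ≡ Vec.lookup x i
eval-var zero (t ∷ x) =
  trans (cong₂ (λ a b → a + t * (b + t * 0ℚ)) (eval-const 0ℚ x) (eval-const 1ℚ x))
    (solve 1 (λ t → con 0ℚ :+ t :* (con 1ℚ :+ t :* con 0ℚ) := t) refl t)
eval-var (suc i) (t ∷ x) =
  trans (cong₂ _+_ (eval-var i x) (ℚₚ.*-zeroʳ t)) (ℚₚ.+-identityʳ _)

eval-add : ∀ {d} (f g : Poly d) x → eval (addP f g) x ≡ eval f x + eval g x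
eval-add {zero}  p       q       []      = refl
eval-add {suc d} []      G       (t ∷ x) = sym (ℚₚ.+-identityˡ _)
eval-add {suc d} (f ∷ F) []      (t ∷ x) = sym (ℚₚ.+-identityʳ _)
eval-add {suc d} (f ∷ F) (g ∷ G) (t ∷ x) =
  trans (cong₂ (λ a b → a + t * b) (eval-add f g x) (eval-add F G (t ∷ x)))
    (solve 5 (λ a b c d t → (a :+ b) :+ t :* (c :+ d) := (a :+ t :* c) :+ (b :+ t :* d)) refl
      (eval f x) (eval g x) (eval F (t ∷ x)) (eval G (t ∷ x)) t)

mutual
  eval-mul : ∀ {d} (f g : Poly d) x → eval (mulP f g) x ≡ eval f x * eval g x
  eval-mul {zero}  p       q []      = refl
  eval-mul {suc d} []      G (t ∷ x) = sym (ℚₚ.*-zeroˡ (eval G (t ∷ x)))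
  eval-mul {suc d} (f ∷ F) G (t ∷ x) =
    trans (eval-add {suc d} (map (mulP f) G) (constP 0ℚ ∷ mulP {suc d} F G) (t ∷ x))
    (trans (cong₂ _+_ (eval-scale f G t x)
             (cong₂ (λ a b → a + t * b) (eval-const 0ℚ x) (eval-mul {suc d} F G (t ∷ x))))
      (solve 4 (λ a b c t → a :* b :+ (con 0ℚ :+ t :* (c :* b)) := (a :+ t :* c) :* b) refl
        (eval f x) (eval G (t ∷ x)) (eval F (t ∷ x)) t))

  eval-scale : ∀ {d} (f : Poly d) (G : Poly (suc d)) t x →
    eval {suc d} (map (mulP f) G) (t ∷ x) ≡ eval f x * eval {suc d} G (t ∷ x)
  eval-scale f []      t x = sym (ℚₚ.*-zeroʳ (eval f x))
  eval-scale f (g ∷ G) t x =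
    trans (cong₂ (λ a b → a + t * b) (eval-mul f g x) (eval-scale f G t x))
      (solve 4 (λ a b c t → a :* b :+ t :* (a :* c) := a :* (b :+ t :* c)) refl
        (eval f x) (eval g x) (eval G (t ∷ x)) t)

eval-sub : ∀ {d} (f g : Poly d) x → eval (subP f g) x ≡ eval f x - eval g x
eval-sub f g x = trans (eval-add f (mulP (constP (- 1ℚ)) g) x)
  (cong (eval f x +_) (trans (eval-mul (constP (- 1ℚ)) g x)
    (trans (cong (_* eval g x) (eval-const (- 1ℚ) x)) (solve 1 (λ y → con (- 1ℚ) :* y := :- y) refl (eval g x)))))

NonzeroCoeff : ∀ {d} → Poly (suc d) → Vec ℚ d → Set
NonzeroCoeff F x = Any (λ f → eval f x ≢ 0ℚ) F

eval-zeroCoeffs : ∀ {d} (F : Poly (suc d)) t x → ¬ NonzeroCoeff F x → eval {suc d} F (t ∷ x) ≡ 0ℚ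
eval-zeroCoeffs []      t x none = refl
eval-zeroCoeffs (f ∷ F) t x none = trans
  (cong₂ (λ a b → a + t * b) (decidable-stable (eval f x ≟ 0ℚ) (none ∘ here)) (eval-zeroCoeffs F t x (none ∘ there)))
  (solve 1 (λ t → con 0ℚ :+ t :* con 0ℚ := con 0ℚ) refl t)

nonzeroCoeff? : ∀ {d} (F : Poly (suc d)) x → Dec (NonzeroCoeff F x)
nonzeroCoeff? F x = Any.any? (λ f → ¬? (eval f x ≟ 0ℚ)) F

eval-nonzero⇒coeff : ∀ {d} (F : Poly (suc d)) t x → eval {suc d} F (t ∷ x) ≢ 0ℚ → NonzeroCoeff F x
eval-nonzero⇒coeff F t x ≢0 = decidable-stable (nonzeroCoeff? F x) (≢0 ∘ eval-zeroCoeffs F t x)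

-- The shape of the bound makes Horner's scheme an induction: once D * ∣P∣ ≥ 1,
-- t ≥ (∣c∣ + 1) * D forces ∣c + t * P∣ ≥ 1.
horner-bound : ∀ c t P D → 1ℚ ℚ.≤ D * ∣ P ∣ → (∣ c ∣ + 1ℚ) * D ℚ.≤ t → 1ℚ ℚ.≤ 1ℚ * ∣ c + t * P ∣
horner-bound c t P D D≤ t≥ = begin
  1ℚ                            ≡⟨ solve 1 (λ a → con 1ℚ := (a :+ con 1ℚ) :- a) refl ∣ c ∣ ⟩
  (∣ c ∣ + 1ℚ) - ∣ c ∣           ≤⟨ ℚₚ.+-monoˡ-≤ (- ∣ c ∣) bound ⟩
  (∣ c + t * P ∣ + ∣ c ∣) - ∣ c ∣ ≡⟨ solve 2 (λ z a → (z :+ a) :- a := con 1ℚ :* z) refl ∣ c + t * P ∣ ∣ c ∣ ⟩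
  1ℚ * ∣ c + t * P ∣             ∎
  where
  open ℚₚ.≤-Reasoning
  p≤∣p∣ : ∀ p → p ℚ.≤ ∣ p ∣
  p≤∣p∣ p with ℚₚ.≤-total 0ℚ p
  ... | inj₁ 0≤p = ℚₚ.≤-reflexive (sym (ℚₚ.0≤p⇒∣p∣≡p 0≤p))
  ... | inj₂ p≤0 = ℚₚ.≤-trans p≤0 (ℚₚ.0≤∣p∣ p)
  instance
    _ = ℚₚ.∣-∣-nonNeg P
    _ = nonNegative (ℚₚ.+-mono-≤ (ℚₚ.0≤∣p∣ c) (ℚₚ.nonNegative⁻¹ 1ℚ))
  bound : ∣ c ∣ + 1ℚ ℚ.≤ ∣ c + t * P ∣ + ∣ c ∣
  bound = begin
    ∣ c ∣ + 1ℚ               ≡⟨ sym (ℚₚ.*-identityʳ _) ⟩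
    (∣ c ∣ + 1ℚ) * 1ℚ        ≤⟨ ℚₚ.*-monoˡ-≤-nonNeg (∣ c ∣ + 1ℚ) D≤ ⟩
    (∣ c ∣ + 1ℚ) * (D * ∣ P ∣) ≡⟨ sym (ℚₚ.*-assoc (∣ c ∣ + 1ℚ) D ∣ P ∣) ⟩
    (∣ c ∣ + 1ℚ) * D * ∣ P ∣  ≤⟨ ℚₚ.*-monoʳ-≤-nonNeg ∣ P ∣ (ℚₚ.≤-trans t≥ (p≤∣p∣ t)) ⟩
    ∣ t ∣ * ∣ P ∣             ≡⟨ sym (ℚₚ.∣p*q∣≡∣p∣*∣q∣ t P) ⟩
    ∣ t * P ∣                ≡⟨ cong ∣_∣ (solve 2 (λ c z → z := (c :+ z) :- c) refl c (t * P)) ⟩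
    ∣ (c + t * P) - c ∣      ≤⟨ ℚₚ.∣p-q∣≤∣p∣+∣q∣ (c + t * P) c ⟩
    ∣ c + t * P ∣ + ∣ c ∣    ∎

-- The bound must hold for all large `t`, not at a single point, so that two polynomials can later
-- be treated with one `t`. Horner's scheme drives the induction; once the tail has no nonzero
-- coefficient at `x`, the value is the constant `c`, and the reciprocal of its absolute value
-- serves as `D`.
eventually-bounded : ∀ {d} (F : Poly (suc d)) x → NonzeroCoeff F x →
  ∃ λ B → ∃ λ D → ∀ t → B ℚ.≤ t → 1ℚ ℚ.≤ D * ∣ eval {suc d} F (t ∷ x) ∣
eventually-bounded (f ∷ F) x nz with nonzeroCoeff? F x
... | yes nzF with eventually-bounded F x nzF
...   | B , D , bound = B ⊔ (∣ eval f x ∣ + 1ℚ) * D , 1ℚ , λ t B≤t →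
        horner-bound (eval f x) t (eval F (t ∷ x)) D
          (bound t (ℚₚ.≤-trans (ℚₚ.p≤p⊔q B _) B≤t)) (ℚₚ.≤-trans (ℚₚ.p≤q⊔p B _) B≤t)
eventually-bounded (f ∷ F) x nz | no ¬nzF = 0ℚ , ∣ 1/ c ∣ , λ t _ → ℚₚ.≤-reflexive (begin
  1ℚ                ≡⟨ cong ∣_∣ (sym (ℚₚ.*-inverseˡ c)) ⟩
  ∣ 1/ c * c ∣       ≡⟨ ℚₚ.∣p*q∣≡∣p∣*∣q∣ (1/ c) c ⟩
  ∣ 1/ c ∣ * ∣ c ∣    ≡⟨ cong (λ z → ∣ 1/ c ∣ * ∣ z ∣) (sym (trans
                         (cong (λ z → c + t * z) (eval-zeroCoeffs F t x ¬nzF))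
                         (solve 2 (λ c t → c :+ t :* con 0ℚ := c) refl c t))) ⟩
  ∣ 1/ c ∣ * ∣ c + t * eval F (t ∷ x) ∣ ∎)
  where
  open ≡-Reasoning
  c = eval f x
  instance _ = ≢-nonZero (Any.head ¬nzF nz)

bounded⇒≢0 : ∀ D P → 1ℚ ℚ.≤ D * ∣ P ∣ → P ≢ 0ℚ
bounded⇒≢0 D .0ℚ bound refl = ℚₚ.<-irrefl refl (ℚₚ.<-≤-trans (ℚₚ.positive⁻¹ 1ℚ) (ℚₚ.≤-trans bound (ℚₚ.≤-reflexive (ℚₚ.*-zeroʳ D))))

coeff⇒eval-nonzero : ∀ {d} (F : Poly (suc d)) x → NonzeroCoeff F x → ∃ λ t → eval {suc d} F (t ∷ x) ≢ 0ℚ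
coeff⇒eval-nonzero F x nz with eventually-bounded F x nz
... | B , D , bound = B , bounded⇒≢0 D _ (bound B ℚₚ.≤-refl)

nonvanishing? : ∀ {d} (f : Poly d) → (∃ λ x → eval f x ≢ 0ℚ) ⊎ (∀ x → eval f x ≡ 0ℚ)
nonvanishing? {zero} q with q ≟ 0ℚ
... | yes q≡0 = inj₂ λ { [] → q≡0 }
... | no  q≢0 = inj₁ ([] , q≢0)
nonvanishing? {suc d} [] = inj₂ λ { (t ∷ x) → refl }
nonvanishing? {suc d} (f ∷ F) with nonvanishing? f
... | inj₁ (x , f≢0) with coeff⇒eval-nonzero (f ∷ F) x (here f≢0)
...   | t , ≢0 = inj₁ (t ∷ x , ≢0)
nonvanishing? {suc d} (f ∷ F) | inj₂ f≡0 with nonvanishing? {suc d} F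
... | inj₂ F≡0 = inj₂ λ { (t ∷ x) → trans (cong₂ (λ a b → a + t * b) (f≡0 x) (F≡0 (t ∷ x)))
                                      (solve 1 (λ t → con 0ℚ :+ t :* con 0ℚ := con 0ℚ) refl t) }
-- The point itself cannot be kept, because `t` may be zero and is multiplied in. It serves only to
-- exhibit a nonzero coefficient.
... | inj₁ (t ∷ x , F≢0) with coeff⇒eval-nonzero (f ∷ F) x (there (eval-nonzero⇒coeff F t x F≢0))
...   | t′ , ≢0 = inj₁ (t′ ∷ x , ≢0)

-- By induction one nonzero coefficient of each polynomial survives at a common point in the
-- remaining variables; above it every large first coordinate suits both.
common-nonvanishing : ∀ {d} (f g : Poly d) x y → eval f x ≢ 0ℚ → eval g y ≢ 0ℚ →
  ∃ λ z → eval f z ≢ 0ℚ × eval g z ≢ 0ℚ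
common-nonvanishing {zero} f g [] [] f≢0 g≢0 = [] , f≢0 , g≢0
common-nonvanishing {suc d} F G (t ∷ x) (s ∷ y) F≢0 G≢0
  with find (eval-nonzero⇒coeff F t x F≢0) | find (eval-nonzero⇒coeff G s y G≢0)
... | f , f∈F , f≢0 | g , g∈G , g≢0 with common-nonvanishing f g x y f≢0 g≢0
... | z , fz≢0 , gz≢0
  with eventually-bounded F z (lose f∈F fz≢0) | eventually-bounded G z (lose g∈G gz≢0)
... | B , D , bF | B′ , D′ , bG = B ⊔ B′ ∷ z ,
      bounded⇒≢0 D _ (bF _ (ℚₚ.p≤p⊔q B B′)) , bounded⇒≢0 D′ _ (bG _ (ℚₚ.p≤q⊔p B B′))

-- Generic placements

indep-cong : ∀ {C : Set} {k} {A B : Fin k → C → ℚ} → (∀ i c → B i c ≡ A i c) → Indep A → Indep B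
indep-cong = indep-reindex id id

evalRows : ∀ {C : Set} {k d} → (Fin k → C → Poly d) → Vec ℚ d → Fin k → C → ℚ
evalRows A x i c = eval (A i c) x

reduceP : ∀ {C : Set} {k d} → (Fin (suc k) → C → Poly d) → C → Fin k → C → Poly d
reduceP A c₀ i c = subP (mulP (A zero c₀) (A (suc i) c)) (mulP (A (suc i) c₀) (A zero c))

eval-reduce : ∀ {C : Set} {k d} (A : Fin (suc k) → C → Poly d) c₀ x i c →
  reduce (evalRows A x) c₀ i c ≡ evalRows (reduceP A c₀) x i c
eval-reduce A c₀ x i c = sym (trans (eval-sub (mulP (A zero c₀) (A (suc i) c)) (mulP (A (suc i) c₀) (A zero c)) x)
  (cong₂ _-_ (eval-mul (A zero c₀) (A (suc i) c) x) (eval-mul (A (suc i) c₀) (A zero c) x)))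

eval-mul≢0 : ∀ {d} (f g : Poly d) x → eval f x ≢ 0ℚ → eval g x ≢ 0ℚ → eval (mulP f g) x ≢ 0ℚ
eval-mul≢0 f g x f≢0 g≢0 fg≡0 = *-≢0 f≢0 g≢0 (trans (sym (eval-mul f g x)) fg≡0)

eval-mul≢0⁻ : ∀ {d} (f g : Poly d) x → eval (mulP f g) x ≢ 0ℚ → eval f x ≢ 0ℚ × eval g x ≢ 0ℚ
eval-mul≢0⁻ f g x fg≢0 =
    (λ f≡0 → fg≢0 (trans (eval-mul f g x) (trans (cong (_* eval g x) f≡0) (ℚₚ.*-zeroˡ (eval g x)))))
  , (λ g≡0 → fg≢0 (trans (eval-mul f g x) (trans (cong (eval f x *_) g≡0) (ℚₚ.*-zeroʳ (eval f x)))))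

eval-one≢0 : ∀ {d} (x : Vec ℚ d) → eval (constP 1ℚ) x ≢ 0ℚ
eval-one≢0 x e = 1≢0 (trans (sym (eval-const 1ℚ x)) e)

-- Symbolic Gaussian elimination. The predicate Nz decides which entries may serve as pivots: it is
-- instantiated both by "nonzero at a given point" and by "not identically zero".
module Elimination {d : ℕ} {C : Set} (search : Searchable C) (Nz : Poly d → Set) (Nz? : ∀ f → Dec (Nz f))
  (Nz-one : Nz (constP 1ℚ)) (Nz-mul : ∀ f g → Nz f → Nz g → Nz (mulP f g)) where

  -- The witness is the product of the pivots used. In the second case some row has run out of
  -- admissible pivots, so the rows are dependent wherever the pivots are nonzero and all
  -- inadmissible entries vanish.
  eliminate : ∀ {k} (A : Fin k → C → Poly d) →
    (∃ λ f → Nz f × ∀ x → eval f x ≢ 0ℚ → Indep (evalRows A x)) ⊎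
    (∃ λ g → Nz g × ∀ x → eval g x ≢ 0ℚ → (∀ e → ¬ Nz e → eval e x ≡ 0ℚ) → ¬ Indep (evalRows A x))
  eliminate {zero}  A = inj₁ (constP 1ℚ , Nz-one , λ x _ μ _ ())
  eliminate {suc k} A with search (λ c → Nz? (A zero c))
  ... | no none = inj₂ (constP 1ℚ , Nz-one , λ x _ vanish →
          indep-firstRow≢0 (evalRows A x) (λ c → vanish (A zero c) (λ nz → none (c , nz))))
  ... | yes (c₀ , nz) with eliminate (reduceP A c₀)
  ...   | inj₁ (f , nzf , ind) = inj₁ (mulP (A zero c₀) f , Nz-mul _ f nz nzf , λ x ≢0 →
            let (e≢0 , f≢0) = eval-mul≢0⁻ (A zero c₀) f x ≢0
            in indep-unreduce (evalRows A x) c₀ e≢0 (indep-cong (eval-reduce A c₀ x) (ind x f≢0)))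
  ...   | inj₂ (f , nzf , dep) = inj₂ (mulP (A zero c₀) f , Nz-mul _ f nz nzf , λ x ≢0 vanish ind →
            let (e≢0 , f≢0) = eval-mul≢0⁻ (A zero c₀) f x ≢0
            in dep x f≢0 vanish (indep-cong (λ i c → sym (eval-reduce A c₀ x i c))
                 (indep-reduce (evalRows A x) c₀ e≢0 ind)))

-- With "nonzero at `x`" as the pivot test, inadmissible entries do vanish at `x`, so a dependent
-- outcome would already contradict independence there.
indep-open : ∀ {d k} {C : Set} → Searchable C → (A : Fin k → C → Poly d) → ∀ x → Indep (evalRows A x) →
  ∃ λ f → eval f x ≢ 0ℚ × ∀ y → eval f y ≢ 0ℚ → Indep (evalRows A y)
indep-open search A x ind with eliminate A
  where open Elimination search (λ f → eval f x ≢ 0ℚ) (λ f → ¬? (eval f x ≟ 0ℚ))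
               (eval-one≢0 x) (λ f g → eval-mul≢0 f g x)
... | inj₁ witness = witness
... | inj₂ (g , g≢0 , dep) = ⊥-elim (dep x g≢0 (λ e → decidable-stable (eval e x ≟ 0ℚ)) ind)

-- Here a pivot is an entry that is not identically zero. If elimination reports dependence,
-- independence at any point would persist on a nonvanishing set, which meets the nonvanishing set
-- of the pivots: a contradiction.
indep-somewhere? : ∀ {d k} {C : Set} → Searchable C → (A : Fin k → C → Poly d) →
  Dec (∃ λ x → Indep (evalRows A x))
indep-somewhere? {d} search A with eliminate A
  where
  nv? : ∀ (f : Poly d) → Dec (∃ λ x → eval f x ≢ 0ℚ)
  nv? f with nonvanishing? f
  ... | inj₁ nv  = yes nv
  ... | inj₂ f≡0 = no λ { (x , f≢0) → f≢0 (f≡0 x) }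
  nv-mul : ∀ (f g : Poly d) → (∃ λ x → eval f x ≢ 0ℚ) → (∃ λ x → eval g x ≢ 0ℚ) → ∃ λ x → eval (mulP f g) x ≢ 0ℚ
  nv-mul f g (x , f≢0) (y , g≢0) =
    let (z , fz≢0 , gz≢0) = common-nonvanishing f g x y f≢0 g≢0 in z , eval-mul≢0 f g z fz≢0 gz≢0
  open Elimination search (λ f → ∃ λ x → eval f x ≢ 0ℚ) nv?
         (Vec.replicate d 0ℚ , eval-one≢0 (Vec.replicate d 0ℚ))
         nv-mul
... | inj₁ (f , (x , f≢0) , ind) = yes (x , ind x f≢0)
... | inj₂ (g , (y , g≢0) , dep) = no λ { (x , ind) →
        let (f , f≢0 , indf) = indep-open search A x ind
            (z , fz , gz) = common-nonvanishing f g x y f≢0 g≢0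
        in dep z gz (λ e ¬nz → decidable-stable (eval e z ≟ 0ℚ) (λ e≢0 → ¬nz (z , e≢0))) (indf z fz) }

-- An enumeration that may repeat elements. It is enough for naming coordinates and for searching.
record Finite (V : Set) : Set where
  field
    size        : ℕ
    point       : Fin size → V
    index       : V → Fin size
    point-index : ∀ v → point (index v) ≡ v

Placement : Set → Set
Placement V = V → Fin 3 → ℚ

row : ∀ {V : Set} → DecidableEquality V → Placement V → Pair V → V × Fin 3 → ℚ
row eqV p e (w , c) = rowEntry eqV p e w c

rows : ∀ {V : Set} → DecidableEquality V → Placement V → (L : List (Pair V)) → Fin (length L) → V × Fin 3 → ℚ
rows eqV p L i = row eqV p (lookup L i)

RowsIndep : ∀ {V : Set} → DecidableEquality V → Placement V → List (Pair V) → Set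
RowsIndep eqV p L = Indep (rows eqV p L)

toRowsIndep : ∀ {V : Set} (eqV : DecidableEquality V) p L → RowsIndependentAt eqV p L → RowsIndep eqV p L
toRowsIndep eqV p L ind μ μA =
  ind μ (λ w c → trans (Σℚ-tabulate (λ k → μ k * rowEntry eqV p (lookup L k) w c)) (μA (w , c)))

fromRowsIndep : ∀ {V : Set} (eqV : DecidableEquality V) p L → RowsIndep eqV p L → RowsIndependentAt eqV p L
fromRowsIndep eqV p L ind μ μA =
  ind μ (λ { (w , c) → trans (sym (Σℚ-tabulate (λ k → μ k * rowEntry eqV p (lookup L k) w c))) (μA w c) })

differences : ∀ {V : Set} → Placement V → (L : List (Pair V)) → Fin (length L) → Fin 3 → ℚ
differences p L i c = p (proj₁ (lookup L i)) c - p (proj₂ (lookup L i)) c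

module GenericPlacement {V : Set} (finite : Finite V) (eqV : DecidableEquality V) where
  open Finite finite

  place : Vec ℚ (size ℕ.* 3) → Placement V
  place x v c = Vec.lookup x (combine (index v) c)

  coords : Placement V → Vec ℚ (size ℕ.* 3)
  coords p = Vec.tabulate (λ l → p (point (proj₁ (remQuot {size} 3 l))) (proj₂ (remQuot {size} 3 l)))

  place-coords : ∀ p v c → place (coords p) v c ≡ p v c
  place-coords p v c = trans (Vecₚ.lookup∘tabulate (λ l → p (point (proj₁ (remQuot {size} 3 l))) (proj₂ (remQuot {size} 3 l))) (combine (index v) c))
    (trans (cong (λ z → p (point (proj₁ z)) (proj₂ z)) (Finₚ.remQuot-combine (index v) c))
      (cong (λ v → p v c) (point-index v)))

  searchV×3 : Searchable (V × Fin 3)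
  searchV×3 {P} P? with Finₚ.any? (λ a → Finₚ.any? (λ c → P? (point a , c)))
  ... | yes (a , c , pac) = yes ((point a , c) , pac)
  ... | no none = no λ { ((v , c) , pvc) → none (index v , c , subst (λ v → P (v , c)) (sym (point-index v)) pvc) }

  coordP : V → Fin 3 → Poly (size ℕ.* 3)
  coordP v c = varP (combine (index v) c)

  rowP : Pair V → V × Fin 3 → Poly (size ℕ.* 3)
  rowP (u , v) (w , c) with eqV w u | eqV w v
  ... | yes _ | _     = subP (coordP u c) (coordP v c)
  ... | no _  | yes _ = subP (coordP v c) (coordP u c)
  ... | no _  | no _  = constP 0ℚ

  eval-coords : ∀ u v c x → eval (subP (coordP u c) (coordP v c)) x ≡ place x u c - place x v c
  eval-coords u v c x = trans (eval-sub (coordP u c) (coordP v c) x)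
    (cong₂ _-_ (eval-var (combine (index u) c) x) (eval-var (combine (index v) c) x))

  eval-row : ∀ e wc x → eval (rowP e wc) x ≡ row eqV (place x) e wc
  eval-row (u , v) (w , c) x with eqV w u | eqV w v
  ... | yes _ | _     = eval-coords u v c x
  ... | no _  | yes _ = eval-coords v u c x
  ... | no _  | no _  = eval-const 0ℚ x

  row-cong : ∀ {p q : Placement V} → (∀ v c → p v c ≡ q v c) → ∀ e wc → row eqV p e wc ≡ row eqV q e wc
  row-cong p≗q (u , v) (w , c) with eqV w u | eqV w v
  ... | yes _ | _     = cong₂ _-_ (p≗q u c) (p≗q v c)
  ... | no _  | yes _ = cong₂ _-_ (p≗q v c) (p≗q u c)
  ... | no _  | no _  = refl

  -- A nonempty Zariski-open set of placements on which `P` holds. Unlike the existence of one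
  -- placement, this is stable under finite conjunction.
  record Generic (P : Placement V → Set) : Set where
    constructor generic
    field
      {polynomial} : Poly (size ℕ.* 3)
      {witness}    : Vec ℚ (size ℕ.* 3)
      nonzero      : eval polynomial witness ≢ 0ℚ
      holds        : ∀ x → eval polynomial x ≢ 0ℚ → P (place x)

  generic-∃ : ∀ {P} → Generic P → ∃ P
  generic-∃ (generic {witness = x} f≢0 P) = place x , P x f≢0

  generic-map : ∀ {P Q : Placement V → Set} → (∀ {p} → P p → Q p) → Generic P → Generic Q
  generic-map P⇒Q (generic f≢0 P) = generic f≢0 (λ x fx≢0 → P⇒Q (P x fx≢0))

  generic-× : ∀ {P Q} → Generic P → Generic Q → Generic (λ p → P p × Q p)
  generic-× (generic {f} {x} f≢0 P) (generic {g} {y} g≢0 Q) =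
    let (z , fz≢0 , gz≢0) = common-nonvanishing f g x y f≢0 g≢0
    in generic {polynomial = mulP f g} {z} (eval-mul≢0 f g z fz≢0 gz≢0) λ w fgw≢0 →
         let (fw≢0 , gw≢0) = eval-mul≢0⁻ f g w fgw≢0 in P w fw≢0 , Q w gw≢0

  generic-∀ : ∀ {k} {P : Fin k → Placement V → Set} → (∀ i → Generic (P i)) → Generic (λ p → ∀ i → P i p)
  generic-∀ {zero}  gen = generic {polynomial = constP 1ℚ} {coords (λ _ _ → 0ℚ)} (eval-one≢0 (coords (λ _ _ → 0ℚ))) (λ _ _ ())
  generic-∀ {suc k} {P} gen = generic-map (λ (P₀ , Pₛ) → λ { zero → P₀ ; (suc i) → Pₛ i })
    (generic-× (gen zero) (generic-∀ {k} {P ∘ suc} (gen ∘ suc)))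

  rowsP : ∀ L → Fin (length L) → V × Fin 3 → Poly (size ℕ.* 3)
  rowsP L i = rowP (lookup L i)

  rowsP⇒rows : ∀ L x → Indep (evalRows (rowsP L) x) → RowsIndep eqV (place x) L
  rowsP⇒rows L x = indep-cong (λ i wc → sym (eval-row (lookup L i) wc x))

  rows⇒rowsP : ∀ L p → RowsIndep eqV p L → Indep (evalRows (rowsP L) (coords p))
  rows⇒rowsP L p = indep-cong (λ i wc →
    trans (eval-row (lookup L i) wc (coords p)) (row-cong (place-coords p) (lookup L i) wc))

  generic-indep : ∀ {L} → IndepR3 eqV L → Generic (λ p → RowsIndep eqV p L)
  generic-indep {L} (p , ind) =
    let (f , f≢0 , indf) = indep-open searchV×3 (rowsP L) (coords p) (rows⇒rowsP L p (toRowsIndep eqV p L ind))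
    in generic f≢0 (λ y fy≢0 → rowsP⇒rows L y (indf y fy≢0))

  -- Independence at some placement becomes decidable by symbolic elimination; this makes the
  -- extraction of a circuit constructive.
  indepR3? : ∀ L → Dec (IndepR3 eqV L)
  indepR3? L with indep-somewhere? searchV×3 (rowsP L)
  ... | yes (x , ind) = yes (place x , fromRowsIndep eqV (place x) L (rowsP⇒rows L x ind))
  ... | no none = no λ (p , ind) → none (coords p , rows⇒rowsP L p (toRowsIndep eqV p L ind))

  -- The map `κ` selects coordinates: pinning vertices for the rank bound involves one or two of
  -- them, placing a new vertex all three.
  generic-differences : ∀ {l} (κ : Fin l → Fin 3) L p → Indep (λ i c → differences p L i (κ c)) →
    Generic (λ p → Indep (λ i c → differences p L i (κ c)))
  generic-differences {l} κ L p ind =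
    let (f , f≢0 , indf) = indep-open Finₚ.any? differencesP (coords p)
          (indep-cong (λ i c → trans (eval-coords (start i) (end i) (κ c) (coords p))
            (cong₂ _-_ (place-coords p (start i) (κ c)) (place-coords p (end i) (κ c)))) ind)
    in generic f≢0 (λ y fy≢0 → indep-cong (λ i c → sym (eval-coords (start i) (end i) (κ c) y)) (indf y fy≢0))
    where
    start end : Fin (length L) → V
    start i = proj₁ (lookup L i)
    end i = proj₂ (lookup L i)
    differencesP : Fin (length L) → Fin l → Poly (size ℕ.* 3)
    differencesP i c = subP (coordP (start i) (κ c)) (coordP (end i) (κ c))

-- Independent edge lists

SameEdge-sym : ∀ {V : Set} {e f : Pair V} → SameEdge e f → SameEdge f e
SameEdge-sym (inj₁ (refl , refl)) = inj₁ (refl , refl)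
SameEdge-sym (inj₂ (refl , refl)) = inj₂ (refl , refl)

SameEdge-trans : ∀ {V : Set} {e f g : Pair V} → SameEdge e f → SameEdge f g → SameEdge e g
SameEdge-trans (inj₁ (refl , refl)) s = s
SameEdge-trans (inj₂ (refl , refl)) (inj₁ (refl , refl)) = inj₂ (refl , refl)
SameEdge-trans (inj₂ (refl , refl)) (inj₂ (refl , refl)) = inj₁ (refl , refl)

SameEdge-refl : ∀ {V : Set} {e : Pair V} → SameEdge e e
SameEdge-refl = inj₁ (refl , refl)

allPairs-lookup : ∀ {A : Set} {R : A → A → Set} → (∀ {x y} → R x y → R y x) →
  ∀ {L} → AllPairs R L → ∀ i j → i ≢ j → R (lookup L i) (lookup L j)
allPairs-lookup Rsym (r ∷ rs) zero    zero    i≢j = ⊥-elim (i≢j refl)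
allPairs-lookup Rsym (r ∷ rs) zero    (suc j) i≢j = All.lookup r (∈-lookup j)
allPairs-lookup Rsym (r ∷ rs) (suc i) zero    i≢j = Rsym (All.lookup r (∈-lookup i))
allPairs-lookup Rsym (r ∷ rs) (suc i) (suc j) i≢j = allPairs-lookup Rsym rs i j (i≢j ∘ cong suc)

-- No two entries of `L` share a partner, so choosing any partner for each is injective. This serves
-- both to compare lengths and to reindex rows.
module Matching {A B : Set} {R : A → B → Set} {L : List A} {M : List B}
  (apart : AllPairs (λ a a′ → ∀ b → R a b → R a′ b → ⊥) L) (matched : All (λ a → Any (R a) M) L) where

  match : Fin (length L) → Fin (length M)
  match i = Any.index (All.lookup matched (∈-lookup i))

  match-related : ∀ i → R (lookup L i) (lookup M (match i))
  match-related i = Anyₚ.lookup-index (All.lookup matched (∈-lookup i))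

  match-injective : Injective _≡_ _≡_ match
  match-injective {i} {j} eq = decidable-stable (i ≟F j) λ i≢j →
    allPairs-lookup {R = λ a a′ → ∀ b → R a b → R a′ b → ⊥} (λ r b x y → r b y x) apart i j i≢j _
      (match-related i) (subst (λ k → R (lookup L j) (lookup M k)) (sym eq) (match-related j))

  length-≤ : length L ≤ length M
  length-≤ = Finₚ.injective⇒≤ match-injective

simple-apart : ∀ {V : Set} {L : List (Pair V)} → SimpleList L →
  AllPairs (λ e e′ → ∀ f → SameEdge e f → SameEdge e′ f → ⊥) L
simple-apart (_ , distinct) =
  AllPairs.map (λ e≁e′ f s s′ → e≁e′ (SameEdge-trans s (SameEdge-sym s′))) distinct

module _ {V : Set} (eqV : DecidableEquality V) where

  ι= : V → V → ℚ
  ι= w u with eqV w u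
  ... | yes _ = 1ℚ
  ... | no _  = 0ℚ

  ι=-refl : ∀ w → ι= w w ≡ 1ℚ
  ι=-refl w with eqV w w
  ... | yes _   = refl
  ... | no  w≢w = ⊥-elim (w≢w refl)

  ι=-≢ : ∀ {w u} → w ≢ u → ι= w u ≡ 0ℚ
  ι=-≢ {w} {u} w≢u with eqV w u
  ... | yes w≡u = ⊥-elim (w≢u w≡u)
  ... | no  _   = refl

  -- Indicator functions replace the case distinction, so that identities between rows become ring
  -- identities. Loops are covered too, since both sides then vanish.
  rowEntry-formula : ∀ (p : Placement V) u v w c →
    rowEntry eqV p (u , v) w c ≡ ι= w u * (p u c - p v c) + ι= w v * (p v c - p u c)
  rowEntry-formula p u v w c with eqV w u | eqV w v
  ... | yes refl | yes refl = solve 1 (λ a → a :- a := con 1ℚ :* (a :- a) :+ con 1ℚ :* (a :- a)) refl (p u c)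
  ... | yes _    | no _     = solve 2 (λ a b → a :- b := con 1ℚ :* (a :- b) :+ con 0ℚ :* (b :- a)) refl (p u c) (p v c)
  ... | no _     | yes _    = solve 2 (λ a b → b :- a := con 0ℚ :* (a :- b) :+ con 1ℚ :* (b :- a)) refl (p u c) (p v c)
  ... | no _     | no _     = solve 2 (λ a b → con 0ℚ := con 0ℚ :* (a :- b) :+ con 0ℚ :* (b :- a)) refl (p u c) (p v c)

  row-start : ∀ p u v c → u ≢ v → rowEntry eqV p (u , v) u c ≡ p u c - p v c
  row-start p u v c u≢v = trans (rowEntry-formula p u v u c)
    (trans (cong₂ (λ x y → x * (p u c - p v c) + y * (p v c - p u c)) (ι=-refl u) (ι=-≢ u≢v))
      (solve 2 (λ a b → con 1ℚ :* (a :- b) :+ con 0ℚ :* (b :- a) := a :- b) refl (p u c) (p v c)))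

  row-off : ∀ p u v w c → w ≢ u → w ≢ v → rowEntry eqV p (u , v) w c ≡ 0ℚ
  row-off p u v w c w≢u w≢v = trans (rowEntry-formula p u v w c)
    (trans (cong₂ (λ x y → x * (p u c - p v c) + y * (p v c - p u c)) (ι=-≢ w≢u) (ι=-≢ w≢v))
      (solve 2 (λ a b → con 0ℚ :* (a :- b) :+ con 0ℚ :* (b :- a) := con 0ℚ) refl (p u c) (p v c)))

  row-sameEdge : ∀ p {e f} → SameEdge e f → ∀ wc → row eqV p e wc ≡ row eqV p f wc
  row-sameEdge p (inj₁ (refl , refl)) wc = refl
  row-sameEdge p {u , v} (inj₂ (refl , refl)) (w , c) = trans (rowEntry-formula p u v w c)
    (trans (ℚₚ.+-comm (ι= w u * (p u c - p v c)) (ι= w v * (p v c - p u c))) (sym (rowEntry-formula p v u w c)))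

  indep-mono : ∀ p {L L′} → SimpleList L′ → All (λ e → Any (SameEdge e) L) L′ →
    RowsIndep eqV p L → RowsIndep eqV p L′
  indep-mono p simple matched = indep-reindex match match-injective
      (λ i → row-sameEdge p (match-related i))
    where open Matching (simple-apart simple) matched

  indep-↭ : ∀ p {L L′} → L ↭ L′ → RowsIndep eqV p L → RowsIndep eqV p L′
  indep-↭ p L↭L′ = indep-reindex (Inverse.to π) inj
      (λ i wc → cong (λ e → row eqV p e wc) (onIndices-lookup (setoid _) L′↭L i))
    where
    L′↭L = ↭⇒↭ₛ (↭-sym L↭L′)
    π = onIndices L′↭L
    inj : Injective _≡_ _≡_ (Inverse.to π)
    inj eq = trans (sym (Inverse.inverseʳ π refl)) (trans (cong (Inverse.from π) eq) (Inverse.inverseʳ π refl))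

  indep-tail : ∀ p {e L} → RowsIndep eqV p (e ∷ L) → RowsIndep eqV p L
  indep-tail p {e} {L} = indep-reindex {A = rows eqV p (e ∷ L)} suc Finₚ.suc-injective (λ _ _ → refl)

  -- A loop has a zero row, and two copies of an edge, in whatever orientation, have equal rows.
  indep⇒simple : ∀ p {L} → RowsIndep eqV p L → SimpleList L
  indep⇒simple p {[]} ind = [] , []
  indep⇒simple p {(u , v) ∷ L} ind with indep⇒simple p (indep-tail p {u , v} {L} ind)
  ... | noLoops , distinct = (u≢v ∷ noLoops) , (All.tabulate fresh ∷ distinct)
    where
    u≢v : u ≢ v
    u≢v refl = indep-firstRow≢0 (rows eqV p ((u , u) ∷ L)) (λ { (w , c) →
      trans (rowEntry-formula p u u w c)
        (solve 2 (λ i a → i :* (a :- a) :+ i :* (a :- a) := con 0ℚ) refl (ι= w u) (p u c)) }) ind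
    fresh : ∀ {f} → f ∈ L → ¬ SameEdge (u , v) f
    fresh {f} f∈L same = 1≢0 (ind μ vanish zero)
      where
      k = Any.index f∈L
      A = rows eqV p L
      μ : Fin (suc (length L)) → ℚ
      μ zero    = 1ℚ
      μ (suc i) = (- 1ℚ) * δ k i
      vanish : ∀ wc → comb μ (rows eqV p ((u , v) ∷ L)) wc ≡ 0ℚ
      vanish wc = trans (cong₂ _+_ (cong (1ℚ *_) (trans (row-sameEdge p same wc)
          (cong (λ e → row eqV p e wc) (Anyₚ.lookup-index f∈L))))
          (trans (∑-cong (λ i → ℚₚ.*-assoc (- 1ℚ) (δ k i) (A i wc)))
            (trans (∑-* (- 1ℚ) (λ i → δ k i * A i wc)) (cong ((- 1ℚ) *_) (∑-δ k (λ i → A i wc))))))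
        (solve 1 (λ a → con 1ℚ :* a :+ con (- 1ℚ) :* a := con 0ℚ) refl (A k wc))

indep-columns : ∀ {C C′ : Set} {k} {A : Fin k → C → ℚ} (κ : C′ → C) → Indep (λ i c → A i (κ c)) → Indep A
indep-columns κ ind μ μA = ind μ (μA ∘ κ)

lookup-map : ∀ {A B : Set} (f : A → B) L i → lookup (map f L) i ≡ f (lookup L (cast (length-map f L) i))
lookup-map f (x ∷ L) zero    = refl
lookup-map f (x ∷ L) (suc i) = lookup-map f L i

cast-injective : ∀ {k l} (eq : k ≡ l) → Injective _≡_ _≡_ (cast eq)
cast-injective refl {i} {j} e = trans (sym (Finₚ.cast-is-id refl i)) (trans e (Finₚ.cast-is-id refl j))

mapPair : ∀ {V W : Set} → (V → W) → Pair V → Pair W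
mapPair j (u , v) = j u , j v

module _ {V W : Set} (eqV : DecidableEquality V) (eqW : DecidableEquality W) (j : V → W)
  (j-inj : ∀ {u v} → j u ≡ j v → u ≡ v) where

  row-image : ∀ (p : Placement W) e v c → row eqW p (mapPair j e) (j v , c) ≡ row eqV (λ v → p (j v)) e (v , c)
  row-image p (a , b) v c = trans (rowEntry-formula eqW p (j a) (j b) (j v) c)
    (trans (cong₂ (λ x y → x * (p (j a) c - p (j b) c) + y * (p (j b) c - p (j a) c)) (ι=-image a) (ι=-image b))
      (sym (rowEntry-formula eqV (λ v → p (j v)) a b v c)))
    where
    ι=-image : ∀ u → ι= eqW (j v) (j u) ≡ ι= eqV v u
    ι=-image u with eqV v u
    ... | yes refl = ι=-refl eqW (j v)
    ... | no v≢u   = ι=-≢ eqW (v≢u ∘ j-inj)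

  indep-map⁺ : ∀ p L → RowsIndep eqV (λ v → p (j v)) L → RowsIndep eqW p (map (mapPair j) L)
  indep-map⁺ p L ind = indep-columns (λ { (v , c) → (j v , c) })
    (indep-reindex (cast (length-map (mapPair j) L)) (cast-injective (length-map (mapPair j) L))
      (λ { i (v , c) → trans (cong (λ e → row eqW p e (j v , c)) (lookup-map (mapPair j) L i))
                         (row-image p (lookup L (cast (length-map (mapPair j) L) i)) v c) }) ind)

  -- A relation over `V` has to be verified in the columns of all of `W`. Off the image of `j` every
  -- entry is zero, and finiteness of `V` decides which case applies.
  indep-map⁻ : Finite V → ∀ p L → RowsIndep eqW p (map (mapPair j) L) → RowsIndep eqV (λ v → p (j v)) L
  indep-map⁻ finite p L ind μ μA = indB μ μB
    where
    open Finite finite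
    B : Fin (length L) → W × Fin 3 → ℚ
    B i = row eqW p (mapPair j (lookup L i))
    len = length-map (mapPair j) L
    indB : Indep B
    indB = indep-reindex (cast (sym len)) (cast-injective (sym len))
      (λ i wc → cong (λ e → row eqW p e wc)
        (trans (cong (mapPair j ∘ lookup L) (sym (Finₚ.cast-involutive len (sym len) i)))
          (sym (lookup-map (mapPair j) L (cast (sym len) i))))) ind
    μB : ∀ wc → comb μ B wc ≡ 0ℚ
    μB (w , c) with Finₚ.any? (λ a → eqW w (j (point a)))
    ... | yes (a , refl) = trans (∑-cong (λ i → cong (μ i *_) (row-image p (lookup L i) (point a) c))) (μA (point a , c))
    ... | no outside = ∑-zero (λ i → trans (cong (μ i *_) (row-off eqW p _ _ w c (w≢j _) (w≢j _))) (ℚₚ.*-zeroʳ (μ i)))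
      where
      w≢j : ∀ v → w ≢ j v
      w≢j v w≡jv = outside (index v , trans w≡jv (cong j (sym (point-index v))))

-- Vertex extensions

Avoids : ∀ {V : Set} → V → Pair V → Set
Avoids x e = x ≢ proj₁ e × x ≢ proj₂ e

star : ∀ {V : Set} → V → List V → List (Pair V)
star x = map (x ,_)

module _ {E : Set} {C : Set} (g : E → C → ℚ) {L : List E} where

  leftPart : ∀ M → (Fin (length (M ++ L)) → ℚ) → Fin (length M) → ℚ
  leftPart (e ∷ M) μ zero    = μ zero
  leftPart (e ∷ M) μ (suc i) = leftPart M (μ ∘ suc) i

  rightPart : ∀ M → (Fin (length (M ++ L)) → ℚ) → Fin (length L) → ℚ
  rightPart []      μ = μ
  rightPart (e ∷ M) μ = rightPart M (μ ∘ suc)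

  comb-++ : ∀ M μ c → comb μ (λ i → g (lookup (M ++ L) i)) c ≡
    comb (leftPart M μ) (λ i → g (lookup M i)) c + comb (rightPart M μ) (λ i → g (lookup L i)) c
  comb-++ []      μ c = sym (ℚₚ.+-identityˡ _)
  comb-++ (e ∷ M) μ c = trans (cong (μ zero * g e c +_) (comb-++ M (μ ∘ suc) c)) (sym (ℚₚ.+-assoc (μ zero * g e c)
    (comb (leftPart M (μ ∘ suc)) (λ i → g (lookup M i)) c) (comb (rightPart M (μ ∘ suc)) (λ i → g (lookup L i)) c)))

  parts≡0 : ∀ M μ → (∀ i → leftPart M μ i ≡ 0ℚ) → (∀ i → rightPart M μ i ≡ 0ℚ) → ∀ i → μ i ≡ 0ℚ
  parts≡0 []      μ l r i       = r i
  parts≡0 (e ∷ M) μ l r zero    = l zero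
  parts≡0 (e ∷ M) μ l r (suc i) = parts≡0 M (μ ∘ suc) (l ∘ suc) r i

module Extensions {V : Set} (eqV : DecidableEquality V) (p : Placement V) where

  comb-avoid : ∀ {x L} → All (Avoids x) L → ∀ μ c → comb μ (rows eqV p L) (x , c) ≡ 0ℚ
  comb-avoid {x} {L} avoids μ c = ∑-zero (λ i → let (≢u , ≢v) = All.lookup avoids (∈-lookup i) in
    trans (cong (μ i *_) (row-off eqV p _ _ x c ≢u ≢v)) (ℚₚ.*-zeroʳ (μ i)))

  comb-star : ∀ {x} As → All (x ≢_) As → (μ : Fin (length (star x As)) → ℚ) → ∀ c →
    comb μ (rows eqV p (star x As)) (x , c) ≡ comb μ (differences p (star x As)) c
  comb-star []       []           μ c = refl
  comb-star (a ∷ As) (x≢a ∷ x≢As) μ c =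
    cong₂ (λ y z → μ zero * y + z) (row-start eqV p _ a c x≢a) (comb-star As x≢As (μ ∘ suc) c)

  -- In the columns of `x` only the star is visible, as the difference vectors to its neighbours.
  -- These are independent, so the star's coefficients vanish first and a relation on `L` remains.
  zero-extension : ∀ {x} As {L} → All (x ≢_) As → All (Avoids x) L → Indep (differences p (star x As)) →
    RowsIndep eqV p L → RowsIndep eqV p (star x As ++ L)
  zero-extension {x} As {L} x≢As avoids indA indL μ μ≡0 = parts≡0 (row eqV p) (star x As) μ left≡0 right≡0
    where
    open ≡-Reasoning
    l = leftPart (row eqV p) {L} (star x As) μ
    r = rightPart (row eqV p) {L} (star x As) μ
    left≡0 : ∀ i → l i ≡ 0ℚ
    left≡0 = indA l λ c → begin
      comb l (differences p (star x As)) c   ≡⟨ sym (comb-star As x≢As l c) ⟩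
      comb l (rows eqV p (star x As)) (x , c) ≡⟨ sym (ℚₚ.+-identityʳ _) ⟩
      comb l (rows eqV p (star x As)) (x , c) + 0ℚ
        ≡⟨ cong (comb l (rows eqV p (star x As)) (x , c) +_) (sym (comb-avoid avoids r c)) ⟩
      comb l (rows eqV p (star x As)) (x , c) + comb r (rows eqV p L) (x , c)
        ≡⟨ sym (comb-++ (row eqV p) {L} (star x As) μ (x , c)) ⟩
      comb μ (rows eqV p (star x As ++ L)) (x , c) ≡⟨ μ≡0 (x , c) ⟩
      0ℚ ∎
    right≡0 : ∀ i → r i ≡ 0ℚ
    right≡0 = indL r λ wc → begin
      comb r (rows eqV p L) wc ≡⟨ sym (ℚₚ.+-identityˡ _) ⟩
      0ℚ + comb r (rows eqV p L) wc
        ≡⟨ cong (_+ comb r (rows eqV p L) wc) (sym (∑-zero (λ i → trans (cong (_* rows eqV p (star x As) i wc) (left≡0 i))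
             (ℚₚ.*-zeroˡ (rows eqV p (star x As) i wc))))) ⟩
      comb l (rows eqV p (star x As)) wc + comb r (rows eqV p L) wc
        ≡⟨ sym (comb-++ (row eqV p) {L} (star x As) μ wc) ⟩
      comb μ (rows eqV p (star x As ++ L)) wc ≡⟨ μ≡0 wc ⟩
      0ℚ ∎

  -- The new vertex x sits on the line through a and b, at 2b - a; a stress on the extended list then
  -- vanishes on xc and xd, and on xa and xb it acts like a stress on the deleted edge ab.
  henneberg-II : ∀ {x a b c d L} → (∀ k → p x k ≡ (p b k + p b k) - p a k) → All (x ≢_) (a ∷ b ∷ c ∷ d ∷ []) →
    All (Avoids x) L → Indep (differences p (star a (b ∷ c ∷ d ∷ []))) →
    RowsIndep eqV p ((a , b) ∷ L) → RowsIndep eqV p (star x (a ∷ b ∷ c ∷ d ∷ []) ++ L)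
  henneberg-II {x} {a} {b} {c} {d} {L} px x≢ avoids indA indL μ μ≡0 =
    λ { zero → μ₀≡0 ; (suc zero) → trans μ₁≡ (trans (cong (λ z → - (z + z)) μ₀≡0) refl)
      ; (suc (suc zero)) → μ₂≡0 ; (suc (suc (suc zero))) → μ₃≡0 ; (suc (suc (suc (suc i)))) → indL ν ν≡0 (suc i) }
    where
    open ≡-Reasoning
    S = star x (a ∷ b ∷ c ∷ d ∷ [])
    μ₀ = μ zero
    μ₁ = μ (suc zero)
    μ₂ = μ (suc (suc zero))
    μ₃ = μ (suc (suc (suc zero)))
    r : Fin (length L) → ℚ
    r i = μ (suc (suc (suc (suc i))))
    λ₄ : Fin 4 → ℚ
    λ₄ = leftPart (row eqV p) {L} S μ
    -- At `x = 2b - a` the vectors from `a`, `b`, `c`, `d` to `x` expand in `a - b`, `a - c`,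
    -- `a - d`; these are the resulting coefficients of the equilibrium at `x`.
    κ : Fin 3 → ℚ
    κ zero             = - (μ₀ + μ₀ + μ₁ + μ₂ + μ₂ + μ₃ + μ₃)
    κ (suc zero)       = μ₂
    κ (suc (suc zero)) = μ₃
    κ≡0 : ∀ i → κ i ≡ 0ℚ
    κ≡0 = indA κ λ k → begin
      κ zero * (p a k - p b k) + (μ₂ * (p a k - p c k) + (μ₃ * (p a k - p d k) + 0ℚ))
        ≡⟨ solve 8 (λ m₀ m₁ m₂ m₃ a b c d →
             (:- (m₀ :+ m₀ :+ m₁ :+ m₂ :+ m₂ :+ m₃ :+ m₃)) :* (a :- b) :+ (m₂ :* (a :- c) :+ (m₃ :* (a :- d) :+ con 0ℚ))
             := m₀ :* (((b :+ b) :- a) :- a) :+ (m₁ :* (((b :+ b) :- a) :- b)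
                :+ (m₂ :* (((b :+ b) :- a) :- c) :+ (m₃ :* (((b :+ b) :- a) :- d) :+ con 0ℚ)))) refl
             μ₀ μ₁ μ₂ μ₃ (p a k) (p b k) (p c k) (p d k) ⟩
      D ((p b k + p b k) - p a k) k ≡⟨ cong (λ z → D z k) (sym (px k)) ⟩
      comb λ₄ (differences p S) k   ≡⟨ sym (comb-star (a ∷ b ∷ c ∷ d ∷ []) x≢ λ₄ k) ⟩
      comb λ₄ (rows eqV p S) (x , k) ≡⟨ sym (ℚₚ.+-identityʳ _) ⟩
      comb λ₄ (rows eqV p S) (x , k) + 0ℚ ≡⟨ cong (comb λ₄ (rows eqV p S) (x , k) +_) (sym (comb-avoid avoids r k)) ⟩
      comb λ₄ (rows eqV p S) (x , k) + comb r (rows eqV p L) (x , k)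
        ≡⟨ sym (comb-++ (row eqV p) {L} S μ (x , k)) ⟩
      comb μ (rows eqV p (S ++ L)) (x , k) ≡⟨ μ≡0 (x , k) ⟩
      0ℚ ∎
      where
      D : ℚ → Fin 3 → ℚ
      D z k = μ₀ * (z - p a k) + (μ₁ * (z - p b k) + (μ₂ * (z - p c k) + (μ₃ * (z - p d k) + 0ℚ)))
    μ₂≡0 = κ≡0 (suc zero)
    μ₃≡0 = κ≡0 (suc (suc zero))
    μ₁≡ : μ₁ ≡ - (μ₀ + μ₀)
    μ₁≡ = begin
      μ₁ ≡⟨ solve 4 (λ m₀ m₁ m₂ m₃ → m₁ :=
              :- (:- (m₀ :+ m₀ :+ m₁ :+ m₂ :+ m₂ :+ m₃ :+ m₃)) :- (m₀ :+ m₀) :- (m₂ :+ m₂) :- (m₃ :+ m₃)) refl μ₀ μ₁ μ₂ μ₃ ⟩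
      - κ zero - (μ₀ + μ₀) - (μ₂ + μ₂) - (μ₃ + μ₃)
        ≡⟨ cong₂ (λ y z → - y - (μ₀ + μ₀) - (μ₂ + μ₂) - (z + z)) (κ≡0 zero) μ₃≡0 ⟩
      - 0ℚ - (μ₀ + μ₀) - (μ₂ + μ₂) - (0ℚ + 0ℚ) ≡⟨ cong (λ y → - 0ℚ - (μ₀ + μ₀) - (y + y) - (0ℚ + 0ℚ)) μ₂≡0 ⟩
      - 0ℚ - (μ₀ + μ₀) - (0ℚ + 0ℚ) - (0ℚ + 0ℚ)
        ≡⟨ solve 1 (λ m → :- con 0ℚ :- (m :+ m) :- (con 0ℚ :+ con 0ℚ) :- (con 0ℚ :+ con 0ℚ) := :- (m :+ m)) refl μ₀ ⟩
      - (μ₀ + μ₀) ∎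
    -- Since `μ₁` is minus twice `μ₀`, the edges `xa` and `xb` together exert on `a` and `b` the
    -- forces of a coefficient `2μ₀` on `ab`.
    ν : Fin (suc (length L)) → ℚ
    ν zero    = μ₀ + μ₀
    ν (suc i) = r i
    on-ab : ∀ w k → w ≢ x → (μ₀ + μ₀) * rowEntry eqV p (a , b) w k ≡
      μ₀ * rowEntry eqV p (x , a) w k + μ₁ * rowEntry eqV p (x , b) w k
    on-ab w k w≢x = begin
      (μ₀ + μ₀) * rowEntry eqV p (a , b) w k ≡⟨ cong ((μ₀ + μ₀) *_) (rowEntry-formula eqV p a b w k) ⟩
      (μ₀ + μ₀) * (ιa * (p a k - p b k) + ιb * (p b k - p a k))
        ≡⟨ solve 5 (λ m i j a b → (m :+ m) :* (i :* (a :- b) :+ j :* (b :- a)) :=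
             m :* (con 0ℚ :* (((b :+ b) :- a) :- a) :+ i :* (a :- ((b :+ b) :- a)))
             :+ (:- (m :+ m)) :* (con 0ℚ :* (((b :+ b) :- a) :- b) :+ j :* (b :- ((b :+ b) :- a)))) refl
             μ₀ ιa ιb (p a k) (p b k) ⟩
      G 0ℚ ((p b k + p b k) - p a k) (- (μ₀ + μ₀))
        ≡⟨ cong₂ (G 0ℚ) (sym (px k)) (sym μ₁≡) ⟩
      G 0ℚ (p x k) μ₁ ≡⟨ cong (λ i → G i (p x k) μ₁) (sym (ι=-≢ eqV w≢x)) ⟩
      G (ι= eqV w x) (p x k) μ₁
        ≡⟨ sym (cong₂ (λ y z → μ₀ * y + μ₁ * z) (rowEntry-formula eqV p x a w k) (rowEntry-formula eqV p x b w k)) ⟩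
      μ₀ * rowEntry eqV p (x , a) w k + μ₁ * rowEntry eqV p (x , b) w k ∎
      where
      ιa = ι= eqV w a
      ιb = ι= eqV w b
      G : ℚ → ℚ → ℚ → ℚ
      G i z m = μ₀ * (i * (z - p a k) + ιa * (p a k - z)) + m * (i * (z - p b k) + ιb * (p b k - z))
    ν≡0 : ∀ wc → comb ν (rows eqV p ((a , b) ∷ L)) wc ≡ 0ℚ
    ν≡0 (w , k) with eqV w x
    ... | yes refl = comb-avoid ((All.head x≢ , All.head (All.tail x≢)) ∷ avoids) ν k
    ... | no w≢x = begin
      (μ₀ + μ₀) * rowEntry eqV p (a , b) w k + R ≡⟨ cong (_+ R) (on-ab w k w≢x) ⟩
      (X + Y) + R
        ≡⟨ solve 5 (λ x y r s t → (x :+ y) :+ r := x :+ (y :+ (con 0ℚ :* s :+ (con 0ℚ :* t :+ r)))) refl X Y R s t ⟩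
      X + (Y + (0ℚ * s + (0ℚ * t + R)))
        ≡⟨ sym (cong₂ (λ y z → X + (Y + (y * s + (z * t + R)))) μ₂≡0 μ₃≡0) ⟩
      comb μ (rows eqV p (S ++ L)) (w , k) ≡⟨ μ≡0 (w , k) ⟩
      0ℚ ∎
      where
      R = comb r (rows eqV p L) (w , k)
      X = μ₀ * rowEntry eqV p (x , a) w k
      Y = μ₁ * rowEntry eqV p (x , b) w k
      s = rowEntry eqV p (x , c) w k
      t = rowEntry eqV p (x , d) w k
    2μ₀≡0 : μ₀ + μ₀ ≡ 0ℚ
    2μ₀≡0 = indL ν ν≡0 zero
    μ₀≡0 : μ₀ ≡ 0ℚ
    μ₀≡0 = *-zero-cancel {1ℚ + 1ℚ} (λ ()) (trans (solve 1 (λ m → (con 1ℚ :+ con 1ℚ) :* m := m :+ m) refl μ₀) 2μ₀≡0)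

-- The rank bound 3|V| - 6

unique-lookup : ∀ {A : Set} {L : List A} → Unique L → ∀ {i j} → lookup L i ≡ lookup L j → i ≡ j
unique-lookup uniq {i} {j} eq = decidable-stable (i ≟F j)
  (λ i≢j → allPairs-lookup (λ x≢y → x≢y ∘ sym) uniq i j i≢j eq)

module _ {V : Set} (eqV : DecidableEquality V) (p : Placement V) {Us : List V} (uniq : Unique Us) where

  vertexSum : (V → ℚ) → ℚ
  vertexSum f = ∑ (λ a → f (lookup Us a))

  vertexSum-ι : ∀ {u} → u ∈ Us → (h : V → ℚ) → vertexSum (λ w → ι= eqV w u * h w) ≡ h u
  vertexSum-ι {u} u∈Us h = trans (∑-cong (λ a → cong (_* h (lookup Us a)) (ι-δ a)))
      (trans (∑-δ k (h ∘ lookup Us)) (cong h (sym u≡)))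
    where
    k = Any.index u∈Us
    u≡ : u ≡ lookup Us k
    u≡ = Anyₚ.lookup-index u∈Us
    ι-δ : ∀ a → ι= eqV (lookup Us a) u ≡ δ k a
    ι-δ a with k ≟F a
    ... | yes refl = trans (cong (ι= eqV (lookup Us k)) u≡) (ι=-refl eqV (lookup Us k))
    ... | no k≢a   = ι=-≢ eqV (λ eq → k≢a (unique-lookup uniq (trans (sym u≡) (sym eq))))

  vertexSum-row : ∀ {u v} → u ∈ Us → v ∈ Us → ∀ c (g : V → ℚ) →
    vertexSum (λ w → rowEntry eqV p (u , v) w c * g w) ≡ (p u c - p v c) * (g u - g v)
  vertexSum-row {u} {v} u∈ v∈ c g = begin
    vertexSum (λ w → rowEntry eqV p (u , v) w c * g w)
      ≡⟨ ∑-cong (λ a → trans (cong (_* g (lookup Us a)) (rowEntry-formula eqV p u v (lookup Us a) c))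
           (solve 5 (λ i j g a b → (i :* (a :- b) :+ j :* (b :- a)) :* g := i :* ((a :- b) :* g) :+ j :* ((b :- a) :* g))
              refl (ι= eqV (lookup Us a) u) (ι= eqV (lookup Us a) v) (g (lookup Us a)) (p u c) (p v c))) ⟩
    ∑ (λ a → ι= eqV (lookup Us a) u * ((p u c - p v c) * g (lookup Us a)) + ι= eqV (lookup Us a) v * ((p v c - p u c) * g (lookup Us a)))
      ≡⟨ ∑-+ (λ a → ι= eqV (lookup Us a) u * ((p u c - p v c) * g (lookup Us a))) (λ a → ι= eqV (lookup Us a) v * ((p v c - p u c) * g (lookup Us a))) ⟩
    vertexSum (λ w → ι= eqV w u * ((p u c - p v c) * g w)) + vertexSum (λ w → ι= eqV w v * ((p v c - p u c) * g w))
      ≡⟨ cong₂ _+_ (vertexSum-ι u∈ (λ w → (p u c - p v c) * g w)) (vertexSum-ι v∈ (λ w → (p v c - p u c) * g w)) ⟩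
    (p u c - p v c) * g u + (p v c - p u c) * g v
      ≡⟨ solve 4 (λ a b g h → (a :- b) :* g :+ (b :- a) :* h := (a :- b) :* (g :- h)) refl (p u c) (p v c) (g u) (g v) ⟩
    (p u c - p v c) * (g u - g v) ∎
    where open ≡-Reasoning

  module Equilibrium {L : List (Pair V)} (inUs : All (λ e → proj₁ e ∈ Us × proj₂ e ∈ Us) L) (μ : Fin (length L) → ℚ) where

    load : V → Fin 3 → ℚ
    load w c = comb μ (rows eqV p L) (w , c)

    Δ : Fin (length L) → (V → ℚ) → ℚ
    Δ i g = g (proj₁ (lookup L i)) - g (proj₂ (lookup L i))

    -- The load is the force a stress leaves at each vertex. After exchanging the sums every edge
    -- contributes through both ends at once. A constant `g` gives balance of forces; a coordinate
    -- as `g` gives an expression symmetric in the two coordinates, which is balance of torques.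
    load-moment : ∀ c g → vertexSum (λ w → load w c * g w) ≡ ∑ (λ i → μ i * (Δ i (λ v → p v c) * Δ i g))
    load-moment c g = begin
      ∑ (λ a → ∑ (λ i → μ i * R i a) * G a)
        ≡⟨ ∑-cong (λ a → trans (ℚₚ.*-comm (∑ (λ i → μ i * R i a)) (G a)) (sym (∑-* (G a) (λ i → μ i * R i a)))) ⟩
      ∑ (λ a → ∑ (λ i → G a * (μ i * R i a)))
        ≡⟨ ∑-swap (λ a i → G a * (μ i * R i a)) ⟩
      ∑ (λ i → ∑ (λ a → G a * (μ i * R i a)))
        ≡⟨ ∑-cong (λ i → trans (∑-cong (λ a → solve 3 (λ g m r → g :* (m :* r) := m :* (r :* g)) refl (G a) (μ i) (R i a)))
             (trans (∑-* (μ i) (λ a → R i a * G a))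
               (cong (μ i *_) (let (u∈ , v∈) = All.lookup inUs (∈-lookup i) in vertexSum-row u∈ v∈ c g)))) ⟩
      ∑ (λ i → μ i * (Δ i (λ v → p v c) * Δ i g)) ∎
      where
      open ≡-Reasoning
      R : Fin (length L) → Fin (length Us) → ℚ
      R i a = rowEntry eqV p (lookup L i) (lookup Us a) c
      G : Fin (length Us) → ℚ
      G a = g (lookup Us a)

    load-balance : ∀ c → vertexSum (λ w → load w c) ≡ 0ℚ
    load-balance c = begin
      vertexSum (λ w → load w c)        ≡⟨ ∑-cong (λ a → sym (ℚₚ.*-identityʳ (load (lookup Us a) c))) ⟩
      vertexSum (λ w → load w c * 1ℚ)   ≡⟨ load-moment c (λ _ → 1ℚ) ⟩
      ∑ (λ i → μ i * (Δ i (λ v → p v c) * 0ℚ))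
        ≡⟨ ∑-zero (λ i → solve 2 (λ m a → m :* (a :* con 0ℚ) := con 0ℚ) refl (μ i) (Δ i (λ v → p v c))) ⟩
      0ℚ ∎
      where open ≡-Reasoning

    load-torque : ∀ c c′ → vertexSum (λ w → load w c * p w c′) ≡ vertexSum (λ w → load w c′ * p w c)
    load-torque c c′ = trans (load-moment c (λ w → p w c′))
      (trans (∑-cong (λ i → cong (μ i *_) (ℚₚ.*-comm (Δ i (λ v → p v c)) (Δ i (λ v → p v c′)))))
        (sym (load-moment c′ (λ w → p w c))))

only : Fin 1 → Fin 3
only _ = zero

allColumns : ∀ {V : Set} → List V → List (V × Fin 3)
allColumns []       = []
allColumns (v ∷ vs) = (v , zero) ∷ (v , suc zero) ∷ (v , suc (suc zero)) ∷ allColumns vs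

length-allColumns : ∀ {V : Set} (vs : List V) → length (allColumns vs) ≡ length vs ℕ.* 3
length-allColumns []       = refl
length-allColumns (v ∷ vs) = cong (3 ℕ.+_) (length-allColumns vs)

allColumns-All : ∀ {V : Set} {P : V × Fin 3 → Set} vs → All P (allColumns vs) → All (λ v → ∀ c → P (v , c)) vs
allColumns-All []       []                = []
allColumns-All (v ∷ vs) (x ∷ y ∷ z ∷ rest) =
  (λ { zero → x ; (suc zero) → y ; (suc (suc zero)) → z }) ∷ allColumns-All vs rest

-- If the load vanishes in all but six pinned columns, balance of forces and torques makes it vanish
-- in those as well. Deleting these columns therefore preserves independence, and 3|V| - 6 remain.
-- The two spread conditions say that the pinned vertices leave no rigid motion.
module RankBound {V : Set} (eqV : DecidableEquality V) (p : Placement V)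
  {u₀ u₁ u₂ : V} {rest : List V} (uniq : Unique (u₀ ∷ u₁ ∷ u₂ ∷ rest))
  (spread₁ : Indep (λ i c → differences p ((u₁ , u₀) ∷ []) i (only c)))
  (spread₂ : Indep (λ i c → differences p ((u₁ , u₀) ∷ (u₂ , u₀) ∷ []) i (inject₁ c)))
  {L : List (Pair V)} (inUs : All (λ e → proj₁ e ∈ u₀ ∷ u₁ ∷ u₂ ∷ rest × proj₂ e ∈ u₀ ∷ u₁ ∷ u₂ ∷ rest) L) where

  -- The six pinned columns are those of u₀, two of u₁ and one of u₂.
  freeColumns : List (V × Fin 3)
  freeColumns = (u₁ , zero) ∷ (u₂ , zero) ∷ (u₂ , suc zero) ∷ allColumns rest

  module _ (μ : Fin (length L) → ℚ)
           (free≡0 : ∀ j → comb μ (rows eqV p L) (lookup freeColumns j) ≡ 0ℚ) where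
    open Equilibrium eqV p uniq inUs μ
    open ≡-Reasoning

    private
      x y z : Fin 3
      x = zero
      y = suc zero
      z = suc (suc zero)
      P R : Fin 3 → ℚ
      P c = p u₁ c - p u₀ c
      R c = p u₂ c - p u₀ c

    free-All : All (λ col → comb μ (rows eqV p L) col ≡ 0ℚ) freeColumns
    free-All = All.tabulate (λ col∈ → trans (cong (comb μ (rows eqV p L)) (Anyₚ.lookup-index col∈)) (free≡0 (Any.index col∈)))

    rest≡0 : All (λ v → ∀ c → load v c ≡ 0ℚ) rest
    rest≡0 with free-All
    ... | _ ∷ _ ∷ _ ∷ all = allColumns-All rest all

    f₁x : load u₁ x ≡ 0ℚ
    f₁x = free≡0 zero
    f₂x : load u₂ x ≡ 0ℚ
    f₂x = free≡0 (suc zero)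
    f₂y : load u₂ y ≡ 0ℚ
    f₂y = free≡0 (suc (suc zero))

    restSum≡0 : ∀ c (g : V → ℚ) → ∑ (λ a → load (lookup rest a) c * g (lookup rest a)) ≡ 0ℚ
    restSum≡0 c g = ∑-zero (λ a → trans (cong (_* g (lookup rest a)) (All.lookup rest≡0 (∈-lookup a) c)) (ℚₚ.*-zeroˡ (g (lookup rest a))))

    f₀ : ∀ c → load u₀ c ≡ - (load u₁ c + load u₂ c)
    f₀ c = begin
      F₀ ≡⟨ solve 4 (λ a b c d → a := (a :+ (b :+ (c :+ d))) :- (b :+ c) :- d) refl F₀ F₁ F₂ Z ⟩
      (F₀ + (F₁ + (F₂ + Z))) - (F₁ + F₂) - Z
        ≡⟨ cong₂ (λ s t → s - (F₁ + F₂) - t) (load-balance c) (∑-zero (λ a → All.lookup rest≡0 (∈-lookup a) c)) ⟩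
      0ℚ - (F₁ + F₂) - 0ℚ ≡⟨ solve 2 (λ a b → con 0ℚ :- (a :+ b) :- con 0ℚ := :- (a :+ b)) refl F₁ F₂ ⟩
      - (F₁ + F₂) ∎
      where F₀ = load u₀ c
            F₁ = load u₁ c
            F₂ = load u₂ c
            Z = ∑ (λ a → load (lookup rest a) c)

    moment : ∀ c c′ → vertexSum eqV p uniq (λ w → load w c * p w c′) ≡ load u₁ c * P c′ + load u₂ c * R c′
    moment c c′ = begin
      load u₀ c * q₀ + (F₁ * q₁ + (F₂ * q₂ + Z)) ≡⟨ cong₂ (λ s t → s * q₀ + (F₁ * q₁ + (F₂ * q₂ + t))) (f₀ c) (restSum≡0 c (λ w → p w c′)) ⟩
      (- (F₁ + F₂)) * q₀ + (F₁ * q₁ + (F₂ * q₂ + 0ℚ))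
        ≡⟨ solve 5 (λ a b q r s → (:- (a :+ b)) :* q :+ (a :* r :+ (b :* s :+ con 0ℚ)) := a :* (r :- q) :+ b :* (s :- q))
             refl F₁ F₂ q₀ q₁ q₂ ⟩
      F₁ * P c′ + F₂ * R c′ ∎
      where F₁ = load u₁ c
            F₂ = load u₂ c
            q₀ = p u₀ c′
            q₁ = p u₁ c′
            q₂ = p u₂ c′
            Z = ∑ (λ a → load (lookup rest a) c * p (lookup rest a) c′)

    torque : ∀ c c′ → load u₁ c * P c′ + load u₂ c * R c′ ≡ load u₁ c′ * P c + load u₂ c′ * R c
    torque c c′ = trans (sym (moment c c′)) (trans (load-torque c c′) (moment c′ c))

    -- Of the torque in the xy-plane only the product of this load with `P x` is left, and `spread₁`
    -- says that `P x` is nonzero.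
    f₁y : load u₁ y ≡ 0ℚ
    f₁y = spread₁ (λ _ → load u₁ y) (λ _ → begin
      load u₁ y * P x + 0ℚ ≡⟨ cong (load u₁ y * P x +_) (sym (ℚₚ.*-zeroˡ (R x))) ⟩
      load u₁ y * P x + 0ℚ * R x ≡⟨ cong (λ s → load u₁ y * P x + s * R x) (sym f₂y) ⟩
      load u₁ y * P x + load u₂ y * R x ≡⟨ torque y x ⟩
      load u₁ x * P y + load u₂ x * R y ≡⟨ cong₂ (λ s t → s * P y + t * R y) f₁x f₂x ⟩
      0ℚ * P y + 0ℚ * R y ≡⟨ solve 2 (λ a b → con 0ℚ :* a :+ con 0ℚ :* b := con 0ℚ) refl (P y) (R y) ⟩
      0ℚ ∎) zero

    zLoads : Fin 2 → ℚ
    zLoads zero       = load u₁ z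
    zLoads (suc zero) = load u₂ z

    zTorque : ∀ c → load u₁ c ≡ 0ℚ → load u₂ c ≡ 0ℚ → load u₁ z * P c + (load u₂ z * R c + 0ℚ) ≡ 0ℚ
    zTorque c f₁≡0 f₂≡0 = begin
      load u₁ z * P c + (load u₂ z * R c + 0ℚ) ≡⟨ cong (load u₁ z * P c +_) (ℚₚ.+-identityʳ (load u₂ z * R c)) ⟩
      load u₁ z * P c + load u₂ z * R c ≡⟨ torque z c ⟩
      load u₁ c * P z + load u₂ c * R z ≡⟨ cong₂ (λ s t → s * P z + t * R z) f₁≡0 f₂≡0 ⟩
      0ℚ * P z + 0ℚ * R z ≡⟨ solve 2 (λ a b → con 0ℚ :* a :+ con 0ℚ :* b := con 0ℚ) refl (P z) (R z) ⟩
      0ℚ ∎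

    -- The torques in the zx- and zy-planes are two linear equations in the two loads; `spread₂` is
    -- the nonsingularity of this system.
    zLoads≡0 : ∀ i → zLoads i ≡ 0ℚ
    zLoads≡0 = spread₂ zLoads λ { zero → zTorque x f₁x f₂x ; (suc zero) → zTorque y f₁y f₂y }

    f₁ : ∀ c → load u₁ c ≡ 0ℚ
    f₁ zero             = f₁x
    f₁ (suc zero)       = f₁y
    f₁ (suc (suc zero)) = zLoads≡0 zero

    f₂ : ∀ c → load u₂ c ≡ 0ℚ
    f₂ zero             = f₂x
    f₂ (suc zero)       = f₂y
    f₂ (suc (suc zero)) = zLoads≡0 (suc zero)

    loads≡0 : All (λ v → ∀ c → load v c ≡ 0ℚ) (u₀ ∷ u₁ ∷ u₂ ∷ rest)
    loads≡0 = (λ c → trans (f₀ c) (cong -_ (trans (cong₂ _+_ (f₁ c) (f₂ c)) (ℚₚ.+-identityˡ 0ℚ)))) ∷ f₁ ∷ f₂ ∷ rest≡0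

    comb≡0 : ∀ wc → comb μ (rows eqV p L) wc ≡ 0ℚ
    comb≡0 (w , c) with Any.any? (eqV w) (u₀ ∷ u₁ ∷ u₂ ∷ rest)
    ... | yes w∈ = All.lookup loads≡0 w∈ c
    ... | no w∉ = Extensions.comb-avoid eqV p (All.map (λ (u∈ , v∈) → (λ { refl → w∉ u∈ }) , (λ { refl → w∉ v∈ })) inUs) μ c

  rank-bound : RowsIndep eqV p L → length L ℕ.+ 6 ≤ length (u₀ ∷ u₁ ∷ u₂ ∷ rest) ℕ.* 3
  rank-bound ind = ℕₚ.≤-trans (ℕₚ.+-monoˡ-≤ 6 (ℕₚ.≤-trans (indep-dim freeRows restricted)
      (ℕₚ.≤-reflexive (cong (3 ℕ.+_) (length-allColumns rest)))))
      (ℕₚ.≤-reflexive (ℕₚ.+-comm (3 ℕ.+ length rest ℕ.* 3) 6))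
    where
    freeRows : Fin (length L) → Fin (length freeColumns) → ℚ
    freeRows i j = rows eqV p L i (lookup freeColumns j)
    restricted : Indep freeRows
    restricted μ free≡0 = ind μ (comb≡0 μ free≡0)

EndsIn : ∀ {V : Set} → List V → Pair V → Set
EndsIn Us e = proj₁ e ∈ Us × proj₂ e ∈ Us

-- Bases of complete graphs

module Simplex {V : Set} (eqV : DecidableEquality V) {u₀ u₁ u₂ : V}
  (u₁≢u₀ : u₁ ≢ u₀) (u₂≢u₀ : u₂ ≢ u₀) (u₂≢u₁ : u₂ ≢ u₁) where

  -- All further vertices may share the third unit vector, because they are joined to the first
  -- three vertices and never to one another.
  corner : Placement V
  corner w with eqV w u₀ | eqV w u₁ | eqV w u₂
  ... | yes _ | _     | _     = λ _ → 0ℚ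
  ... | no _  | yes _ | _     = δ zero
  ... | no _  | no _  | yes _ = δ (suc zero)
  ... | no _  | no _  | no _  = δ (suc (suc zero))

  corner-u₀ : ∀ c → corner u₀ c ≡ 0ℚ
  corner-u₀ c with eqV u₀ u₀
  ... | yes _ = refl
  ... | no ≢  = ⊥-elim (≢ refl)

  corner-u₁ : ∀ c → corner u₁ c ≡ δ zero c
  corner-u₁ c with eqV u₁ u₀ | eqV u₁ u₁
  ... | yes ≡u₀ | _     = ⊥-elim (u₁≢u₀ ≡u₀)
  ... | no _    | yes _ = refl
  ... | no _    | no ≢  = ⊥-elim (≢ refl)

  corner-u₂ : ∀ c → corner u₂ c ≡ δ (suc zero) c
  corner-u₂ c with eqV u₂ u₀ | eqV u₂ u₁ | eqV u₂ u₂
  ... | yes ≡u₀ | _       | _     = ⊥-elim (u₂≢u₀ ≡u₀)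
  ... | no _    | yes ≡u₁ | _     = ⊥-elim (u₂≢u₁ ≡u₁)
  ... | no _    | no _    | yes _ = refl
  ... | no _    | no _    | no ≢  = ⊥-elim (≢ refl)

  corner-other : ∀ {x} → x ≢ u₀ → x ≢ u₁ → x ≢ u₂ → ∀ c → corner x c ≡ δ (suc (suc zero)) c
  corner-other {x} x≢u₀ x≢u₁ x≢u₂ c with eqV x u₀ | eqV x u₁ | eqV x u₂
  ... | yes ≡u₀ | _       | _       = ⊥-elim (x≢u₀ ≡u₀)
  ... | no _    | yes ≡u₁ | _       = ⊥-elim (x≢u₁ ≡u₁)
  ... | no _    | no _    | yes ≡u₂ = ⊥-elim (x≢u₂ ≡u₂)
  ... | no _    | no _    | no _    = refl

  spread₁ : Indep (λ i c → differences corner ((u₁ , u₀) ∷ []) i (only c))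
  spread₁ μ μ≡0 zero = trans (trans (solve 1 (λ m → m := m :* (con 1ℚ :- con 0ℚ) :+ con 0ℚ) refl (μ zero))
    (sym (cong₂ (λ a b → μ zero * (a - b) + 0ℚ) (corner-u₁ zero) (corner-u₀ zero)))) (μ≡0 zero)

  spread₂ : Indep (λ i c → differences corner ((u₁ , u₀) ∷ (u₂ , u₀) ∷ []) i (inject₁ c))
  spread₂ = indep-cong {A = N} {λ i c → differences corner ((u₁ , u₀) ∷ (u₂ , u₀) ∷ []) i (inject₁ c)} (λ { zero c → cong₂ _-_ (corner-u₁ (inject₁ c)) (corner-u₀ (inject₁ c))
                                  ; (suc zero) c → cong₂ _-_ (corner-u₂ (inject₁ c)) (corner-u₀ (inject₁ c)) })
    λ μ μN → λ { zero → trans (solve 2 (λ a b → a := a :* (con 1ℚ :- con 0ℚ) :+ (b :* (con 0ℚ :- con 0ℚ) :+ con 0ℚ)) refl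
                            (μ zero) (μ (suc zero))) (μN zero)
               ; (suc zero) → trans (solve 2 (λ a b → b := a :* (con 0ℚ :- con 0ℚ) :+ (b :* (con 1ℚ :- con 0ℚ) :+ con 0ℚ)) refl
                            (μ zero) (μ (suc zero))) (μN (suc zero)) }
    where
    N : Fin 2 → Fin 2 → ℚ
    N zero       c = δ (zero {2}) (inject₁ c) - 0ℚ
    N (suc zero) c = δ (suc (zero {1})) (inject₁ c) - 0ℚ

  star-u₁ : Indep (differences corner (star u₁ (u₀ ∷ [])))
  star-u₁ = indep-columns {A = differences corner (star u₁ (u₀ ∷ []))} only spread₁

  star-u₂ : Indep (differences corner (star u₂ (u₀ ∷ u₁ ∷ [])))
  star-u₂ = indep-cong {A = N} {differences corner (star u₂ (u₀ ∷ u₁ ∷ []))} (λ { zero c → cong₂ _-_ (corner-u₂ c) (corner-u₀ c)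
                                  ; (suc zero) c → cong₂ _-_ (corner-u₂ c) (corner-u₁ c) })
    λ μ μN → let μ₁≡0 = trans (solve 2 (λ a b → b := :- (a :* (con 0ℚ :- con 0ℚ) :+ (b :* (con 0ℚ :- con 1ℚ) :+ con 0ℚ))) refl
                          (μ zero) (μ (suc zero))) (cong -_ (μN zero))
             in λ { zero → trans (solve 2 (λ a b → a := (a :* (con 1ℚ :- con 0ℚ) :+ (b :* (con 1ℚ :- con 0ℚ) :+ con 0ℚ)) :- b) refl
                             (μ zero) (μ (suc zero))) (cong₂ _-_ (μN (suc zero)) μ₁≡0)
                  ; (suc zero) → μ₁≡0 }
    where
    N : Fin 2 → Fin 3 → ℚ
    N zero       c = δ (suc zero) c - 0ℚ
    N (suc zero) c = δ (suc zero) c - δ zero c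

  star-other : ∀ {x} → x ≢ u₀ → x ≢ u₁ → x ≢ u₂ → Indep (differences corner (star x (u₀ ∷ u₁ ∷ u₂ ∷ [])))
  star-other {x} x≢u₀ x≢u₁ x≢u₂ = indep-cong {A = N} {differences corner (star x (u₀ ∷ u₁ ∷ u₂ ∷ []))}
      (λ { zero c → cong₂ _-_ (corner-x c) (corner-u₀ c)
         ; (suc zero) c → cong₂ _-_ (corner-x c) (corner-u₁ c)
         ; (suc (suc zero)) c → cong₂ _-_ (corner-x c) (corner-u₂ c) })
    λ μ μN → let a = μ zero
                 b = μ (suc zero)
                 c = μ (suc (suc zero))
                 b≡0 = trans (solve 3 (λ a b c → b := :- (a :* (con 0ℚ :- con 0ℚ) :+ (b :* (con 0ℚ :- con 1ℚ) :+ (c :* (con 0ℚ :- con 0ℚ) :+ con 0ℚ))))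
                         refl a b c) (cong -_ (μN zero))
                 c≡0 = trans (solve 3 (λ a b c → c := :- (a :* (con 0ℚ :- con 0ℚ) :+ (b :* (con 0ℚ :- con 0ℚ) :+ (c :* (con 0ℚ :- con 1ℚ) :+ con 0ℚ))))
                         refl a b c) (cong -_ (μN (suc zero)))
             in λ { zero → trans (solve 3 (λ a b c → a := (a :* (con 1ℚ :- con 0ℚ) :+ (b :* (con 1ℚ :- con 0ℚ) :+ (c :* (con 1ℚ :- con 0ℚ) :+ con 0ℚ))) :- b :- c)
                             refl a b c) (trans (cong (λ s → s - b - c) (μN (suc (suc zero)))) (cong₂ (λ s t → 0ℚ - s - t) b≡0 c≡0))
                  ; (suc zero) → b≡0
                  ; (suc (suc zero)) → c≡0 }
    where
    corner-x = corner-other x≢u₀ x≢u₁ x≢u₂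
    N : Fin 3 → Fin 3 → ℚ
    N zero             c = δ (suc (suc zero)) c - 0ℚ
    N (suc zero)       c = δ (suc (suc zero)) c - δ zero c
    N (suc (suc zero)) c = δ (suc (suc zero)) c - δ (suc zero) c

  -- A triangle extended by vertices of degree three: a basis of the complete graph, of size 3 + 3(v
  -- - 3) = 3v - 6.
  simplexEdges : List V → List (Pair V)
  simplexEdges []       = star u₂ (u₀ ∷ u₁ ∷ []) ++ star u₁ (u₀ ∷ [])
  simplexEdges (x ∷ xs) = star x (u₀ ∷ u₁ ∷ u₂ ∷ []) ++ simplexEdges xs

  length-simplexEdges : ∀ xs → length (simplexEdges xs) ≡ 3 ℕ.+ length xs ℕ.* 3
  length-simplexEdges []       = refl
  length-simplexEdges (x ∷ xs) = cong (3 ℕ.+_) (length-simplexEdges xs)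

  simplexEdges-endpoints : ∀ xs → All (EndsIn (u₀ ∷ u₁ ∷ u₂ ∷ xs)) (simplexEdges xs)
  simplexEdges-endpoints [] = (there (there (here refl)) , here refl) ∷ (there (there (here refl)) , there (here refl)) ∷
    (there (here refl) , here refl) ∷ []
  simplexEdges-endpoints (x ∷ xs) = (x∈ , here refl) ∷ (x∈ , there (here refl)) ∷ (x∈ , there (there (here refl))) ∷
      All.map (λ (u∈ , v∈) → insert u∈ , insert v∈) (simplexEdges-endpoints xs)
    where
    x∈ : x ∈ u₀ ∷ u₁ ∷ u₂ ∷ x ∷ xs
    x∈ = there (there (there (here refl)))
    insert : ∀ {v} → v ∈ u₀ ∷ u₁ ∷ u₂ ∷ xs → v ∈ u₀ ∷ u₁ ∷ u₂ ∷ x ∷ xs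
    insert (here eq)                  = here eq
    insert (there (here eq))          = there (here eq)
    insert (there (there (here eq)))  = there (there (here eq))
    insert (there (there (there v∈))) = there (there (there (there v∈)))

  simplexEdges-indep : ∀ xs → All (λ x → x ≢ u₀ × x ≢ u₁ × x ≢ u₂) xs → Unique xs → RowsIndep eqV corner (simplexEdges xs)
  simplexEdges-indep [] [] [] = zero-extension (u₀ ∷ u₁ ∷ []) (u₂≢u₀ ∷ u₂≢u₁ ∷ []) ((u₂≢u₁ , u₂≢u₀) ∷ []) star-u₂
      (zero-extension (u₀ ∷ []) (u₁≢u₀ ∷ []) [] star-u₁ (λ _ _ ()))
    where open Extensions eqV corner
  simplexEdges-indep (x ∷ xs) ((x≢u₀ , x≢u₁ , x≢u₂) ∷ others) (x∉xs ∷ uniq) =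
      zero-extension (u₀ ∷ u₁ ∷ u₂ ∷ []) (x≢u₀ ∷ x≢u₁ ∷ x≢u₂ ∷ [])
        (All.map (λ (u∈ , v∈) → All.lookup x∉ u∈ , All.lookup x∉ v∈) (simplexEdges-endpoints xs))
        (star-other x≢u₀ x≢u₁ x≢u₂) (simplexEdges-indep xs others uniq)
    where
    open Extensions eqV corner
    x∉ : All (x ≢_) (u₀ ∷ u₁ ∷ u₂ ∷ xs)
    x∉ = x≢u₀ ∷ x≢u₁ ∷ x≢u₂ ∷ x∉xs

module Rank {V : Set} (finite : Finite V) (eqV : DecidableEquality V) where
  open GenericPlacement finite eqV

  basis : ∀ Us → Unique Us → 3 ≤ length Us → ∃ λ L →
    SimpleList L × All (EndsIn Us) L × IndepR3 eqV L × length L ℕ.+ 6 ≡ length Us ℕ.* 3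
  basis (u₀ ∷ u₁ ∷ u₂ ∷ xs) ((u₀≢u₁ ∷ u₀≢u₂ ∷ u₀∉) ∷ (u₁≢u₂ ∷ u₁∉) ∷ u₂∉ ∷ uniq) _ =
      simplexEdges xs , indep⇒simple eqV corner ind , simplexEdges-endpoints xs ,
      (corner , fromRowsIndep eqV corner (simplexEdges xs) ind) ,
      trans (cong (ℕ._+ 6) (length-simplexEdges xs)) (ℕₚ.+-comm (3 ℕ.+ length xs ℕ.* 3) 6)
    where
    open Simplex eqV (u₀≢u₁ ∘ sym) (u₀≢u₂ ∘ sym) (u₁≢u₂ ∘ sym)
    ind = simplexEdges-indep xs (All.tabulate (λ x∈ → All.lookup u₀∉ x∈ ∘ sym , All.lookup u₁∉ x∈ ∘ sym , All.lookup u₂∉ x∈ ∘ sym)) uniq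
  basis []             _ ()
  basis (_ ∷ [])       _ (s≤s ())
  basis (_ ∷ _ ∷ [])   _ (s≤s (s≤s ()))

  -- `IndepR3` provides some placement, possibly one where the pinned vertices are degenerate.
  -- Genericity moves it to one that is spread as well.
  rank-≤ : ∀ {Us L} → Unique Us → 3 ≤ length Us → All (EndsIn Us) L → IndepR3 eqV L → length L ℕ.+ 6 ≤ length Us ℕ.* 3
  rank-≤ {u₀ ∷ u₁ ∷ u₂ ∷ xs} {L} uniq@((u₀≢u₁ ∷ u₀≢u₂ ∷ _) ∷ (u₁≢u₂ ∷ _) ∷ _) _ inUs indL =
      let (p , sp₁ , sp₂ , ind) = generic-∃ (generic-× (generic-differences only ((u₁ , u₀) ∷ []) corner spread₁)
            (generic-× (generic-differences inject₁ ((u₁ , u₀) ∷ (u₂ , u₀) ∷ []) corner spread₂) (generic-indep {L} indL)))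
      in RankBound.rank-bound eqV p uniq sp₁ sp₂ inUs ind
    where
    open Simplex eqV (u₀≢u₁ ∘ sym) (u₀≢u₂ ∘ sym) (u₁≢u₂ ∘ sym)
  rank-≤ {[]}           _ () _ _
  rank-≤ {_ ∷ []}       _ (s≤s ()) _ _
  rank-≤ {_ ∷ _ ∷ []}   _ (s≤s (s≤s ())) _ _

  -- Four distinct vertices are affinely independent at the corners of a simplex, hence generically.
  generic-star : ∀ {x a b c} → Unique (a ∷ b ∷ c ∷ x ∷ []) →
    Generic (λ p → Indep (differences p (star x (a ∷ b ∷ c ∷ []))))
  generic-star {x} {a} {b} {c} ((a≢b ∷ a≢c ∷ a≢x ∷ []) ∷ (b≢c ∷ b≢x ∷ []) ∷ (c≢x ∷ []) ∷ _) =
      generic-differences id (star x (a ∷ b ∷ c ∷ [])) corner (star-other (a≢x ∘ sym) (b≢x ∘ sym) (c≢x ∘ sym))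
    where
    open Simplex eqV (a≢b ∘ sym) (a≢c ∘ sym) (b≢c ∘ sym)

-- The ring and its extension

finite-Fin : ∀ k → Finite (Fin k)
finite-Fin k = record { size = k ; point = id ; index = id ; point-index = λ _ → refl }

finite-retract : ∀ {A B : Set} (f : A → B) (g : B → A) → (∀ b → f (g b) ≡ b) → Finite A → Finite B
finite-retract f g fg≡ fin = record
  { size = size ; point = f ∘ point ; index = index ∘ g
  ; point-index = λ b → trans (cong f (point-index (g b))) (fg≡ b) }
  where open Finite fin

finite-⊎ : ∀ {A B : Set} → Finite A → Finite B → Finite (A ⊎ B)
finite-⊎ {A} {B} finA finB = finite-retract to from to∘from (finite-Fin (A.size ℕ.+ B.size))
  where
  module A = Finite finA
  module B = Finite finB
  to : Fin (A.size ℕ.+ B.size) → A ⊎ B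
  to k = [ inj₁ ∘ A.point , inj₂ ∘ B.point ]′ (splitAt A.size k)
  from : A ⊎ B → Fin (A.size ℕ.+ B.size)
  from x = join A.size B.size ([ inj₁ ∘ A.index , inj₂ ∘ B.index ]′ x)
  to∘from : ∀ x → to (from x) ≡ x
  to∘from (inj₁ a) = trans (cong [ inj₁ ∘ A.point , inj₂ ∘ B.point ]′ (Finₚ.splitAt-join A.size B.size (inj₁ (A.index a))))
                       (cong inj₁ (A.point-index a))
  to∘from (inj₂ b) = trans (cong [ inj₁ ∘ A.point , inj₂ ∘ B.point ]′ (Finₚ.splitAt-join A.size B.size (inj₂ (B.index b))))
                       (cong inj₂ (B.point-index b))

finite-Σ : ∀ {k} {B : Fin k → Set} → (∀ i → Finite (B i)) → Finite (Σ (Fin k) B)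
finite-Σ {zero}  fin = record { size = 0 ; point = λ () ; index = λ () ; point-index = λ () }
finite-Σ {suc k} {B} fin = finite-retract to from to∘from (finite-⊎ (fin zero) (finite-Σ (fin ∘ suc)))
  where
  to : B zero ⊎ Σ (Fin k) (B ∘ suc) → Σ (Fin (suc k)) B
  to (inj₁ b)       = zero , b
  to (inj₂ (i , b)) = suc i , b
  from : Σ (Fin (suc k)) B → B zero ⊎ Σ (Fin k) (B ∘ suc)
  from (zero , b)  = inj₁ b
  from (suc i , b) = inj₂ (i , b)
  to∘from : ∀ x → to (from x) ≡ x
  to∘from (zero , b)  = refl
  to∘from (suc i , b) = refl

finite-LV : ∀ k → Finite (LV k)
finite-LV k = finite-⊎ (finite-Fin 4) (finite-Fin k)

finite-RV : ∀ m n → Finite (RV m n)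
finite-RV m n = finite-⊎ (finite-Σ (λ _ → finite-Fin 2)) (finite-Σ (λ i → finite-Fin (n i)))

finite-RV' : ∀ m n → Finite (RV' m n)
finite-RV' m n = finite-⊎ (finite-RV m n) (finite-Fin m)

-- Used for `deletedHinge s`: as many hinges are deleted as there are links, so none is left. A
-- missed value could be punched out, giving an injection into a smaller set.
injective⇒surjective : ∀ {k} (f : Fin k → Fin k) → (∀ i j → f i ≡ f j → i ≡ j) → ∀ j → ∃ λ i → f i ≡ j
injective⇒surjective {suc k} f f-inj j with Finₚ.any? (λ i → f i ≟F j)
... | yes hit = hit
... | no miss = ⊥-elim (ℕₚ.1+n≰n (Finₚ.injective⇒≤ {f = λ i → punchOut {i = j} (λ j≡fi → miss (i , sym j≡fi))}
        (λ {a} {b} eq → f-inj a b (Finₚ.punchOut-injective (λ j≡fi → miss (a , sym j≡fi)) (λ j≡fi → miss (b , sym j≡fi)) eq))))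

sucMod-≢ : ∀ {m} → 2 ≤ m → (i : Fin m) → sucMod i ≢ i
sucMod-≢ (s≤s (s≤s _)) i with view i
... | ‵fromℕ {n}  = λ eq → Finₚ.0≢1+n (trans (sym (sucMod-fromℕ (suc _))) eq)
... | ‵inj₁ {i = i} _ = λ eq → ℕₚ.1+n≢n (trans (cong toℕ (trans (sym (sucMod-inject₁ i)) eq)) (Finₚ.toℕ-inject₁ i))

inj₁-injective : ∀ {A B : Set} {x y : A} → _≡_ {A = A ⊎ B} (inj₁ x) (inj₁ y) → x ≡ y
inj₁-injective refl = refl

SameEdge-map⁺ : ∀ {V W : Set} (j : V → W) {e f} → SameEdge e f → SameEdge (mapPair j e) (mapPair j f)
SameEdge-map⁺ j (inj₁ (refl , refl)) = inj₁ (refl , refl)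
SameEdge-map⁺ j (inj₂ (refl , refl)) = inj₂ (refl , refl)

module Rings (m : ℕ) (2≤m : 2 ≤ m) (n : Fin m → ℕ) where

  eqV : DecidableEquality (RV m n)
  eqV = eqRV m n

  eqV' : DecidableEquality (RV' m n)
  eqV' = eq (ring' m n (λ _ _ _ → ⊥) (λ _ → true))

  emb : (i : Fin m) → LV (n i) → RV m n
  emb i = ι i

  -- A left inverse of `emb i`, from which injectivity of `ι i` follows; the values off the link are
  -- arbitrary.
  toLink : (i : Fin m) → RV m n → LV (n i)
  toLink i (inj₁ (j , ε)) with j ≟F i | ε
  ... | yes _ | zero     = hA
  ... | yes _ | suc zero = hB
  ... | no _  | zero     = hC
  ... | no _  | suc zero = hD
  toLink i (inj₂ (j , x)) with j ≟F i
  ... | yes refl = inj₂ x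
  ... | no _     = hA

  toLink-ι : ∀ i x → toLink i (emb i x) ≡ x
  toLink-ι i (inj₁ zero) with i ≟F i
  ... | yes _ = refl
  ... | no ≢  = ⊥-elim (≢ refl)
  toLink-ι i (inj₁ (suc zero)) with i ≟F i
  ... | yes _ = refl
  ... | no ≢  = ⊥-elim (≢ refl)
  toLink-ι i (inj₁ (suc (suc zero))) with sucMod i ≟F i
  ... | yes ≡ = ⊥-elim (sucMod-≢ 2≤m i ≡)
  ... | no _  = refl
  toLink-ι i (inj₁ (suc (suc (suc zero)))) with sucMod i ≟F i
  ... | yes ≡ = ⊥-elim (sucMod-≢ 2≤m i ≡)
  ... | no _  = refl
  toLink-ι i (inj₂ x) with i ≟F i
  ... | yes refl = refl
  ... | no ≢     = ⊥-elim (≢ refl)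

  ι-injective : ∀ i {x y} → emb i x ≡ emb i y → x ≡ y
  ι-injective i eq = trans (sym (toLink-ι i _)) (trans (cong (toLink i) eq) (toLink-ι i _))

  module Extended (G : (i : Fin m) → LV (n i) → LV (n i) → Set)
    (hinges : (i : Fin m) → G i hA hB × G i hC hD) (s : Fin m → Bool)
    (s-inj : (i j : Fin m) → deletedHinge s i ≡ deletedHinge s j → i ≡ j)
    (indepR : Independent (ring m n G)) where

    otherHinge : Fin m → Fin m
    otherHinge i = if s i then i else sucMod i

    other≢deleted : ∀ i → otherHinge i ≢ deletedHinge s i
    other≢deleted i with s i
    ... | true  = sucMod-≢ 2≤m i ∘ sym
    ... | false = sucMod-≢ 2≤m i

    del : Fin m → Pair (RV m n)
    del i = hingePair (deletedHinge s i)

    deleted-adj : ∀ i → AdjP (ring m n G) (del i)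
    deleted-adj i with s i
    ... | true  = i , hC , hD , proj₂ (hinges i) , refl , refl
    ... | false = i , hA , hB , proj₁ (hinges i) , refl , refl

    -- The base vertices reordered so that the deleted hinge comes first, whichever hinge `s`
    -- selects; the extension lemma deletes the edge between the first two.
    base : Fin m → List (RV m n)
    base i = inj₁ (deletedHinge s i , zero) ∷ inj₁ (deletedHinge s i , suc zero) ∷
             inj₁ (otherHinge i , zero) ∷ inj₁ (otherHinge i , suc zero) ∷ []

    baseVerts⊆base : ∀ i {u} → u ∈ baseVerts i → u ∈ base i
    baseVerts⊆base i u∈ with s i
    baseVerts⊆base i (here eq)                         | true  = there (there (here eq))
    baseVerts⊆base i (there (here eq))                 | true  = there (there (there (here eq)))
    baseVerts⊆base i (there (there (here eq)))         | true  = here eq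
    baseVerts⊆base i (there (there (there (here eq)))) | true  = there (here eq)
    ... | false = u∈

    base⊆baseVerts : ∀ i {u} → u ∈ base i → u ∈ baseVerts i
    base⊆baseVerts i u∈ with s i
    base⊆baseVerts i (here eq)                         | true  = there (there (here eq))
    base⊆baseVerts i (there (here eq))                 | true  = there (there (there (here eq)))
    base⊆baseVerts i (there (there (here eq)))         | true  = here eq
    base⊆baseVerts i (there (there (there (here eq)))) | true  = there (here eq)
    ... | false = u∈

    newStar : Fin m → List (Pair (RV' m n))
    newStar i = star (inj₂ i) (map inj₁ (base i))

    lift : List (Pair (RV m n)) → List (Pair (RV' m n))
    lift = map (mapPair inj₁)

    addStars : List (Fin m) → List (Pair (RV' m n)) → List (Pair (RV' m n))
    addStars []       M = M
    addStars (i ∷ is) M = addStars is (newStar i ++ M)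

    length-addStars : ∀ is M → length (addStars is M) ≡ length is ℕ.* 4 ℕ.+ length M
    length-addStars []       M = refl
    length-addStars (i ∷ is) M = trans (length-addStars is (newStar i ++ M))
      (trans (sym (ℕₚ.+-assoc (length is ℕ.* 4) 4 (length M))) (cong (ℕ._+ length M) (ℕₚ.+-comm (length is ℕ.* 4) 4)))

    addStars-old : ∀ is {M e} → e ∈ M → e ∈ addStars is M
    addStars-old []       e∈ = e∈
    addStars-old (i ∷ is) e∈ = addStars-old is (∈-++⁺ʳ (newStar i) e∈)

    addStars-new : ∀ {is M i e} → i ∈ is → e ∈ newStar i → e ∈ addStars is M
    addStars-new {i ∷ is} (here refl) e∈ = addStars-old is (∈-++⁺ˡ e∈)
    addStars-new {i ∷ is} (there i∈)  e∈ = addStars-new {is} i∈ e∈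

    addStars-All : ∀ {P : Pair (RV' m n) → Set} is {M} → (∀ {i e} → i ∈ is → e ∈ newStar i → P e) → All P M → All P (addStars is M)
    addStars-All []       new old = old
    addStars-All (i ∷ is) new old = addStars-All is (new ∘ there) (Allₚ.++⁺ (All.tabulate (new (here refl))) old)

    avoids-lift : ∀ i L → All (Avoids (inj₂ i)) (lift L)
    avoids-lift i []      = []
    avoids-lift i (e ∷ L) = ((λ ()) , (λ ())) ∷ avoids-lift i L

    avoids-newStar : ∀ {i j} → i ≢ j → All (Avoids (inj₂ i)) (newStar j)
    avoids-newStar {i} {j} i≢j = (new≢ , λ ()) ∷ (new≢ , λ ()) ∷ (new≢ , λ ()) ∷ (new≢ , λ ()) ∷ []
      where
      new≢ : _≢_ {A = RV' m n} (inj₂ i) (inj₂ j)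
      new≢ refl = i≢j refl

    module _ (p : Placement (RV' m n))
      (onLine : ∀ i k → p (inj₂ i) k ≡ (p (proj₂ (mapPair inj₁ (del i))) k + p (proj₂ (mapPair inj₁ (del i))) k) - p (proj₁ (mapPair inj₁ (del i))) k)
      (spread : ∀ i → Indep (differences p (star (inj₁ (inj₁ (deletedHinge s i , zero)))
        (inj₁ (inj₁ (deletedHinge s i , suc zero)) ∷ inj₁ (inj₁ (otherHinge i , zero)) ∷ inj₁ (inj₁ (otherHinge i , suc zero)) ∷ [])))) where

      -- Invariant: the hinges still to be deleted, together with `M`, are independent. One
      -- extension trades the first of these hinges for a star, which is then shifted behind the
      -- remaining hinges.
      addStars-indep : ∀ is → Unique is → ∀ M → All (λ i → All (Avoids (inj₂ i)) M) is →
        RowsIndep eqV' p (lift (map del is) ++ M) → RowsIndep eqV' p (addStars is M)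
      addStars-indep []       []            M avoids           ind = ind
      addStars-indep (i ∷ is) (i∉is ∷ uniq) M (avoid ∷ avoids) ind =
        addStars-indep is uniq (newStar i ++ M)
          (All.zipWith (λ (i≢j , avoid) → Allₚ.++⁺ (avoids-newStar (i≢j ∘ sym)) avoid) (i∉is , avoids))
          (indep-↭ eqV' p {newStar i ++ lift (map del is) ++ M} (shifts (newStar i) (lift (map del is)))
            (Extensions.henneberg-II eqV' p (onLine i) ((λ ()) ∷ (λ ()) ∷ (λ ()) ∷ (λ ()) ∷ [])
              (Allₚ.++⁺ (avoids-lift i (map del is)) avoid) (spread i) ind))

    RemainingEdge : Pair (RV m n) → Set
    RemainingEdge e = AdjP (ring m n G) e × (∀ i → ¬ SameEdge e (del i))

    del-distinct : ∀ {i j} → i ≢ j → ¬ SameEdge (del i) (del j)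
    del-distinct {i} {j} i≢j (inj₁ (eq , _)) = i≢j (s-inj i j (cong proj₁ (inj₁-injective eq)))
    del-distinct i≢j (inj₂ (eq , _)) = Finₚ.0≢1+n (cong proj₂ (inj₁-injective eq))

    -- With the deleted hinges restored the list lies in the independent ring; injectivity of the
    -- deletion keeps these hinges distinct.
    dels++-indep : ∀ L → SimpleList L → All RemainingEdge L → IndepR3 eqV (map del (allFin m) ++ L)
    dels++-indep L (noLoops , distinct) edges = indepR (map del (allFin m) ++ L) simple
        (Allₚ.++⁺ (Allₚ.map⁺ (All.tabulate (λ {i} _ → deleted-adj i))) (All.map proj₁ edges))
      where
      simple : SimpleList (map del (allFin m) ++ L)
      simple = Allₚ.++⁺ (Allₚ.map⁺ (All.tabulate (λ _ ()))) noLoops ,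
        AllPairsₚ.++⁺ (AllPairsₚ.map⁺ (AllPairsₚ.tabulate⁺ del-distinct)) distinct
          (Allₚ.map⁺ (All.tabulate (λ {i} _ → All.map (λ (_ , ¬del) same → ¬del i (SameEdge-sym same)) edges)))

    d≢o : ∀ i {ε ε′} → _≢_ {A = RV m n} (inj₁ (deletedHinge s i , ε)) (inj₁ (otherHinge i , ε′))
    d≢o i eq = other≢deleted i (sym (cong proj₁ (inj₁-injective eq)))

    -- Genericity is asked of the old vertices only: the ring edges stay independent and the four
    -- base vertices of each link span a tetrahedron. The new vertices are then defined on their
    -- lines, so collinearity holds by computation.
    extension-indep : ∀ L → SimpleList L → All RemainingEdge L →
      ∃ λ p → RowsIndep eqV' p (addStars (allFin m) (lift L))
    extension-indep L simple edges = p' , addStars-indep p' (λ _ _ → refl) (proj₂ (proj₂ point)) (allFin m)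
        (AllPairsₚ.tabulate⁺ id) (lift L) (All.tabulate (λ {i} _ → avoids-lift i L))
        (subst (RowsIndep eqV' p') (map-++ (mapPair inj₁) (map del (allFin m)) L)
          (indep-map⁺ eqV eqV' inj₁ inj₁-injective p' dels++L (proj₁ (proj₂ point))))
      where
      open GenericPlacement (finite-RV m n) eqV
      open Rank (finite-RV m n) eqV
      dels++L = map del (allFin m) ++ L
      tetra : Fin m → Placement (RV m n) → Set
      tetra i p = Indep (differences p (star (inj₁ (deletedHinge s i , zero))
        (inj₁ (deletedHinge s i , suc zero) ∷ inj₁ (otherHinge i , zero) ∷ inj₁ (otherHinge i , suc zero) ∷ [])))
      unique-base : ∀ i → Unique (inj₁ (deletedHinge s i , suc zero) ∷ inj₁ (otherHinge i , zero) ∷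
        inj₁ (otherHinge i , suc zero) ∷ inj₁ (deletedHinge s i , zero) ∷ [])
      unique-base i = (d≢o i ∷ d≢o i ∷ (λ ()) ∷ []) ∷ ((λ ()) ∷ (d≢o i ∘ sym) ∷ []) ∷ ((d≢o i ∘ sym) ∷ []) ∷ [] ∷ []
      point = generic-∃ (generic-× {λ p → RowsIndep eqV p dels++L} (generic-indep {dels++L} (dels++-indep L simple edges))
        (generic-∀ {P = tetra} (λ i → generic-star (unique-base i))))
      p = proj₁ point
      p' : Placement (RV' m n)
      p' (inj₁ v) = p v
      p' (inj₂ i) = λ k → (p (proj₂ (del i)) k + p (proj₂ (del i)) k) - p (proj₁ (del i)) k

    ringPart : List (Pair (RV' m n)) → List (Pair (RV m n))
    ringPart []                     = []
    ringPart ((inj₁ u , inj₁ v) ∷ L) = (u , v) ∷ ringPart L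
    ringPart ((inj₁ u , inj₂ _) ∷ L) = ringPart L
    ringPart ((inj₂ _ , _) ∷ L)      = ringPart L

    ringPart-∈⁻ : ∀ {L e} → e ∈ ringPart L → mapPair inj₁ e ∈ L
    ringPart-∈⁻ {(inj₁ u , inj₁ v) ∷ L} (here refl) = here refl
    ringPart-∈⁻ {(inj₁ u , inj₁ v) ∷ L} (there e∈)  = there (ringPart-∈⁻ e∈)
    ringPart-∈⁻ {(inj₁ u , inj₂ _) ∷ L} e∈          = there (ringPart-∈⁻ e∈)
    ringPart-∈⁻ {(inj₂ _ , _) ∷ L}      e∈          = there (ringPart-∈⁻ e∈)

    ringPart-∈⁺ : ∀ {L u v} → (inj₁ u , inj₁ v) ∈ L → (u , v) ∈ ringPart L
    ringPart-∈⁺ (here refl) = here refl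
    ringPart-∈⁺ {(inj₁ u , inj₁ v) ∷ L} (there e∈) = there (ringPart-∈⁺ e∈)
    ringPart-∈⁺ {(inj₁ u , inj₂ _) ∷ L} (there e∈) = ringPart-∈⁺ e∈
    ringPart-∈⁺ {(inj₂ _ , _) ∷ L}      (there e∈) = ringPart-∈⁺ e∈

    ringPart-distinct : ∀ {L} → AllPairs (λ e f → ¬ SameEdge e f) L → AllPairs (λ e f → ¬ SameEdge e f) (ringPart L)
    ringPart-distinct {[]}                     []       = []
    ringPart-distinct {(inj₁ u , inj₁ v) ∷ L} (x ∷ xs) =
      All.tabulate (λ f∈ same → All.lookup x (ringPart-∈⁻ f∈) (SameEdge-map⁺ inj₁ same)) ∷ ringPart-distinct xs
    ringPart-distinct {(inj₁ u , inj₂ _) ∷ L} (x ∷ xs) = ringPart-distinct xs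
    ringPart-distinct {(inj₂ _ , _) ∷ L}      (x ∷ xs) = ringPart-distinct xs

    -- Any edge list of R' is contained, up to orientation, in its old edges together with all
    -- stars, and independence passes down.
    ring'-independent : Independent (ring' m n G s)
    ring'-independent L simple@(noLoops , distinct) edges =
        p , fromRowsIndep eqV' p L (indep-mono eqV' p simple (All.tabulate covered) ind)
      where
      R = ringPart L
      ext = extension-indep R
        (All.tabulate (λ e∈ eq → All.lookup noLoops (ringPart-∈⁻ e∈) (cong inj₁ eq)) , ringPart-distinct distinct)
        (All.tabulate (λ e∈ → All.lookup edges (ringPart-∈⁻ e∈)))
      p = proj₁ ext
      ind = proj₂ ext
      starEdge : ∀ {u i} → u ∈ baseVerts i → (inj₂ i , inj₁ u) ∈ addStars (allFin m) (lift R)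
      starEdge {u} {i} u∈ = addStars-new {allFin m} {lift R} (∈-allFin i) (∈-map⁺ (inj₂ i ,_) (∈-map⁺ inj₁ (baseVerts⊆base i u∈)))
      covered : ∀ {e} → e ∈ L → Any (SameEdge e) (addStars (allFin m) (lift R))
      covered {inj₁ u , inj₁ v} e∈ = lose (addStars-old (allFin m) (∈-map⁺ (mapPair inj₁) (ringPart-∈⁺ e∈))) SameEdge-refl
      covered {inj₁ u , inj₂ i} e∈ = lose (starEdge {u} {i} (All.lookup edges e∈)) (inj₂ (refl , refl))
      covered {inj₂ i , inj₁ u} e∈ = lose (starEdge {u} {i} (All.lookup edges e∈)) SameEdge-refl
      covered {inj₂ i , inj₂ j} e∈ = ⊥-elim (All.lookup edges e∈)

-- Implied hinges

sublist-distinct : ∀ {A : Set} {R : A → A → Set} {K L : List A} → K ⊆ L → AllPairs R L → AllPairs R K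
sublist-distinct []         []       = []
sublist-distinct (y ∷ʳ K⊆L) (r ∷ rs) = sublist-distinct K⊆L rs
sublist-distinct (refl ∷ K⊆L) (r ∷ rs) = All-resp-⊆ K⊆L r ∷ sublist-distinct K⊆L rs

-- Circuits in dependent edge lists

module CircuitExtraction {V : Set} (finite : Finite V) (eqV : DecidableEquality V) where
  open GenericPlacement finite eqV using (indepR3?)

  indepR3-sublist : ∀ {K L} → K ⊆ L → IndepR3 eqV L → IndepR3 eqV K
  indepR3-sublist {K} {L} K⊆L (p , ind) = p , fromRowsIndep eqV p K
      (indep-mono eqV p (All-resp-⊆ K⊆L noLoops , sublist-distinct K⊆L distinct)
        (All.tabulate (λ e∈ → Any.map (λ { refl → SameEdge-refl }) (Sublist.lookup K⊆L e∈))) indL)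
    where
    indL = toRowsIndep eqV p L ind
    noLoops = proj₁ (indep⇒simple eqV p indL)
    distinct = proj₂ (indep⇒simple eqV p indL)

  indepR3-↭ : ∀ {K L} → K ↭ L → IndepR3 eqV K → IndepR3 eqV L
  indepR3-↭ {K} {L} K↭L (p , ind) = p , fromRowsIndep eqV p L (indep-↭ eqV p K↭L (toRowsIndep eqV p K ind))

  -- Greedy deletion with `B` as protected part: an edge is dropped when the rest stays dependent
  -- without it. Otherwise it moves into `B`, and the independence just found shows later that its
  -- removal from the final list destroys the dependence.
  extract : ∀ B L → ¬ IndepR3 eqV (L ++ B) → ∃ λ K → K ⊆ L × ¬ IndepR3 eqV (K ++ B) ×
    (∀ k → IndepR3 eqV (removeAt K k ++ B))
  extract B []      dep = [] , [] , dep , λ ()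
  extract B (e ∷ L) dep with indepR3? (L ++ B)
  ... | no dep′ =
    let (K , K⊆L , depK , indK) = extract B L dep′ in K , e ∷ʳ K⊆L , depK , indK
  ... | yes ind₀ =
    let (K , K⊆L , depK , indK) = extract (e ∷ B) L
          (λ ind → dep (indepR3-↭ {L ++ e ∷ B} {e ∷ L ++ B} (shift e L B) ind))
    in e ∷ K , refl ∷ K⊆L ,
       (λ ind → depK (indepR3-↭ {e ∷ K ++ B} {K ++ e ∷ B} (↭-sym (shift e K B)) ind)) ,
       λ { zero → indepR3-sublist {K ++ B} {L ++ B} (++⁺ K⊆L (⊆-refl {x = B})) ind₀
         ; (suc k) → indepR3-↭ {removeAt K k ++ e ∷ B} {e ∷ removeAt K k ++ B} (shift e (removeAt K k) B) (indK k) }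

  circuit-through : ∀ {h L} → IndepR3 eqV L → ¬ IndepR3 eqV (h ∷ L) → ∃ λ K → K ⊆ L × Circuit eqV (h ∷ K)
  circuit-through {h} {L} ind dep =
    let (K , K⊆L , depK , indK) = extract (h ∷ []) L (λ ind → dep (indepR3-↭ {L ++ h ∷ []} {h ∷ L} (unappend L) ind))
    in K , K⊆L ,
       (λ ind → depK (indepR3-↭ {h ∷ K} {K ++ h ∷ []} (↭-sym (unappend K)) ind)) ,
       λ { zero → indepR3-sublist {K} {L} K⊆L ind
         ; (suc k) → indepR3-↭ {removeAt K k ++ h ∷ []} {h ∷ removeAt K k} (unappend (removeAt K k)) (indK k) }
    where
    unappend : ∀ L → L ++ h ∷ [] ↭ h ∷ L
    unappend L = subst (λ z → L ++ h ∷ [] ↭ h ∷ z) (++-identityʳ L) (shift h L [])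

sameEdge? : ∀ {V : Set} → DecidableEquality V → (e f : Pair V) → Dec (SameEdge e f)
sameEdge? eqV (u , v) (x , y) = (eqV u x ×-dec eqV v y) ⊎-dec (eqV u y ×-dec eqV v x)

module _ {V : Set} (eqV : DecidableEquality V) where

  -- Bases of consecutive links may repeat a hinge edge, and a deleted hinge must not reappear.
  -- Filtering against `B` and everything kept so far settles both without comparing links.
  fresh : List (Pair V) → List (Pair V) → List (Pair V)
  fresh B []      = []
  fresh B (e ∷ L) with Any.any? (sameEdge? eqV e) B
  ... | yes _ = fresh B L
  ... | no  _ = e ∷ fresh (e ∷ B) L

  fresh-∈ : ∀ {B L e} → e ∈ fresh B L → e ∈ L
  fresh-∈ {B} {f ∷ L} e∈ with Any.any? (sameEdge? eqV f) B
  fresh-∈ e∈          | yes _ = there (fresh-∈ e∈)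
  fresh-∈ (here refl) | no _  = here refl
  fresh-∈ (there e∈)  | no _  = there (fresh-∈ e∈)

  fresh-avoids : ∀ B L → All (λ e → ¬ Any (SameEdge e) B) (fresh B L)
  fresh-avoids B []      = []
  fresh-avoids B (e ∷ L) with Any.any? (sameEdge? eqV e) B
  ... | yes _ = fresh-avoids B L
  ... | no e∉ = e∉ ∷ All.map (λ f∉ → f∉ ∘ there) (fresh-avoids (e ∷ B) L)

  fresh-distinct : ∀ B L → AllPairs (λ e f → ¬ SameEdge e f) (fresh B L)
  fresh-distinct B []      = []
  fresh-distinct B (e ∷ L) with Any.any? (sameEdge? eqV e) B
  ... | yes _ = fresh-distinct B L
  ... | no _  = All.map (λ f∉ same → f∉ (here (SameEdge-sym same))) (fresh-avoids (e ∷ B) L) ∷ fresh-distinct (e ∷ B) L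

  fresh-covers : ∀ B {L e} → e ∈ L → Any (SameEdge e) B ⊎ Any (SameEdge e) (fresh B L)
  fresh-covers B {f ∷ L} e∈ with Any.any? (sameEdge? eqV f) B
  fresh-covers B (here refl) | yes f∈ = inj₁ f∈
  fresh-covers B (there e∈)  | yes _  = fresh-covers B e∈
  fresh-covers B (here refl) | no _   = inj₂ (here SameEdge-refl)
  fresh-covers B {f ∷ L} (there e∈)  | no _ with fresh-covers (f ∷ B) e∈
  ... | inj₁ (here same) = inj₂ (here same)
  ... | inj₁ (there e∈B) = inj₁ e∈B
  ... | inj₂ e∈fresh     = inj₂ (there e∈fresh)

-- Span membership is available only up to double negation. For a negative goal, finitely many such
-- facts may be assumed together.
¬¬-∀ : ∀ {k} {P : Fin k → Set} → (∀ i → ¬ ¬ P i) → ¬ ¬ (∀ i → P i)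
¬¬-∀ {zero}  ¬¬P ¬∀ = ¬∀ λ ()
¬¬-∀ {suc k} ¬¬P ¬∀ = ¬¬P zero λ P₀ → ¬¬-∀ (¬¬P ∘ suc) λ Pₛ → ¬∀ λ { zero → P₀ ; (suc i) → Pₛ i }

allLV : ∀ k → List (LV k)
allLV k = hA ∷ hB ∷ hC ∷ hD ∷ map inj₂ (allFin k)

allLV-unique : ∀ k → Unique (allLV k)
allLV-unique k = ((λ ()) ∷ (λ ()) ∷ (λ ()) ∷ off) ∷ ((λ ()) ∷ (λ ()) ∷ off) ∷ ((λ ()) ∷ off) ∷ off ∷
    Uniqueₚ.map⁺ (λ { refl → refl }) (Uniqueₚ.allFin⁺ k)
  where
  off : ∀ {a} → All (inj₁ a ≢_) (map inj₂ (allFin k))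
  off = Allₚ.map⁺ (All.tabulate (λ _ ()))

∈-allLV : ∀ {k} (x : LV k) → x ∈ allLV k
∈-allLV (inj₁ zero)                   = here refl
∈-allLV (inj₁ (suc zero))             = there (here refl)
∈-allLV (inj₁ (suc (suc zero)))       = there (there (here refl))
∈-allLV (inj₁ (suc (suc (suc zero)))) = there (there (there (here refl)))
∈-allLV (inj₂ x)                      = there (there (there (there (∈-map⁺ inj₂ (∈-allFin x)))))

SameEdge-map⁻ : ∀ {V W : Set} {j : V → W} → (∀ {u v} → j u ≡ j v → u ≡ v) → ∀ {e f} →
  SameEdge (mapPair j e) (mapPair j f) → SameEdge e f
SameEdge-map⁻ inj (inj₁ (eq₁ , eq₂)) = inj₁ (inj eq₁ , inj eq₂)
SameEdge-map⁻ inj (inj₂ (eq₁ , eq₂)) = inj₂ (inj eq₁ , inj eq₂)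

simple-map : ∀ {V W : Set} {j : V → W} → (∀ {u v} → j u ≡ j v → u ≡ v) → ∀ {L} →
  SimpleList L → SimpleList (map (mapPair j) L)
simple-map inj (noLoops , distinct) = Allₚ.map⁺ (All.map (λ u≢v → u≢v ∘ inj) noLoops) ,
  AllPairsₚ.map⁺ (AllPairs.map (λ e≁f → e≁f ∘ SameEdge-map⁻ inj) distinct)

record LinkBasis {k : ℕ} (A : LV k → LV k → Set) : Set where
  field
    edges  : List (Pair (LV k))
    simple : SimpleList edges
    inLink : All (AdjP (linkGraph k A)) edges
    large  : length (allLV k) ℕ.* 3 ≤ length edges ℕ.+ 6

-- Testing rigidity against a basis of the complete graph on the link yields a list of link edges of
-- full size.
linkBasis : ∀ {k A} → Rigid (linkGraph k A) → LinkBasis A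
linkBasis {k} rigid =
  let (L , simpleL , _ , indL , lenL) = basis (allLV k) (allLV-unique k) (s≤s (s≤s (s≤s z≤n)))
      (S , simpleS , inS , _ , L≤S) = rigid L simpleL (All.tabulate (λ _ → tt , tt)) indL
  in record { edges = S ; simple = simpleS ; inLink = inS
            ; large = ℕₚ.≤-trans (ℕₚ.≤-reflexive (sym lenL)) (ℕₚ.+-monoˡ-≤ 6 L≤S) }
  where open Rank (finite-LV k) (eqLV k)

module ImpliedHinges (m : ℕ) (2≤m : 2 ≤ m) (n : Fin m → ℕ) (G : (i : Fin m) → LV (n i) → LV (n i) → Set)
    (hinges : (i : Fin m) → G i hA hB × G i hC hD) (s : Fin m → Bool)
    (s-inj : (i j : Fin m) → deletedHinge s i ≡ deletedHinge s j → i ≡ j)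
    (indepR : Independent (ring m n G)) (bases : (i : Fin m) → LinkBasis (G i)) where
  open Rings m 2≤m n
  open Extended G hinges s s-inj indepR
  open CircuitExtraction (finite-RV' m n) eqV'

  module B i = LinkBasis (bases i)

  toRing : ∀ i → List (Pair (LV (n i))) → List (Pair (RV m n))
  toRing i = map (mapPair (emb i))

  dels : List (Pair (RV m n))
  dels = map del (allFin m)

  candidates T : List (Pair (RV m n))
  candidates = concat (tabulate (λ i → toRing i (B.edges i)))
  T = fresh eqV dels candidates

  ∈-candidates⁻ : ∀ {e} → e ∈ candidates → ∃ λ i → ∃ λ f → f ∈ B.edges i × e ≡ mapPair (emb i) f
  ∈-candidates⁻ {e} e∈ =
    let (xs , e∈xs , xs∈) = ∈-concat⁻′ (tabulate (λ i → toRing i (B.edges i))) e∈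
        (i , xs≡) = ∈-tabulate⁻ {f = λ i → toRing i (B.edges i)} xs∈
        (f , f∈ , e≡) = ∈-map⁻ (mapPair (emb i)) (subst (e ∈_) xs≡ e∈xs)
    in i , f , f∈ , e≡

  FromLink : Pair (RV m n) → Set
  FromLink e = ∃ λ i → ∃ λ f → f ∈ B.edges i × e ≡ mapPair (emb i) f

  T-fromLink : ∀ {e} → e ∈ T → FromLink e
  T-fromLink e∈ = ∈-candidates⁻ (fresh-∈ eqV {dels} {candidates} e∈)

  fromLink-adj : ∀ {e} → FromLink e → AdjP (ring m n G) e
  fromLink-adj (i , (x , y) , xy∈ , refl) = i , x , y , All.lookup (B.inLink i) xy∈ , refl , refl

  fromLink-noLoop : ∀ {e} → FromLink e → proj₁ e ≢ proj₂ e
  fromLink-noLoop (i , (x , y) , xy∈ , refl) eq = All.lookup (proj₁ (B.simple i)) xy∈ (ι-injective i eq)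

  T-notDeleted : ∀ {e} → e ∈ T → ∀ i → ¬ SameEdge e (del i)
  T-notDeleted {e} e∈ i same = All.lookup {P = λ e → ¬ Any (SameEdge e) dels} (fresh-avoids eqV dels candidates) e∈
    (lose {P = SameEdge e} (∈-map⁺ del (∈-allFin i)) same)

  T-remaining : All RemainingEdge T
  T-remaining = All.tabulate (λ e∈ → fromLink-adj (T-fromLink e∈) , T-notDeleted e∈)

  T-simple : SimpleList T
  T-simple = All.tabulate (λ e∈ → fromLink-noLoop (T-fromLink e∈)) , fresh-distinct eqV dels candidates

  -- A list standing for the edge set of R': all stars, and the link bases without the deleted
  -- hinges.
  E' : List (Pair (RV' m n))
  E' = addStars (allFin m) (lift T)

  E'-indep : IndepR3 eqV' E'
  E'-indep = let (p , ind) = extension-indep T T-simple T-remaining in p , fromRowsIndep eqV' p E' ind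

  E'-adj : All (AdjP (ring' m n G s)) E'
  E'-adj = addStars-All (allFin m) starAdj (Allₚ.map⁺ T-remaining)
    where
    starAdj : ∀ {i e} → i ∈ allFin m → e ∈ newStar i → AdjP (ring' m n G s) e
    starAdj {i} _ e∈ with ∈-map⁻ (inj₂ i ,_) e∈
    ... | v , v∈ , refl with ∈-map⁻ inj₁ v∈
    ... | u , u∈ , refl = base⊆baseVerts i u∈

  apex : Fin m → RV m n
  apex i = inj₁ (otherHinge i , suc zero)

  base₃ : Fin m → List (RV m n)
  base₃ i = inj₁ (deletedHinge s i , zero) ∷ inj₁ (deletedHinge s i , suc zero) ∷ inj₁ (otherHinge i , zero) ∷ []

  star₃ : Fin m → List (Pair (RV' m n))
  star₃ i = star (inj₂ i) (map inj₁ (base₃ i))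

  addStars₃ : List (Fin m) → List (Pair (RV' m n)) → List (Pair (RV' m n))
  addStars₃ []       M = M
  addStars₃ (i ∷ is) M = star₃ i ++ addStars₃ is M

  length-addStars₃ : ∀ is M → length (addStars₃ is M) ≡ length is ℕ.* 3 ℕ.+ length M
  length-addStars₃ []       M = refl
  length-addStars₃ (i ∷ is) M = cong (3 ℕ.+_) (length-addStars₃ is M)

  addStars₃-old : ∀ is {M e} → e ∈ M → e ∈ addStars₃ is M
  addStars₃-old []       e∈ = e∈
  addStars₃-old (i ∷ is) e∈ = ∈-++⁺ʳ (star₃ i) (addStars₃-old is e∈)

  addStars₃-new : ∀ {is M i e} → i ∈ is → e ∈ star₃ i → e ∈ addStars₃ is M
  addStars₃-new {i ∷ is} (here refl) e∈ = ∈-++⁺ˡ e∈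
  addStars₃-new {i ∷ is} (there i∈)  e∈ = ∈-++⁺ʳ (star₃ i) (addStars₃-new i∈ e∈)

  avoids-addStars₃ : ∀ {i} is L → All (i ≢_) is → All (Avoids (inj₂ i)) (addStars₃ is (lift L))
  avoids-addStars₃ {i} []       L []           = avoids-lift i L
  avoids-addStars₃ {i} (j ∷ is) L (i≢j ∷ i≢is) = (new≢ , λ ()) ∷ (new≢ , λ ()) ∷ (new≢ , λ ()) ∷ avoids-addStars₃ is L i≢is
    where
    new≢ : _≢_ {A = RV' m n} (inj₂ i) (inj₂ j)
    new≢ refl = i≢j refl

  base₃-unique : ∀ i → Unique (inj₁ (deletedHinge s i , zero) ∷ inj₁ (deletedHinge s i , suc zero) ∷
    inj₁ (otherHinge i , zero) ∷ apex i ∷ [])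
  base₃-unique i = ((λ ()) ∷ d≢o i ∷ d≢o i ∷ []) ∷ (d≢o i ∷ d≢o i ∷ []) ∷ ((λ ()) ∷ []) ∷ [] ∷ []

  Q : List (Pair (RV' m n))
  Q = addStars₃ (allFin m) (lift (dels ++ T))

  -- Per link, three star edges and one deleted hinge balance the four edges of a full star.
  Q-length : length Q ≡ length E'
  Q-length = begin
    length Q ≡⟨ length-addStars₃ (allFin m) (lift (dels ++ T)) ⟩
    a ℕ.* 3 ℕ.+ length (lift (dels ++ T)) ≡⟨ cong (a ℕ.* 3 ℕ.+_) (trans (length-map (mapPair inj₁) (dels ++ T))
         (trans (length-++ dels) (cong (ℕ._+ length T) (length-map del (allFin m))))) ⟩
    a ℕ.* 3 ℕ.+ (a ℕ.+ length T) ≡⟨ sym (ℕₚ.+-assoc (a ℕ.* 3) a (length T)) ⟩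
    a ℕ.* 3 ℕ.+ a ℕ.+ length T ≡⟨ cong (ℕ._+ length T) (trans (ℕₚ.+-comm (a ℕ.* 3) a) (sym (ℕₚ.*-suc a 3))) ⟩
    a ℕ.* 4 ℕ.+ length T ≡⟨ cong (a ℕ.* 4 ℕ.+_) (sym (length-map (mapPair inj₁) T)) ⟩
    a ℕ.* 4 ℕ.+ length (lift T) ≡⟨ sym (length-addStars (allFin m) (lift T)) ⟩
    length E' ∎
    where
    open ≡-Reasoning
    a = length (allFin m)

  -- The new vertex of a link may be placed on top of the fourth base vertex.
  Q-indep : IndepR3 eqV' Q
  Q-indep = p' , fromRowsIndep eqV' p' Q (stars (allFin m) (Uniqueₚ.allFin⁺ m))
    where
    open GenericPlacement (finite-RV m n) eqV
    open Rank (finite-RV m n) eqV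
    spread₃ : Fin m → Placement (RV m n) → Set
    spread₃ i p = Indep (differences p (star (apex i) (base₃ i)))
    point = generic-∃ (generic-× {λ p → RowsIndep eqV p (dels ++ T)}
      (generic-indep {dels ++ T} (dels++-indep T T-simple T-remaining))
      (generic-∀ {P = spread₃} (λ i → generic-star (base₃-unique i))))
    p = proj₁ point
    p' : Placement (RV' m n)
    p' (inj₁ v) = p v
    p' (inj₂ i) = p (apex i)
    stars : ∀ is → Unique is → RowsIndep eqV' p' (addStars₃ is (lift (dels ++ T)))
    stars []       []            = indep-map⁺ eqV eqV' inj₁ inj₁-injective p' (dels ++ T) (proj₁ (proj₂ point))
    stars (i ∷ is) (i∉is ∷ uniq) = Extensions.zero-extension eqV' p' (map inj₁ (base₃ i)) ((λ ()) ∷ (λ ()) ∷ (λ ()) ∷ [])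
      (avoids-addStars₃ is (dels ++ T) i∉is)
      (indep-cong {A = differences p (star (apex i) (base₃ i))} {differences p' (star₃ i)}
        (λ { zero c → refl ; (suc zero) c → refl ; (suc (suc zero)) c → refl }) (proj₂ (proj₂ point) i))
      (stars is uniq)

  linkVertices : ∀ i → List (RV' m n)
  linkVertices i = inj₂ i ∷ map (λ x → inj₁ (emb i x)) (allLV (n i))

  linkVertices-unique : ∀ i → Unique (linkVertices i)
  linkVertices-unique i = Allₚ.map⁺ (All.tabulate {xs = allLV (n i)} (λ _ ())) ∷
    Uniqueₚ.map⁺ (λ {x} {y} eq → ι-injective i {x} {y} (inj₁-injective eq)) (allLV-unique (n i))

  ∈-linkVertices : ∀ i x → inj₁ (emb i x) ∈ linkVertices i
  ∈-linkVertices i x = there (∈-map⁺ {B = RV' m n} (λ x → inj₁ (emb i x)) (∈-allLV x))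

  base-fromLink : ∀ i {u : RV m n} → u ∈ baseVerts i → ∃ λ x → u ≡ emb i x
  base-fromLink i (here eq)                         = hA , eq
  base-fromLink i (there (here eq))                 = hB , eq
  base-fromLink i (there (there (here eq)))         = hC , eq
  base-fromLink i (there (there (there (here eq)))) = hD , eq

  ∈-newStar⁻ : ∀ i {e} → e ∈ newStar i → ∃ λ u → u ∈ base i × e ≡ (inj₂ i , inj₁ u)
  ∈-newStar⁻ i e∈ =
    let (v , v∈ , e≡) = ∈-map⁻ (inj₂ i ,_) e∈
        (u , u∈ , v≡) = ∈-map⁻ inj₁ v∈
    in u , u∈ , trans e≡ (cong (inj₂ i ,_) v≡)

  extendedLink : ∀ i → List (Pair (RV' m n))
  extendedLink i = newStar i ++ lift (toRing i (B.edges i))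

  length-linkVertices : ∀ i → length (linkVertices i) ≡ suc (length (allLV (n i)))
  length-linkVertices i = cong suc (length-map (λ x → inj₁ (emb i x)) (allLV (n i)))

  length-extendedLink : ∀ i → length (extendedLink i) ≡ 4 ℕ.+ length (B.edges i)
  length-extendedLink i = cong (4 ℕ.+_) (trans (length-map (mapPair inj₁) (toRing i (B.edges i))) (length-map (mapPair (emb i)) (B.edges i)))

  extendedLink-inside : ∀ i → All (EndsIn (linkVertices i)) (extendedLink i)
  extendedLink-inside i = Allₚ.++⁺ (All.tabulate inStar) (Allₚ.map⁺ (Allₚ.map⁺ (All.tabulate (λ {e} _ →
      ∈-linkVertices i (proj₁ e) , ∈-linkVertices i (proj₂ e)))))
    where
    inStar : ∀ {e} → e ∈ newStar i → EndsIn (linkVertices i) e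
    inStar e∈ =
      let (u , u∈ , e≡) = ∈-newStar⁻ i e∈
          (x , u≡) = base-fromLink i (base⊆baseVerts i u∈)
      in subst (EndsIn (linkVertices i)) (sym (trans e≡ (cong (λ u → inj₂ i , inj₁ u) u≡))) (here refl , ∈-linkVertices i x)

  newStar-simple : ∀ i → SimpleList (newStar i)
  newStar-simple i = ((λ ()) ∷ (λ ()) ∷ (λ ()) ∷ (λ ()) ∷ []) ,
      AllPairsₚ.map⁺ {f = inj₂ i ,_} (AllPairsₚ.map⁺ {f = inj₁} (AllPairs.map apart (base₃-unique i)))
    where
    apart : ∀ {u v : RV m n} → u ≢ v → ¬ SameEdge {RV' m n} (inj₂ i , inj₁ u) (inj₂ i , inj₁ v)
    apart u≢v (inj₁ (_ , eq)) = u≢v (inj₁-injective eq)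

  extendedLink-simple : ∀ i → SimpleList (extendedLink i)
  extendedLink-simple i = Allₚ.++⁺ (proj₁ (newStar-simple i)) (proj₁ old) ,
      AllPairsₚ.++⁺ (proj₂ (newStar-simple i)) (proj₂ old) (All.tabulate (λ e∈ → Allₚ.map⁺ (All.tabulate (λ {f} _ → apart e∈ f))))
    where
    old : SimpleList (lift (toRing i (B.edges i)))
    old = simple-map inj₁-injective (simple-map (ι-injective i) (B.simple i))
    apart : ∀ {e} → e ∈ newStar i → ∀ f → ¬ SameEdge e (mapPair inj₁ f)
    apart e∈ f same with ∈-newStar⁻ i e∈
    apart e∈ f (inj₁ ()) | u , u∈ , refl
    apart e∈ f (inj₂ ()) | u , u∈ , refl

  -- The rank is at most 3(|V| + 1) - 6, one less than the number of edges.
  extendedLink-dependent : ∀ i → ¬ IndepR3 eqV' (extendedLink i)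
  extendedLink-dependent i ind = ℕₚ.<-irrefl refl (begin-strict
    length (B.edges i) ℕ.+ 9           <⟨ ℕₚ.n<1+n _ ⟩
    suc (length (B.edges i) ℕ.+ 9)     ≡⟨ ℕₚ.+-suc (length (B.edges i)) 9 ⟨
    length (B.edges i) ℕ.+ 10          ≡⟨ ℕₚ.+-assoc (length (B.edges i)) 4 6 ⟨
    length (B.edges i) ℕ.+ 4 ℕ.+ 6     ≡⟨ cong (ℕ._+ 6) (trans (length-extendedLink i) (ℕₚ.+-comm 4 (length (B.edges i)))) ⟨
    length (extendedLink i) ℕ.+ 6      ≤⟨ rank-≤ {linkVertices i} {extendedLink i} (linkVertices-unique i) (s≤s (s≤s (s≤s z≤n))) (extendedLink-inside i) ind ⟩
    length (linkVertices i) ℕ.* 3      ≡⟨ cong (ℕ._* 3) (length-linkVertices i) ⟩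
    3 ℕ.+ length (allLV (n i)) ℕ.* 3   ≤⟨ ℕₚ.+-monoʳ-≤ 3 (B.large i) ⟩
    3 ℕ.+ (length (B.edges i) ℕ.+ 6)   ≡⟨ trans (ℕₚ.+-comm 3 (length (B.edges i) ℕ.+ 6)) (ℕₚ.+-assoc (length (B.edges i)) 6 3) ⟩
    length (B.edges i) ℕ.+ 9           ∎)
    where
    open ℕₚ.≤-Reasoning
    open Rank (finite-RV' m n) eqV'

  apexEdge : Fin m → Pair (RV' m n)
  apexEdge i = inj₂ i , inj₁ (apex i)

  ∈-newStar : ∀ i {e} → e ∈ newStar i → e ∈ star₃ i ⊎ e ≡ apexEdge i
  ∈-newStar i (here eq)                         = inj₁ (here eq)
  ∈-newStar i (there (here eq))                 = inj₁ (there (here eq))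
  ∈-newStar i (there (there (here eq)))         = inj₁ (there (there (here eq)))
  ∈-newStar i (there (there (there (here eq)))) = inj₂ eq

  toRing-⊆-candidates : ∀ i {e} → e ∈ toRing i (B.edges i) → e ∈ candidates
  toRing-⊆-candidates i e∈ = ∈-concat⁺′ e∈ (∈-tabulate⁺ {f = λ i → toRing i (B.edges i)} i)

  ring-inQ : ∀ {e} → e ∈ dels ++ T → mapPair inj₁ e ∈ Q
  ring-inQ e∈ = addStars₃-old (allFin m) (∈-map⁺ (mapPair inj₁) e∈)

  toRing-inQ : ∀ i {e} → e ∈ toRing i (B.edges i) → Any (SameEdge (mapPair inj₁ e)) Q
  toRing-inQ i {e} e∈ = [ (λ a → place (Anyₚ.++⁺ˡ a)) , (λ a → place (Anyₚ.++⁺ʳ dels a)) ]′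
      (fresh-covers eqV dels (toRing-⊆-candidates i e∈))
    where
    place : Any (SameEdge e) (dels ++ T) → Any (SameEdge (mapPair inj₁ e)) Q
    place a = let (f , f∈ , same) = find a in lose (ring-inQ f∈) (SameEdge-map⁺ inj₁ same)

  extendedLink-inQ : ∀ i → All (λ e → Any (SameEdge e) (apexEdge i ∷ Q)) (extendedLink i)
  extendedLink-inQ i = Allₚ.++⁺ (All.tabulate inStar) (Allₚ.map⁺ (All.tabulate (λ e∈ → there (toRing-inQ i e∈))))
    where
    inStar : ∀ {e} → e ∈ newStar i → Any (SameEdge e) (apexEdge i ∷ Q)
    inStar e∈ with ∈-newStar i e∈
    ... | inj₁ e∈₃  = there (lose (addStars₃-new {allFin m} {lift (dels ++ T)} (∈-allFin i) e∈₃) SameEdge-refl)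
    ... | inj₂ refl = here SameEdge-refl

  module _ (p : Placement (RV' m n)) (indQ : RowsIndep eqV' p Q) where

    Spanned : Pair (RV' m n) → Set
    Spanned e = InSpan (rows eqV' p Q) (row eqV' p e)

    spanned-∈ : ∀ {e} → e ∈ Q → Spanned e
    spanned-∈ {e} e∈ = inSpan-row (rows eqV' p Q) {row eqV' p e} (Any.index e∈)
      (λ c → cong (λ e → row eqV' p e c) (Anyₚ.lookup-index e∈))

    -- Were the fourth star edge outside the span, `Q` together with it would be independent, and so
    -- would its part inside the extended link, which has too many edges.
    apex-spanned : ∀ i → ¬ ¬ Spanned (apexEdge i)
    apex-spanned i ¬spanned = extendedLink-dependent i (p , fromRowsIndep eqV' p (extendedLink i)
      (indep-mono eqV' p (extendedLink-simple i) (extendedLink-inQ i)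
        (indep-cons (rows eqV' p (apexEdge i ∷ Q)) ¬spanned indQ)))

    E'-spanned : (∀ i → Spanned (apexEdge i)) → All Spanned E'
    E'-spanned apexes = addStars-All (allFin m) inStar
        (All.tabulate {xs = lift T} (λ e∈ → let (f , f∈ , e≡) = ∈-map⁻ (mapPair inj₁) e∈
          in subst Spanned (sym e≡) (spanned-∈ (ring-inQ (∈-++⁺ʳ dels f∈)))))
      where
      inStar : ∀ {i e} → i ∈ allFin m → e ∈ newStar i → Spanned e
      inStar {i} i∈ e∈ with ∈-newStar i e∈
      ... | inj₁ e∈₃ = spanned-∈ (addStars₃-new {allFin m} {lift (dels ++ T)} i∈ e∈₃)
      ... | inj₂ e≡  = subst Spanned (sym e≡) (apexes i)

  -- A generic placement serves `Q` and the enlarged list at once. There the whole enlarged list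
  -- lies in the span of `Q`, yet it has one edge more, against `steinitz`.
  dependent : ∀ i → ¬ IndepR3 eqV' (mapPair inj₁ (del i) ∷ E')
  dependent i ind = ¬¬-∀ (apex-spanned p indQ) λ apexes →
      ℕₚ.<-irrefl refl (ℕₚ.≤-trans (steinitz (rows eqV' p Q) (rows eqV' p (h ∷ E'))
        (λ k → All.lookup {P = Spanned p indQ} (spanned-∈ p indQ (ring-inQ (∈-++⁺ˡ (∈-map⁺ del (∈-allFin i)))) ∷
          E'-spanned p indQ apexes) (∈-lookup k)) indE)
        (ℕₚ.≤-reflexive Q-length))
    where
    h : Pair (RV' m n)
    h = mapPair inj₁ (del i)
    open GenericPlacement (finite-RV' m n) eqV'
    point = generic-∃ (generic-× {λ p → RowsIndep eqV' p Q} {λ p → RowsIndep eqV' p (h ∷ E')} (generic-indep {Q} Q-indep) (generic-indep {h ∷ E'} ind))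
    p = proj₁ point
    indQ = proj₁ (proj₂ point)
    indE = proj₂ (proj₂ point)

  hinge-implied : ∀ j → Implied (ring' m n G s) (hingePair' j)
  hinge-implied j with injective⇒surjective (deletedHinge s) s-inj j
  ... | i , refl = (λ ()) , notAdjacent SameEdge-refl , h ∷ K , simple ,
        (inj₂ SameEdge-refl ∷ All.map inj₁ (All-resp-⊆ K⊆E' E'-adj)) , here SameEdge-refl , circuit
    where
    h : Pair (RV' m n)
    h = mapPair inj₁ (del i)
    notAdjacent : ∀ {e} → SameEdge h e → ¬ AdjP (ring' m n G s) e
    notAdjacent (inj₁ (refl , refl)) (_ , ¬del) = ¬del i SameEdge-refl
    notAdjacent (inj₂ (refl , refl)) (_ , ¬del) = ¬del i (inj₂ (refl , refl))
    extracted = circuit-through {h} {E'} E'-indep (dependent i)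
    K = proj₁ extracted
    K⊆E' = proj₁ (proj₂ extracted)
    circuit = proj₂ (proj₂ extracted)
    E'-simple : SimpleList E'
    E'-simple = indep⇒simple eqV' (proj₁ E'-indep) (toRowsIndep eqV' (proj₁ E'-indep) E' (proj₂ E'-indep))
    simple : SimpleList (h ∷ K)
    simple = (λ ()) ∷ All-resp-⊆ K⊆E' (proj₁ E'-simple) ,
      All.map (λ adj same → notAdjacent same adj) (All-resp-⊆ K⊆E' E'-adj) ∷ sublist-distinct K⊆E' (proj₂ E'-simple)

-- Nucleations

length-unique-≤ : ∀ {A : Set} {K L : List A} → Unique K → (∀ {x} → x ∈ K → x ∈ L) → length K ≤ length L
length-unique-≤ {A} {K} {L} uniq K⊆L = Matching.length-≤ {R = _≡_}
  (AllPairs.map (λ x≢y _ x≡b y≡b → x≢y (trans x≡b (sym y≡b))) uniq) (All.tabulate {P = λ x → Any (x ≡_) L} K⊆L)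

module _ {m : ℕ} {B : Fin m → Set} where

  component : ∀ i → List (Σ (Fin m) B) → List (B i)
  component i []            = []
  component i ((k , b) ∷ L) with k ≟F i
  ... | yes refl = b ∷ component i L
  ... | no _     = component i L

  component-∈⁻ : ∀ {i b} L → b ∈ component i L → (i , b) ∈ L
  component-∈⁻ {i} ((k , _) ∷ L) b∈ with k ≟F i
  component-∈⁻ (_ ∷ L) (here refl) | yes refl = here refl
  component-∈⁻ (_ ∷ L) (there b∈)  | yes refl = there (component-∈⁻ L b∈)
  ... | no _ = there (component-∈⁻ L b∈)

  component-∈⁺ : ∀ {i b L} → (i , b) ∈ L → b ∈ component i L
  component-∈⁺ {i} (here {x = k , _} refl) with i ≟F i
  ... | yes refl = here refl
  ... | no i≢i   = ⊥-elim (i≢i refl)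
  component-∈⁺ {i} (there {x = k , _} b∈) with k ≟F i
  ... | yes refl = there (component-∈⁺ b∈)
  ... | no _     = component-∈⁺ b∈

  component-pairs : ∀ {R : Σ (Fin m) B → Σ (Fin m) B → Set} i {L} → AllPairs R L →
    AllPairs (λ b b′ → R (i , b) (i , b′)) (component i L)
  component-pairs i {[]}          []       = []
  component-pairs i {(k , b) ∷ L} (r ∷ rs) with k ≟F i
  ... | yes refl = All.tabulate (λ b∈ → All.lookup r (component-∈⁻ L b∈)) ∷ component-pairs i rs
  ... | no _     = component-pairs i rs

  ∑-component : ∀ L → ∑ℕ (λ i → length (component i L)) ≡ length L
  ∑-component []            = Sum.sum-replicate-zero m
  ∑-component ((k , b) ∷ L) = trans (Sum.sum-cong-≗ step)
      (trans (Sum.∑-distrib-+ (one k) (λ i → length (component i L))) (cong₂ ℕ._+_ (∑-one k) (∑-component L)))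
    where
    one : ∀ {m} → Fin m → Fin m → ℕ
    one k i with k ≟F i
    ... | yes _ = 1
    ... | no _  = 0
    step : ∀ i → length (component i ((k , b) ∷ L)) ≡ one k i ℕ.+ length (component i L)
    step i with k ≟F i
    ... | yes refl = refl
    ... | no _     = refl
    one-suc : ∀ {m} (k i : Fin m) → one (suc k) (suc i) ≡ one k i
    one-suc k i with k ≟F i
    ... | yes _ = refl
    ... | no _  = refl
    ∑-one : ∀ {m} (k : Fin m) → ∑ℕ (one k) ≡ 1
    ∑-one {suc m} zero    = cong suc (Sum.sum-replicate-zero m)
    ∑-one {suc m} (suc k) = trans (Sum.sum-cong-≗ (one-suc k)) (∑-one k)

module _ {A B : Set} where

  lefts : List (A ⊎ B) → List A
  lefts []           = []
  lefts (inj₁ a ∷ L) = a ∷ lefts L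
  lefts (inj₂ _ ∷ L) = lefts L

  rights : List (A ⊎ B) → List B
  rights []           = []
  rights (inj₁ _ ∷ L) = rights L
  rights (inj₂ b ∷ L) = b ∷ rights L

  lefts-∈⁻ : ∀ {a} L → a ∈ lefts L → inj₁ a ∈ L
  lefts-∈⁻ (inj₁ _ ∷ L) (here refl) = here refl
  lefts-∈⁻ (inj₁ _ ∷ L) (there a∈)  = there (lefts-∈⁻ L a∈)
  lefts-∈⁻ (inj₂ _ ∷ L) a∈          = there (lefts-∈⁻ L a∈)

  rights-∈⁻ : ∀ {b} L → b ∈ rights L → inj₂ b ∈ L
  rights-∈⁻ (inj₂ _ ∷ L) (here refl) = here refl
  rights-∈⁻ (inj₂ _ ∷ L) (there b∈)  = there (rights-∈⁻ L b∈)
  rights-∈⁻ (inj₁ _ ∷ L) b∈          = there (rights-∈⁻ L b∈)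

  lefts-∈⁺ : ∀ {a L} → inj₁ a ∈ L → a ∈ lefts L
  lefts-∈⁺ (here refl)                = here refl
  lefts-∈⁺ {L = inj₁ _ ∷ L} (there a∈) = there (lefts-∈⁺ a∈)
  lefts-∈⁺ {L = inj₂ _ ∷ L} (there a∈) = lefts-∈⁺ a∈

  rights-∈⁺ : ∀ {b L} → inj₂ b ∈ L → b ∈ rights L
  rights-∈⁺ (here refl)                = here refl
  rights-∈⁺ {L = inj₂ _ ∷ L} (there b∈) = there (rights-∈⁺ b∈)
  rights-∈⁺ {L = inj₁ _ ∷ L} (there b∈) = rights-∈⁺ b∈

  length-lefts-rights : ∀ L → length (lefts L) ℕ.+ length (rights L) ≡ length L
  length-lefts-rights []           = refl
  length-lefts-rights (inj₁ _ ∷ L) = cong suc (length-lefts-rights L)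
  length-lefts-rights (inj₂ _ ∷ L) = trans (ℕₚ.+-suc (length (lefts L)) (length (rights L))) (cong suc (length-lefts-rights L))

  lefts-pairs : ∀ {R : A ⊎ B → A ⊎ B → Set} {L} → AllPairs R L → AllPairs (λ a a′ → R (inj₁ a) (inj₁ a′)) (lefts L)
  lefts-pairs {L = []}         []       = []
  lefts-pairs {L = inj₁ _ ∷ L} (r ∷ rs) = All.tabulate (λ a∈ → All.lookup r (lefts-∈⁻ L a∈)) ∷ lefts-pairs rs
  lefts-pairs {L = inj₂ _ ∷ L} (r ∷ rs) = lefts-pairs rs

  rights-pairs : ∀ {R : A ⊎ B → A ⊎ B → Set} {L} → AllPairs R L → AllPairs (λ b b′ → R (inj₂ b) (inj₂ b′)) (rights L)
  rights-pairs {L = []}         []       = []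
  rights-pairs {L = inj₂ _ ∷ L} (r ∷ rs) = All.tabulate (λ b∈ → All.lookup r (rights-∈⁻ L b∈)) ∷ rights-pairs rs
  rights-pairs {L = inj₁ _ ∷ L} (r ∷ rs) = rights-pairs rs

unordered : ∀ {V : Set} → List V → List (Pair V)
unordered []       = []
unordered (v ∷ Us) = star v Us ++ unordered Us

length-unordered : ∀ {V : Set} (Us : List V) → length (unordered Us) ≡ DegreesOfFreedom.tri (length Us)
length-unordered []       = refl
length-unordered (v ∷ Us) = trans (length-++ (star v Us)) (cong₂ ℕ._+_ (length-map (v ,_) Us) (length-unordered Us))

∈-unordered : ∀ {V : Set} {Us : List V} {u v} → u ≢ v → u ∈ Us → v ∈ Us → Any (SameEdge (u , v)) (unordered Us)
∈-unordered u≢v (here refl) (here refl) = ⊥-elim (u≢v refl)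
∈-unordered {Us = w ∷ Us} u≢v (here refl) (there v∈)  = Anyₚ.++⁺ˡ (lose (∈-map⁺ (w ,_) v∈) (inj₁ (refl , refl)))
∈-unordered {Us = w ∷ Us} u≢v (there u∈)  (here refl) = Anyₚ.++⁺ˡ (lose (∈-map⁺ (w ,_) u∈) (inj₂ (refl , refl)))
∈-unordered {Us = w ∷ Us} u≢v (there u∈)  (there v∈)  = Anyₚ.++⁺ʳ (star w Us) (∈-unordered u≢v u∈ v∈)

length-simple-≤ : ∀ {V : Set} {Us : List V} {L} → SimpleList L → All (EndsIn Us) L → length L ≤ DegreesOfFreedom.tri (length Us)
length-simple-≤ {Us = Us} simple inUs = ℕₚ.≤-trans
  (Matching.length-≤ (simple-apart simple) (All.zipWith (λ (u≢v , u∈ , v∈) → ∈-unordered u≢v u∈ v∈) (proj₁ simple , inUs)))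
  (ℕₚ.≤-reflexive (length-unordered Us))

-- Edge bounds inside one link

module LinkBounds {k : ℕ} (A : LV k → LV k → Set) (hinges : A hA hB × A hC hD)
  (independent : ∀ L → SimpleList L → All (AdjP (linkGraph k A)) L → IndepR3 (eqLV k) L)
  (nucleationFree : NucleationFree (linkMinusHinges k A))
  {U : List (LV k)} (uniq : Unique U) {E : List (Pair (LV k))} (simple : SimpleList E)
  (adjacent : All (AdjP (linkMinusHinges k A)) E) (inU : All (EndsIn U) E) where
  open DegreesOfFreedom using (tri)
  open Rank (finite-LV k) (eqLV k)

  indepE : IndepR3 (eqLV k) E
  indepE = independent E simple (All.map proj₁ adjacent)

  -- If the bound failed, `E` would have at least 3u - 6 edges. Being independent it would reach the
  -- full rank on `U`, a nucleation of the link without its hinges.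
  not-nucleation : 5 ≤ length U → length E ℕ.+ 7 ≤ length U ℕ.* 3
  not-nucleation 5≤U with length E ℕ.+ 7 ℕ.≤? length U ℕ.* 3
  ... | yes bound = bound
  ... | no ¬bound = ⊥-elim (nucleationFree U E uniq 5≤U simple (All.zipWith id (adjacent , inU)) rigid)
    where
    rigid : RigidWrt (eqLV k) (λ x → x ∈ U) (λ e → Any (SameEdge e) E)
    rigid L _ inU′ indL = E , simple , All.tabulate (λ e∈ → lose e∈ SameEdge-refl) , indepE ,
      ℕₚ.+-cancelʳ-≤ 6 (length L) (length E) (ℕₚ.≤-trans
        (rank-≤ {U} {L} uniq (ℕₚ.≤-trans (ℕₚ.m≤m+n 3 2) 5≤U) inU′ indL)
        (ℕₚ.≤-pred (ℕₚ.≤-trans (ℕₚ.≰⇒> ¬bound) (ℕₚ.≤-reflexive (ℕₚ.+-suc (length E) 6)))))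

  hinge₁-fresh : All (λ e → ¬ SameEdge (hA , hB) e) E
  hinge₁-fresh = All.map (λ { {x , y} (_ , ¬ab , _) same → ¬ab (SameEdge-sym same) }) adjacent

  hinge₂-fresh : All (λ e → ¬ SameEdge (hC , hD) e) E
  hinge₂-fresh = All.map (λ { {x , y} (_ , _ , ¬cd) same → ¬cd (SameEdge-sym same) }) adjacent

  simple₁ : SimpleList ((hA , hB) ∷ E)
  simple₁ = (λ ()) ∷ proj₁ simple , hinge₁-fresh ∷ proj₂ simple

  simple₂ : SimpleList ((hC , hD) ∷ E)
  simple₂ = (λ ()) ∷ proj₁ simple , hinge₂-fresh ∷ proj₂ simple

  all-pairs : length E ≤ tri (length U)
  all-pairs = length-simple-≤ simple inU

  -- The hinge edge is a pair inside `U` that `E` misses, so it can be counted as one more distinct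
  -- pair.
  one-hinge₁ : hA ∈ U → hB ∈ U → suc (length E) ≤ tri (length U)
  one-hinge₁ a∈ b∈ = length-simple-≤ simple₁ ((a∈ , b∈) ∷ inU)

  one-hinge₂ : hC ∈ U → hD ∈ U → suc (length E) ≤ tri (length U)
  one-hinge₂ c∈ d∈ = length-simple-≤ simple₂ ((c∈ , d∈) ∷ inU)

  -- Both hinge edges belong to the link though not to `E`. Adding them keeps independence, so the
  -- rank bound leaves 6 + 2 units.
  two-hinges : hA ∈ U → hB ∈ U → hC ∈ U → hD ∈ U → 3 ≤ length U → length E ℕ.+ 8 ≤ length U ℕ.* 3
  two-hinges a∈ b∈ c∈ d∈ 3≤U = ℕₚ.≤-trans (ℕₚ.≤-reflexive (trans (ℕₚ.+-suc (length E) 7) (cong suc (ℕₚ.+-suc (length E) 6))))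
      (rank-≤ {U} {F} uniq 3≤U ((a∈ , b∈) ∷ (c∈ , d∈) ∷ inU)
        (independent F simpleF (proj₁ hinges ∷ proj₂ hinges ∷ All.map proj₁ adjacent)))
    where
    F : List (Pair (LV k))
    F = (hA , hB) ∷ (hC , hD) ∷ E
    simpleF : SimpleList F
    simpleF = (λ ()) ∷ proj₁ simple₂ , ((λ { (inj₁ ()) ; (inj₂ ()) }) ∷ hinge₁-fresh) ∷ proj₂ simple₂

pairOf : ∀ {k} → Fin 2 → LV k
pairOf zero       = hA
pairOf (suc zero) = hB

pairOf′ : ∀ {k} → Fin 2 → LV k
pairOf′ zero       = hC
pairOf′ (suc zero) = hD

module Nucleations (m : ℕ) (7≤m : 7 ≤ m) (n : Fin m → ℕ) (G : (i : Fin m) → LV (n i) → LV (n i) → Set)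
    (irreflexive : (i : Fin m) (x : LV (n i)) → ¬ G i x x)
    (hinges : (i : Fin m) → G i hA hB × G i hC hD) (s : Fin m → Bool)
    (s-inj : (i j : Fin m) → deletedHinge s i ≡ deletedHinge s j → i ≡ j)
    (indepR : Independent (ring m n G))
    (linksFree : (i : Fin m) → NucleationFree (linkMinusHinges (n i) (G i))) where
  private
    2≤m : 2 ≤ m
    2≤m = ℕₚ.≤-trans (ℕₚ.m≤m+n 2 5) 7≤m
  open Rings m 2≤m n
  open DegreesOfFreedom

  link-independent : ∀ i L → SimpleList L → All (AdjP (linkGraph (n i) (G i))) L → IndepR3 (eqLV (n i)) L
  link-independent i L simple adj =
    let (p , ind) = indepR (map (mapPair (emb i)) L) (simple-map (ι-injective i) simple)
          (Allₚ.map⁺ (All.map (λ {e} a → i , proj₁ e , proj₂ e , a , refl , refl) adj))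
    in (λ v → p (emb i v)) , fromRowsIndep (eqLV (n i)) (λ v → p (emb i v)) L
         (indep-map⁻ (eqLV (n i)) eqV (emb i) (ι-injective i) (finite-LV (n i)) p L
           (toRowsIndep eqV p (map (mapPair (emb i)) L) ind))

  embed : ∀ i → LV (n i) → RV' m n
  embed i x = inj₁ (emb i x)

  -- An edge of the extended ring, sorted by its link: either an edge of the link that is not a hinge edge,
  -- or an edge from the new vertex to one of the four hinge vertices.
  EdgeClass : Set
  EdgeClass = Σ (Fin m) (λ i → Pair (LV (n i)) ⊎ Fin 4)

  realize : EdgeClass → Pair (RV' m n)
  realize (i , inj₁ (x , y)) = embed i x , embed i y
  realize (i , inj₂ q)       = inj₂ i , embed i (inj₁ q)

  Valid : EdgeClass → Set
  Valid (i , inj₁ e) = AdjP (linkMinusHinges (n i) (G i)) e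
  Valid (i , inj₂ q) = ⊤

  baseVertex : ∀ i {u : RV m n} → u ∈ baseVerts i → ∃ λ q → u ≡ emb i (inj₁ q)
  baseVertex i (here eq)                         = zero , eq
  baseVertex i (there (here eq))                 = suc zero , eq
  baseVertex i (there (there (here eq)))         = suc (suc zero) , eq
  baseVertex i (there (there (there (here eq)))) = suc (suc (suc zero)) , eq

  -- A surviving old edge is no hinge edge of its link, because every hinge is deleted, possibly by
  -- the extension of the neighbouring link; the pair `c`, `d` of link `i` is hinge `sucMod i`.
  classify : ∀ e → AdjP (ring' m n G s) e → ∃ λ c → Valid c × SameEdge e (realize c)
  classify (inj₁ u , inj₁ v) ((i , x , y , Gxy , refl , refl) , ¬deleted) =
      (i , inj₁ (x , y)) , (Gxy , notHinge i hA hB refl , notHinge (sucMod i) hC hD refl) , SameEdge-refl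
    where
    notHinge : ∀ j a b → (emb i a , emb i b) ≡ hingePair j → ¬ SameEdge (x , y) (a , b)
    notHinge j a b hinge same with injective⇒surjective (deletedHinge s) s-inj j
    ... | i′ , refl = ¬deleted i′ (subst (SameEdge (emb i x , emb i y)) hinge (SameEdge-map⁺ (emb i) same))
  classify (inj₁ u , inj₂ i) u∈ = let (q , u≡) = baseVertex i u∈ in (i , inj₂ q) , tt , inj₂ (cong inj₁ u≡ , refl)
  classify (inj₂ i , inj₁ u) u∈ = let (q , u≡) = baseVertex i u∈ in (i , inj₂ q) , tt , inj₁ (refl , cong inj₁ u≡)
  classify (inj₂ i , inj₂ j) ()

  -- A hinge vertex lies in two links but is filed once, under the link where it is `a` or `b`; the
  -- other link finds it at index `sucMod i`. The fibres then partition the vertex set.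
  VertexClass : Set
  VertexClass = Σ (Fin m) (λ i → Fin 2 ⊎ (Fin (n i) ⊎ ⊤))

  encode : RV' m n → VertexClass
  encode (inj₁ (inj₁ (i , ε))) = i , inj₁ ε
  encode (inj₁ (inj₂ (i , x))) = i , inj₂ (inj₁ x)
  encode (inj₂ i)              = i , inj₂ (inj₂ tt)

  decode : VertexClass → RV' m n
  decode (i , inj₁ ε)        = inj₁ (inj₁ (i , ε))
  decode (i , inj₂ (inj₁ x)) = inj₁ (inj₂ (i , x))
  decode (i , inj₂ (inj₂ _)) = inj₂ i

  decode-encode : ∀ v → decode (encode v) ≡ v
  decode-encode (inj₁ (inj₁ _)) = refl
  decode-encode (inj₁ (inj₂ _)) = refl
  decode-encode (inj₂ _)        = refl

  module Counting (Us : List (RV' m n)) (uniq : Unique Us) (5≤Us : 5 ≤ length Us)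
    (cs : List EdgeClass) (valid : All Valid cs) (distinct : AllPairs (λ c d → ¬ SameEdge (realize c) (realize d)) cs)
    (inUs : All (λ c → EndsIn Us (realize c)) cs) where

    classes : ∀ i → List (Fin 2 ⊎ (Fin (n i) ⊎ ⊤))
    classes i = component i (map encode Us)

    onHinge : Fin m → List (Fin 2)
    onHinge i = lefts (classes i)

    interior : ∀ i → List (Fin (n i))
    interior i = lefts (rights (classes i))

    new : Fin m → List ⊤
    new i = rights (rights (classes i))

    classes-unique : ∀ i → Unique (classes i)
    classes-unique i = AllPairs.map (λ i,b≢ b≡b′ → i,b≢ (cong (i ,_) b≡b′)) (component-pairs i
      (Uniqueₚ.map⁺ (λ {u} {v} eq → trans (sym (decode-encode u)) (trans (cong decode eq) (decode-encode v))) uniq))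

    onHinge-unique : ∀ i → Unique (onHinge i)
    onHinge-unique i = AllPairs.map (λ ≢ eq → ≢ (cong inj₁ eq)) (lefts-pairs (classes-unique i))

    rights-unique : ∀ i → Unique (rights (classes i))
    rights-unique i = AllPairs.map (λ ≢ eq → ≢ (cong inj₂ eq)) (rights-pairs (classes-unique i))

    interior-unique : ∀ i → Unique (interior i)
    interior-unique i = AllPairs.map (λ ≢ eq → ≢ (cong inj₁ eq)) (lefts-pairs (rights-unique i))

    new-unique : ∀ i → Unique (new i)
    new-unique i = AllPairs.map (λ ≢ eq → ≢ (cong inj₂ eq)) (rights-pairs (rights-unique i))

    ∈-onHinge : ∀ {i ε} → inj₁ (inj₁ (i , ε)) ∈ Us → ε ∈ onHinge i
    ∈-onHinge v∈ = lefts-∈⁺ (component-∈⁺ (∈-map⁺ encode v∈))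

    ∈-interior : ∀ {i x} → inj₁ (inj₂ (i , x)) ∈ Us → x ∈ interior i
    ∈-interior v∈ = lefts-∈⁺ (rights-∈⁺ (component-∈⁺ (∈-map⁺ encode v∈)))

    ∈-new : ∀ {i} → inj₂ i ∈ Us → tt ∈ new i
    ∈-new v∈ = rights-∈⁺ (rights-∈⁺ (component-∈⁺ (∈-map⁺ encode v∈)))

    ∈-Fin2 : ∀ (ε : Fin 2) → ε ∈ zero ∷ suc zero ∷ []
    ∈-Fin2 zero       = here refl
    ∈-Fin2 (suc zero) = there (here refl)

    onHinge≤2 : ∀ i → length (onHinge i) ≤ 2
    onHinge≤2 i = length-unique-≤ {L = zero ∷ suc zero ∷ []} (onHinge-unique i) (λ {ε} _ → ∈-Fin2 ε)

    new≤1 : ∀ i → length (new i) ≤ 1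
    new≤1 i = length-unique-≤ {L = tt ∷ []} (new-unique i) (λ _ → here refl)

    wholeHinge : ∀ i → isPair (length (onHinge i)) ≡ true → ∀ ε → ε ∈ onHinge i
    wholeHinge i pair ε = decidable-stable (Any.any? (ε ≟F_) (onHinge i)) λ ε∉ →
        tooLong (length (onHinge i)) pair (length-unique-≤ {L = zero ∷ suc zero ∷ []}
          (All.tabulate (λ e∈ ε≡ → ε∉ (subst (_∈ onHinge i) (sym ε≡) e∈)) ∷ onHinge-unique i) (λ {x} _ → ∈-Fin2 x))
      where
      tooLong : ∀ l → isPair l ≡ true → ¬ (suc l ≤ 2)
      tooLong 2 _ (s≤s (s≤s ()))

    linkVerts : ∀ i → List (LV (n i))
    linkVerts i = map pairOf (onHinge i) ++ map pairOf′ (onHinge (sucMod i)) ++ map inj₂ (interior i)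

    length-linkVerts : ∀ i → length (linkVerts i) ≡ length (onHinge i) ℕ.+ length (onHinge (sucMod i)) ℕ.+ length (interior i)
    length-linkVerts i = trans (length-++ (map pairOf (onHinge i)))
      (trans (cong₂ ℕ._+_ (length-map pairOf (onHinge i)) (trans (length-++ (map pairOf′ (onHinge (sucMod i))))
          (cong₂ ℕ._+_ (length-map pairOf′ (onHinge (sucMod i))) (length-map inj₂ (interior i)))))
        (sym (ℕₚ.+-assoc (length (onHinge i)) (length (onHinge (sucMod i))) (length (interior i)))))

    ∈-linkVerts₁ : ∀ i {ε} → ε ∈ onHinge i → pairOf ε ∈ linkVerts i
    ∈-linkVerts₁ i ε∈ = ∈-++⁺ˡ (∈-map⁺ pairOf ε∈)

    ∈-linkVerts₂ : ∀ i {ε} → ε ∈ onHinge (sucMod i) → pairOf′ ε ∈ linkVerts i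
    ∈-linkVerts₂ i ε∈ = ∈-++⁺ʳ (map pairOf (onHinge i)) (∈-++⁺ˡ (∈-map⁺ pairOf′ ε∈))

    ∈-linkVerts : ∀ i x → embed i x ∈ Us → x ∈ linkVerts i
    ∈-linkVerts i (inj₁ zero)                   v∈ = ∈-linkVerts₁ i (∈-onHinge v∈)
    ∈-linkVerts i (inj₁ (suc zero))             v∈ = ∈-linkVerts₁ i (∈-onHinge v∈)
    ∈-linkVerts i (inj₁ (suc (suc zero)))       v∈ = ∈-linkVerts₂ i (∈-onHinge v∈)
    ∈-linkVerts i (inj₁ (suc (suc (suc zero)))) v∈ = ∈-linkVerts₂ i (∈-onHinge v∈)
    ∈-linkVerts i (inj₂ x)                      v∈ =
      ∈-++⁺ʳ (map pairOf (onHinge i)) (∈-++⁺ʳ (map pairOf′ (onHinge (sucMod i))) (∈-map⁺ inj₂ (∈-interior v∈)))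

    linkVerts-unique : ∀ i → Unique (linkVerts i)
    linkVerts-unique i = AllPairsₚ.++⁺ (Uniqueₚ.map⁺ pairOf-injective (onHinge-unique i))
        (AllPairsₚ.++⁺ (Uniqueₚ.map⁺ pairOf′-injective (onHinge-unique (sucMod i)))
          (Uniqueₚ.map⁺ (λ { refl → refl }) (interior-unique i))
          (Allₚ.map⁺ (All.tabulate (λ {ε} _ → Allₚ.map⁺ (All.tabulate (λ {x} _ → pairOf′≢inj₂ ε x))))))
        (Allₚ.map⁺ (All.tabulate (λ {ε} _ → Allₚ.++⁺ {xs = map pairOf′ (onHinge (sucMod i))} (Allₚ.map⁺ (All.tabulate (λ {ε′} _ → pairOf≢pairOf′ ε ε′)))
          (Allₚ.map⁺ (All.tabulate (λ {x} _ → pairOf≢inj₂ ε x))))))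
      where
      pairOf-injective : ∀ {ε ε′} → pairOf {n i} ε ≡ pairOf ε′ → ε ≡ ε′
      pairOf-injective {zero}     {zero}     _ = refl
      pairOf-injective {zero}     {suc zero} ()
      pairOf-injective {suc zero} {zero}     ()
      pairOf-injective {suc zero} {suc zero} _ = refl
      pairOf′-injective : ∀ {ε ε′} → pairOf′ {n i} ε ≡ pairOf′ ε′ → ε ≡ ε′
      pairOf′-injective {zero}     {zero}     _ = refl
      pairOf′-injective {zero}     {suc zero} ()
      pairOf′-injective {suc zero} {zero}     ()
      pairOf′-injective {suc zero} {suc zero} _ = refl
      pairOf≢pairOf′ : ∀ ε ε′ → pairOf {n i} ε ≢ pairOf′ ε′
      pairOf≢pairOf′ zero       zero       ()
      pairOf≢pairOf′ zero       (suc zero) ()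
      pairOf≢pairOf′ (suc zero) zero       ()
      pairOf≢pairOf′ (suc zero) (suc zero) ()
      pairOf≢inj₂ : ∀ ε x → pairOf {n i} ε ≢ inj₂ x
      pairOf≢inj₂ zero       _ ()
      pairOf≢inj₂ (suc zero) _ ()
      pairOf′≢inj₂ : ∀ ε x → pairOf′ {n i} ε ≢ inj₂ x
      pairOf′≢inj₂ zero       _ ()
      pairOf′≢inj₂ (suc zero) _ ()

    edgesOf : ∀ i → List (Pair (LV (n i)) ⊎ Fin 4)
    edgesOf i = component i cs

    oldEdges : ∀ i → List (Pair (LV (n i)))
    oldEdges i = lefts (edgesOf i)

    newEdges : Fin m → List (Fin 4)
    newEdges i = rights (edgesOf i)

    old-∈ : ∀ {i e} → e ∈ oldEdges i → (i , inj₁ e) ∈ cs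
    old-∈ {i} e∈ = component-∈⁻ cs (lefts-∈⁻ (edgesOf i) e∈)

    new-∈ : ∀ {i q} → q ∈ newEdges i → (i , inj₂ q) ∈ cs
    new-∈ {i} q∈ = component-∈⁻ cs (rights-∈⁻ (edgesOf i) q∈)

    oldEdges-adj : ∀ i → All (AdjP (linkMinusHinges (n i) (G i))) (oldEdges i)
    oldEdges-adj i = All.tabulate (λ e∈ → All.lookup valid (old-∈ e∈))

    oldEdges-simple : ∀ i → SimpleList (oldEdges i)
    oldEdges-simple i =
        All.map (λ { {x , y} (Gxy , _) x≡y → irreflexive i x (subst (G i x) (sym x≡y) Gxy) }) (oldEdges-adj i) ,
        AllPairs.map (λ { {x , y} {x′ , y′} ¬same same → ¬same (SameEdge-map⁺ (embed i) same) })
          (lefts-pairs {R = λ b b′ → ¬ SameEdge (realize (i , b)) (realize (i , b′))} (component-pairs i distinct))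

    oldEdges-inside : ∀ i → All (EndsIn (linkVerts i)) (oldEdges i)
    oldEdges-inside i = All.tabulate (λ { {x , y} e∈ → let (u∈ , v∈) = All.lookup inUs (old-∈ e∈)
                                                       in ∈-linkVerts i x u∈ , ∈-linkVerts i y v∈ })

    newEdges-unique : ∀ i → Unique (newEdges i)
    newEdges-unique i = AllPairs.map (λ { ¬same refl → ¬same SameEdge-refl })
      (rights-pairs {R = λ b b′ → ¬ SameEdge (realize (i , b)) (realize (i , b′))} (component-pairs i distinct))

    first second : Fin 2 → Fin 4
    first zero        = zero
    first (suc zero)  = suc zero
    second zero       = suc (suc zero)
    second (suc zero) = suc (suc (suc zero))

    hingeEnds : Fin m → List (Fin 4)
    hingeEnds i = map first (onHinge i) ++ map second (onHinge (sucMod i))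

    ∈-hingeEnds : ∀ i q → embed i (inj₁ q) ∈ Us → q ∈ hingeEnds i
    ∈-hingeEnds i zero                   v∈ = ∈-++⁺ˡ (∈-map⁺ first (∈-onHinge v∈))
    ∈-hingeEnds i (suc zero)             v∈ = ∈-++⁺ˡ (∈-map⁺ first (∈-onHinge v∈))
    ∈-hingeEnds i (suc (suc zero))       v∈ = ∈-++⁺ʳ (map first (onHinge i)) (∈-map⁺ second (∈-onHinge v∈))
    ∈-hingeEnds i (suc (suc (suc zero))) v∈ = ∈-++⁺ʳ (map first (onHinge i)) (∈-map⁺ second (∈-onHinge v∈))

    -- If any new edge is met, its new end lies in `Us`, so the first factor is positive; and the
    -- new edges are told apart by their hinge ends.
    newEdges-length : ∀ i → length (newEdges i) ≤ length (new i) ℕ.* (length (onHinge i) ℕ.+ length (onHinge (sucMod i)))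
    newEdges-length i = bound (newEdges i) refl
      where
      a = length (onHinge i) ℕ.+ length (onHinge (sucMod i))
      few : length (newEdges i) ≤ a
      few = ℕₚ.≤-trans
        (length-unique-≤ {L = hingeEnds i} (newEdges-unique i) (λ {q} q∈ → ∈-hingeEnds i q (proj₂ (All.lookup inUs (new-∈ q∈)))))
        (ℕₚ.≤-reflexive (trans (length-++ (map first (onHinge i)))
          (cong₂ ℕ._+_ (length-map first (onHinge i)) (length-map second (onHinge (sucMod i))))))
      nonempty : ∀ {L : List ⊤} → tt ∈ L → 1 ≤ length L
      nonempty (here _)  = s≤s z≤n
      nonempty (there _) = s≤s z≤n
      bound : ∀ N → newEdges i ≡ N → length (newEdges i) ≤ length (new i) ℕ.* a
      bound []      eq = ℕₚ.≤-trans (ℕₚ.≤-reflexive (cong length eq)) z≤n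
      bound (q ∷ N) eq = ℕₚ.≤-trans few (ℕₚ.≤-trans (ℕₚ.≤-reflexive (sym (ℕₚ.*-identityˡ a)))
        (ℕₚ.*-monoˡ-≤ a (nonempty (∈-new (proj₁ (All.lookup inUs (new-∈ (subst (q ∈_) (sym eq) (here refl)))))))))

    count : ∀ i → LinkCount (length (onHinge i)) (length (onHinge (sucMod i)))
      (length (interior i) ℕ.+ length (new i)) (length (oldEdges i) ℕ.+ length (newEdges i))
    count i = linkCount (onHinge≤2 i) (onHinge≤2 (sucMod i)) (new≤1 i) (newEdges-length i)
        (subst (λ u → length (oldEdges i) ≤ tri u) len all-pairs)
        (λ pair → subst (λ u → suc (length (oldEdges i)) ≤ tri u) len (one pair))
        (λ both → subst (λ u → length (oldEdges i) ℕ.+ 8 ≤ u ℕ.* 3) len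
          (let (pair , pair′) = ∧-both (isPair h) (isPair h′) both in
            two-hinges (a∈ pair) (b∈ pair) (c∈ pair′) (d∈ pair′) (subst (3 ≤_) (sym len)
              (ℕₚ.≤-trans (ℕₚ.m≤m+n 3 1) (ℕₚ.≤-trans (pairs≥4 h h′ pair pair′) (ℕₚ.m≤m+n (h ℕ.+ h′) (length (interior i))))))))
        (λ 5≤ → subst (λ u → length (oldEdges i) ℕ.+ 7 ≤ u ℕ.* 3) len (not-nucleation (subst (5 ≤_) (sym len) 5≤)))
      where
      open LinkBounds (G i) (hinges i) (link-independent i) (linksFree i) (linkVerts-unique i)
        (oldEdges-simple i) (oldEdges-adj i) (oldEdges-inside i)
      len = length-linkVerts i
      h = length (onHinge i)
      h′ = length (onHinge (sucMod i))
      a∈ : isPair h ≡ true → hA ∈ linkVerts i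
      a∈ pair = ∈-linkVerts₁ i (wholeHinge i pair zero)
      b∈ : isPair h ≡ true → hB ∈ linkVerts i
      b∈ pair = ∈-linkVerts₁ i (wholeHinge i pair (suc zero))
      c∈ : isPair h′ ≡ true → hC ∈ linkVerts i
      c∈ pair = ∈-linkVerts₂ i (wholeHinge (sucMod i) pair zero)
      d∈ : isPair h′ ≡ true → hD ∈ linkVerts i
      d∈ pair = ∈-linkVerts₂ i (wholeHinge (sucMod i) pair (suc zero))
      one : isPair h ∨ isPair h′ ≡ true → suc (length (oldEdges i)) ≤ tri (length (linkVerts i))
      one = or (isPair h) (isPair h′) (λ pair → one-hinge₁ (a∈ pair) (b∈ pair)) (λ pair → one-hinge₂ (c∈ pair) (d∈ pair))
        where
        or : ∀ b b′ {P : Set} → (b ≡ true → P) → (b′ ≡ true → P) → b ∨ b′ ≡ true → P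
        or true  b′ f g _  = f refl
        or false b′ f g eq = g eq
      ∧-both : ∀ b b′ → b ∧ b′ ≡ true → b ≡ true × b′ ≡ true
      ∧-both true true _ = refl , refl
      pairs≥4 : ∀ h h′ → isPair h ≡ true → isPair h′ ≡ true → 4 ≤ h ℕ.+ h′
      pairs≥4 2 2 _ _ = ℕₚ.≤-refl

    vertexTotal : ∑ℕ (λ i → length (onHinge i)) ℕ.+ ∑ℕ (λ i → length (interior i) ℕ.+ length (new i)) ≡ length Us
    vertexTotal = trans (sym (Sum.∑-distrib-+ (λ i → length (onHinge i)) (λ i → length (interior i) ℕ.+ length (new i))))
      (trans (Sum.sum-cong-≗ (λ i → trans (cong (length (onHinge i) ℕ.+_) (length-lefts-rights (rights (classes i))))
          (length-lefts-rights (classes i))))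
        (trans (∑-component (map encode Us)) (length-map encode Us)))

    edgeTotal : ∑ℕ (λ i → length (oldEdges i) ℕ.+ length (newEdges i)) ≡ length cs
    edgeTotal = trans (Sum.sum-cong-≗ (λ i → length-lefts-rights (edgesOf i))) (∑-component cs)

    edge-bound : length cs ℕ.+ 7 ≤ length Us ℕ.* 3
    edge-bound = subst₂ (λ e u → e ℕ.+ 7 ≤ u ℕ.* 3) edgeTotal vertexTotal
      (ringCount 7≤m (λ i → length (onHinge i)) (λ i → length (interior i) ℕ.+ length (new i))
        (λ i → length (oldEdges i) ℕ.+ length (newEdges i)) count (subst (5 ≤_) (sym vertexTotal) 5≤Us))

  Classified : List (Pair (RV' m n)) → EdgeClass → Set
  Classified S c = Valid c × ∃ λ e → e ∈ S × SameEdge e (realize c)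

  -- Rigidity returns edges in arbitrary orientation. Replacing each by its form within a link keeps
  -- them distinct, since equal forms would come from the same edge, and so they can be counted link
  -- by link.
  classifyAll : ∀ S → AllPairs (λ e f → ¬ SameEdge e f) S → All (λ e → ∃ λ c → Valid c × SameEdge e (realize c)) S →
    ∃ λ cs → length cs ≡ length S × All (Classified S) cs × AllPairs (λ c d → ¬ SameEdge (realize c) (realize d)) cs
  classifyAll []      []              []                       = [] , refl , [] , []
  classifyAll (e ∷ S) (e∉ ∷ distinct) ((c , valid , same) ∷ cls) =
    let (cs , len , classified , distinct′) = classifyAll S distinct cls
    in c ∷ cs , cong suc len ,
       (valid , e , here refl , same) ∷ All.map (λ (v , f , f∈ , sf) → v , f , there f∈ , sf) classified ,
       All.map (λ (_ , f , f∈ , sf) c≈d →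
         All.lookup e∉ f∈ (SameEdge-trans same (SameEdge-trans c≈d (SameEdge-sym sf)))) classified ∷ distinct′

  ring'-nucleationFree : NucleationFree (ring' m n G s)
  ring'-nucleationFree Us Es uniq 5≤Us _ edges rigid =
    let (L , simpleL , inL , indL , lenL) = basis Us uniq (ℕₚ.≤-trans (ℕₚ.m≤m+n 3 2) 5≤Us)
        (S , simpleS , inS , _ , L≤S) = rigid L simpleL inL indL
        (cs , len , classified , distinct) = classifyAll S (proj₂ simpleS) (All.map class inS)
        bound = Counting.edge-bound Us uniq 5≤Us cs (All.map proj₁ classified) distinct
          (All.map (λ (_ , e , e∈ , same) → endsIn same (ends (All.lookup inS e∈))) classified)
    in ℕₚ.<-irrefl refl (begin-strict
      length Us ℕ.* 3  ≡⟨ sym lenL ⟩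
      length L ℕ.+ 6   ≤⟨ ℕₚ.+-monoˡ-≤ 6 (ℕₚ.≤-trans L≤S (ℕₚ.≤-reflexive (sym len))) ⟩
      length cs ℕ.+ 6  <⟨ ℕₚ.+-monoʳ-< (length cs) (ℕₚ.n<1+n 6) ⟩
      length cs ℕ.+ 7  ≤⟨ bound ⟩
      length Us ℕ.* 3  ∎)
    where
    open ℕₚ.≤-Reasoning
    open Rank (finite-RV' m n) eqV'
    endsIn : ∀ {e f} → SameEdge e f → EndsIn Us e → EndsIn Us f
    endsIn (inj₁ (refl , refl)) ends = ends
    endsIn (inj₂ (refl , refl)) (u∈ , v∈) = v∈ , u∈
    class : ∀ {e} → Any (SameEdge e) Es → ∃ λ c → Valid c × SameEdge e (realize c)
    class e∈ = let (f , f∈ , same) = find e∈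
                   (c , v , same′) = classify f (proj₁ (All.lookup edges f∈))
               in c , v , SameEdge-trans same same′
    ends : ∀ {e} → Any (SameEdge e) Es → EndsIn Us e
    ends e∈ = let (f , f∈ , same) = find e∈ in endsIn (SameEdge-sym same) (proj₂ (All.lookup edges f∈))

theorem3 : (m : ℕ) → 7 ≤ m →
    (n : Fin m → ℕ) (G : (i : Fin m) → LV (n i) → LV (n i) → Set) →
    ((i : Fin m) (x y : LV (n i)) → G i x y → G i y x) →
    ((i : Fin m) (x : LV (n i)) → ¬ G i x x) →
    ((i : Fin m) → G i hA hB × G i hC hD) →
    (s : Fin m → Bool) →
    ((i j : Fin m) → deletedHinge s i ≡ deletedHinge s j → i ≡ j) →
    Independent (ring m n G) →
    ((i : Fin m) → Rigid (linkGraph (n i) (G i))) →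
    ((i : Fin m) → NucleationFree (linkMinusHinges (n i) (G i))) →
    Independent (ring' m n G s) × NucleationFree (ring' m n G s) ×
    ((j : Fin m) → Implied (ring' m n G s) (hingePair' j))
theorem3 m 7≤m n G _ irreflexive hinges s s-inj indepR rigid linksFree =
    Extended.ring'-independent G hinges s s-inj indepR ,
    Nucleations.ring'-nucleationFree m 7≤m n G irreflexive hinges s s-inj indepR linksFree ,
    ImpliedHinges.hinge-implied m 2≤m n G hinges s s-inj indepR (λ i → linkBasis (rigid i))
  where
  2≤m : 2 ≤ m
  2≤m = ℕₚ.≤-trans (ℕₚ.m≤m+n 2 5) 7≤m
  open Rings m 2≤m n
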